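{- Let $\ell \ge r \ge 4$ and $t \ge 4$ be fixed integers. Then for all sufficiently large $n$, \[ \mathrm{ar}(n,H_{F}^{r}) = t_{r}(n,\ell) + 2 \quad\text{for all}\quad F\in \{K_{\ell}^{\alpha}[t],\ K_{\ell}^{\beta}[t],\ K_{\ell}^{\gamma}[t]\}. \]
   Context: An $r$-graph is a collection of $r$-subsets of a finite vertex set. $K_n^r$ is the complete $r$-graph on $[n]$. Given $\chi\colon K_n^r\to\mathbb{N}$, a subgraph is rainbow if no two of its edges receive the same color. $\mathrm{ar}(n,F)$ is the minimum $m$ such that every surjective map $\chi\colon K_n^r\to[m]$ contains a rainbow copy of the $r$-graph $F$. For a graph $F$, the expansion $H_F^r$ is the $r$-graph obtained from $F$ by adding to each edge a set of $r-2$ new vertices, different edges receiving disjoint new sets. $K_\ell[t]$ is the complete $\ell$-partite graph with all parts of size $t$. $K_\ell^\alpha[t]$ is obtained from $K_\ell[t]$ by adding a path with two edges inside one part; $K_\ell^\beta[t]$ by adding two disjoint edges inside one part; $K_\ell^\gamma[t]$ by adding two edges inside two different parts (one edge in each). Let $V_1\sqcup\cdots\sqcup V_\ell=[n]$ with $|V_\ell|+1\ge|V_1|\ge\cdots\ge|V_\ell|$; $T_r(n,\ell)$ is the $r$-graph of all $r$-subsets of $[n]$ containing at most one vertex from each $V_i$, and $t_r(n,\ell)$ is its number of edges. -}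

module Defs where

open import Data.Nat using (ℕ; zero; suc; _+_; _∸_; _*_; _%_; _≤_; _<_; _≡ᵇ_; _<ᵇ_; NonZero)
open import Data.Bool using (Bool; true; false; _∧_; _∨_; not; T)
open import Data.Fin using (Fin; toℕ; quotient; remainder)
open import Data.Fin.Subset using (Subset; _∈_; ∣_∣)
open import Data.Vec using (Vec; []; _∷_)
open import Data.List using (List; []; _∷_; map; _++_; length; filter; allFin)
open import Data.Product using (Σ; ∃; _×_; _,_; proj₁; proj₂)
open import Data.Sum using (_⊎_; inj₁; inj₂)
open import Relation.Binary.PropositionalEquality using (_≡_; _≢_)
open import Relation.Nullary using (¬_)
open import Function.Definitions using (Injective)
open import Function.Bundles using (_⇔_)
open import Relation.Nullary.Decidable using (T?)

record HGraph : Set₁ where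
  field
    V   : Set
    E   : Set
    Mem : E → V → Set
open HGraph public

-- A colouring of K_n^r with colours in [m] (= Fin m); only its values on
-- r-subsets matter.  It is surjective if every colour is used on some r-set.
SurjectiveColouring : (n r m : ℕ) → (Subset n → Fin m) → Set
SurjectiveColouring n r m χ = ∀ (c : Fin m) → ∃ λ (s : Subset n) → ∣ s ∣ ≡ r × χ s ≡ c

IsImage : ∀ {n} (H : HGraph) → (V H → Fin n) → E H → Subset n → Set
IsImage {n} H φ e s = ∀ (j : Fin n) → (j ∈ s) ⇔ (∃ λ (x : V H) → Mem H e x × φ x ≡ j)

RainbowCopy : ∀ {n m} (H : HGraph) → (Subset n → Fin m) → Set
RainbowCopy {n} H χ =
  Σ (V H → Fin n) λ φ → Injective _≡_ _≡_ φ ×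
    (∀ (e e′ : E H) (s s′ : Subset n) → e ≢ e′ →
       IsImage H φ e s → IsImage H φ e′ s′ → χ s ≢ χ s′)

ForcesRainbow : (n r : ℕ) (H : HGraph) (m : ℕ) → Set
ForcesRainbow n r H m =
  ∀ (χ : Subset n → Fin m) → SurjectiveColouring n r m χ → RainbowCopy H χ

ArEq : (n r : ℕ) (H : HGraph) (a : ℕ) → Set
ArEq n r H a = ForcesRainbow n r H a × (∀ m → 1 ≤ m → m < a → ¬ ForcesRainbow n r H m)

GEdge : (k : ℕ) → (Fin k → Fin k → Bool) → Set
GEdge k adj = Σ (Fin k × Fin k) λ p → T ((toℕ (proj₁ p) <ᵇ toℕ (proj₂ p)) ∧ adj (proj₁ p) (proj₂ p))

ExpMem : ∀ (r k : ℕ) (adj : Fin k → Fin k → Bool) →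
         GEdge k adj → Fin k ⊎ (GEdge k adj × Fin (r ∸ 2)) → Set
ExpMem r k adj ((u , w) , _) (inj₁ x) = x ≡ u ⊎ x ≡ w
ExpMem r k adj e (inj₂ (e′ , _)) = e′ ≡ e

Expansion : (r k : ℕ) → (Fin k → Fin k → Bool) → HGraph
Expansion r k adj = record
  { V   = Fin k ⊎ (GEdge k adj × Fin (r ∸ 2))
  ; E   = GEdge k adj
  ; Mem = ExpMem r k adj }

part : ∀ ℓ t → Fin (ℓ * t) → ℕ
part ℓ t x = toℕ (quotient {ℓ} t x)

pos : ∀ ℓ t → Fin (ℓ * t) → ℕ
pos ℓ t x = toℕ (remainder {ℓ} t x)

inPart : ∀ ℓ t (p a b : ℕ) → Fin (ℓ * t) → Fin (ℓ * t) → Bool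
inPart ℓ t p a b x y =
  (part ℓ t x ≡ᵇ p) ∧ (part ℓ t y ≡ᵇ p) ∧
  (((pos ℓ t x ≡ᵇ a) ∧ (pos ℓ t y ≡ᵇ b)) ∨ ((pos ℓ t x ≡ᵇ b) ∧ (pos ℓ t y ≡ᵇ a)))

Kadj : ∀ ℓ t → Fin (ℓ * t) → Fin (ℓ * t) → Bool
Kadj ℓ t x y = not (part ℓ t x ≡ᵇ part ℓ t y)

data Variant : Set where
  α β γ : Variant

-- α: path with two edges inside part 0;  β: two disjoint edges inside part 0;
-- γ: one edge inside part 0 and one edge inside part 1.
VarAdj : Variant → ∀ ℓ t → Fin (ℓ * t) → Fin (ℓ * t) → Bool
VarAdj α ℓ t x y = Kadj ℓ t x y ∨ inPart ℓ t 0 0 1 x y ∨ inPart ℓ t 0 1 2 x y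
VarAdj β ℓ t x y = Kadj ℓ t x y ∨ inPart ℓ t 0 0 1 x y ∨ inPart ℓ t 0 2 3 x y
VarAdj γ ℓ t x y = Kadj ℓ t x y ∨ inPart ℓ t 0 0 1 x y ∨ inPart ℓ t 1 0 1 x y

allSubsets : ∀ n → List (Subset n)
allSubsets zero    = [] ∷ []
allSubsets (suc n) = map (true ∷_) (allSubsets n) ++ map (false ∷_) (allSubsets n)

allB : ∀ {A : Set} → (A → Bool) → List A → Bool
allB p [] = true
allB p (x ∷ xs) = p x ∧ allB p xs

lookupB : ∀ {n} → Subset n → Fin n → Bool
lookupB (b ∷ _) Fin.zero = b
lookupB (_ ∷ s) (Fin.suc i) = lookupB s i

-- the balanced partition: vertex j lies in class (toℕ j mod ℓ); class sizes are
-- non-increasing in the class index and differ by at most one.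
crossing : ∀ {n} (ℓ : ℕ) .{{_ : NonZero ℓ}} → Subset n → Bool
crossing {n} ℓ s = allB (λ i → allB (λ j →
    not (lookupB s i ∧ lookupB s j ∧ (toℕ i <ᵇ toℕ j) ∧ ((toℕ i % ℓ) ≡ᵇ (toℕ j % ℓ))))
  (allFin n)) (allFin n)

-- t_r(n,ℓ) = number of r-subsets of Fin n meeting each class in at most one vertex.
-- (ℓ = 0 is a degenerate case never used; we set it to 0.)
turan : (r n ℓ : ℕ) → ℕ
turan r n zero = 0
turan r n (suc k) = length (filter (λ s → T? ((∣ s ∣ ≡ᵇ r) ∧ crossing (suc k) s)) (allSubsets n))

{-# OPTIONS --safe #-}

-- Lower bound: give the crossing r-sets of the Turán partition their own colours and all other r-sets one
-- further colour.  F contains two copies of K_{ℓ+1} without a common edge, each forced by pigeonhole to have an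
-- edge of the further colour.
--
-- Upper bound: let G contain one edge of each colour and call a pair heavy if its codegree in G exceeds a
-- constant times n^{r-3}; expansions of heavy pairs can be chosen greedily.  Hence a core K_ℓ[t] of heavy pairs
-- together with any two differently coloured r-sets through its two added edges yields a rainbow copy.
-- Deleting vertices of degree below t_r(n,ℓ) - t_r(n-1,ℓ) increases the surplus of colours, so G may be assumed
-- to have the minimum degree of the Turán graph.  All but O(n^{r-1}) edges of G are r-cliques of the
-- graph of heavy pairs, and the Moon–Moser inequalities, read downwards, show that on average over its ℓ-cliques
-- almost every vertex is joined to all but one vertex of the clique.  Blowing up such cliques (Erdős) gives
-- a large K_ℓ[T] which assigns a type i < ℓ to almost every vertex.  Without a rainbow copy, all r-sets containing
-- two vertices of the same type have the same colour; comparing degrees with the Turán graph then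
-- assigns every vertex to one of ℓ classes with the same property.  So at most one colour of G is
-- not crossing, and G has at most t_r(n,ℓ) + 1 edges.
module Submission where

open import Defs
open import Data.Bool using (Bool; true; false; T; not; _∧_; _∨_)
import Data.Bool.Properties as Bool
open import Data.Bool.Properties using (T-irrelevant)
open import Data.Empty using (⊥; ⊥-elim)
open import Data.Fin using (Fin; zero; suc; toℕ; fromℕ<; inject≤; punchIn; punchOut; remQuot; combine; _↑ˡ_; _↑ʳ_)
open import Data.Fin.Properties using (all?; any?; ¬∀⟶∃¬; pigeonhole; toℕ<n; toℕ-injective; toℕ-fromℕ<; inject≤-injective; punchIn-injective; punchInᵢ≢i; punchIn-punchOut; remQuot-combine; combine-remQuot; combine-injective; ↑ˡ-injective; ↑ʳ-injective; toℕ-↑ˡ; toℕ-↑ʳ) renaming (_≟_ to _≟ᶠ_; suc-injective to sucᶠ-injective)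
open import Data.Fin.Subset using (Subset; _∈_; _∉_; ∣_∣; _∪_; ⁅_⁆; inside; outside) renaming (⊥ to ∅)
open import Data.Fin.Subset.Properties using (_∈?_; anySubset?; drop-there; ⊆-antisym; ∣⊥∣≡0; ∉⊥; p⊆q⇒∣p∣≤∣q∣; ∣⁅x⁆∣≡1; x∈p∪q⁺; x∈⁅x⁆)
open import Data.List using (List; []; _∷_; map; _++_; length; filter; concatMap; lookup; allFin)
open import Data.List.Membership.Propositional using () renaming (_∈_ to _∈ˡ_)
open import Data.List.Membership.Propositional.Properties using (∈-map⁺; ∈-map⁻; ∈-++⁺ˡ; ∈-++⁺ʳ; ∈-lookup; ∈-filter⁻; ∈-filter⁺; ∈-allFin)
open import Data.List.Properties using (length-map; length-++)
import Data.List.Relation.Unary.All as All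
open import Data.List.Relation.Unary.All using ([]; _∷_)
import Data.List.Relation.Unary.All.Properties as AllP
open import Data.List.Relation.Unary.AllPairs using ([]; _∷_)
open import Data.List.Relation.Unary.Any using (here; there; index)
open import Data.List.Relation.Unary.Any.Properties using (lookup-index)
open import Data.List.Relation.Unary.Unique.Propositional using (Unique)
import Data.List.Relation.Unary.Unique.Propositional.Properties as UP
open import Data.Maybe using (Maybe; just; nothing)
import Data.Maybe.Properties as Maybe
open import Data.Nat using (ℕ; zero; suc; _+_; _*_; _∸_; _^_; _!; _≤_; _<_; _≡ᵇ_; _<ᵇ_; z≤n; s≤s; _≤?_; _<?_; >-nonZero)
open import Data.Nat.DivMod using (_%_; _/_; m%n<n; m≡m%n+[m/n]*n; [m+kn]%n≡m%n; m<n⇒m%n≡m; m/n*n≤m; n%n≡0)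
open import Data.Nat.Properties
open import Data.Nat.Tactic.RingSolver using (solve-∀)
open import Data.Product using (∃; _×_; _,_; proj₁; proj₂)
open import Data.Sum using (_⊎_; inj₁; inj₂; [_,_]′)
open import Data.Sum.Properties using (inj₁-injective)
open import Data.Unit using (⊤; tt)
import Data.Vec as Vec
open import Data.Vec using (Vec; []; _∷_; here; there; _[_]≔_; insertAt; removeAt)
open import Data.Vec.Properties using (≡-dec; insertAt-lookup; insertAt-punchIn; removeAt-punchOut; removeAt-insertAt; lookup∘tabulate; lookup⇒[]=; []=⇒lookup)
open import Function using (_∘_; id)
open import Function.Bundles using (Equivalence; mk⇔)
open import Function.Definitions using (Injective)
open import Relation.Binary.Definitions using (tri<; tri≈; tri>)
open import Relation.Binary.PropositionalEquality using (_≡_; _≢_; refl; sym; trans; cong; cong₂; subst; subst₂; ≢-sym)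
open import Relation.Nullary using (¬_; Dec; yes; no; does; contradiction)
open import Relation.Nullary.Decidable using (_×-dec_; _⊎-dec_; _→-dec_; ¬?; T?; map′; dec-true; decidable-stable)
open import Relation.Unary using (Decidable)

-- Two r-sets with a repeated type may intersect, and their pairs need not lie like the two added
-- edges of F, so their colours cannot be compared in one copy of F. Each is exchanged for a set of
-- its colour in a prescribed position of a common core, and the two new sets are compared with one
-- and the same set. It has to contain two pairs, which is the use of r ≥ 4. The comparison runs
-- twice: for the types, which leave a small proportion of the vertices undecided, and for the final
-- classes. In between, the minimum degree settles the undecided vertices: a vertex with few
-- neighbours in one class must see almost all of the others to reach this degree. Densities are
-- kept as inequalities between natural numbers. The errors are governed by constants chosen in the
-- order `J₂`, `J₁`, `Q`: deficits of order `n / J₂` for arbitrary vertices, the much smaller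
-- `n / J₁` for typed ones, and a proportion of order `1 / Q` of untyped vertices. Whether a rainbow
-- copy exists is a finite search, so the upper bound can be argued by contradiction.

private variable
  A B : Set
  n m k : ℕ

-- Finite sums and counting with indicator functions.

∑ : List A → (A → ℕ) → ℕ
∑ []       f = 0
∑ (x ∷ xs) f = f x + ∑ xs f

∑-cong : ∀ (xs : List A) {f g : A → ℕ} → (∀ x → f x ≡ g x) → ∑ xs f ≡ ∑ xs g
∑-cong []       e = refl
∑-cong (x ∷ xs) e = cong₂ _+_ (e x) (∑-cong xs e)

∑-mono : ∀ (xs : List A) {f g : A → ℕ} → (∀ x → f x ≤ g x) → ∑ xs f ≤ ∑ xs g
∑-mono []       e = z≤n
∑-mono (x ∷ xs) e = +-mono-≤ (e x) (∑-mono xs e)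

+-exchange : ∀ a b c d → (a + b) + (c + d) ≡ (a + c) + (b + d)
+-exchange a b c d = trans (+-assoc a b (c + d))
  (trans (cong (a +_) (trans (sym (+-assoc b c d)) (trans (cong (_+ d) (+-comm b c)) (+-assoc c b d))))
    (sym (+-assoc a c (b + d))))

∑-+ : ∀ (xs : List A) (f g : A → ℕ) → ∑ xs (λ x → f x + g x) ≡ ∑ xs f + ∑ xs g
∑-+ []       f g = refl
∑-+ (x ∷ xs) f g = trans (cong (f x + g x +_) (∑-+ xs f g)) (+-exchange (f x) (g x) _ _)

∑-*ˡ : ∀ (xs : List A) c (f : A → ℕ) → ∑ xs (λ x → c * f x) ≡ c * ∑ xs f
∑-*ˡ []       c f = sym (*-zeroʳ c)
∑-*ˡ (x ∷ xs) c f = trans (cong (c * f x +_) (∑-*ˡ xs c f)) (sym (*-distribˡ-+ c (f x) _))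

∑-*ʳ : ∀ (xs : List A) c (f : A → ℕ) → ∑ xs (λ x → f x * c) ≡ ∑ xs f * c
∑-*ʳ xs c f = trans (∑-cong xs (λ x → *-comm (f x) c)) (trans (∑-*ˡ xs c f) (*-comm c _))

∑-const : ∀ (xs : List A) c → ∑ xs (λ _ → c) ≡ length xs * c
∑-const []       c = refl
∑-const (x ∷ xs) c = cong (c +_) (∑-const xs c)

∑-zero : ∀ (xs : List A) → ∑ xs (λ _ → 0) ≡ 0
∑-zero xs = trans (∑-const xs 0) (*-zeroʳ (length xs))

∑-swap : ∀ (xs : List A) (ys : List B) (f : A → B → ℕ) →
  ∑ xs (λ x → ∑ ys (f x)) ≡ ∑ ys (λ y → ∑ xs (λ x → f x y))
∑-swap []       ys f = sym (∑-zero ys)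
∑-swap (x ∷ xs) ys f = trans (cong (∑ ys (f x) +_) (∑-swap xs ys f)) (sym (∑-+ ys (f x) _))

∑-++ : ∀ (xs ys : List A) (f : A → ℕ) → ∑ (xs ++ ys) f ≡ ∑ xs f + ∑ ys f
∑-++ []       ys f = refl
∑-++ (x ∷ xs) ys f = trans (cong (f x +_) (∑-++ xs ys f)) (sym (+-assoc (f x) _ _))

∑-map : ∀ (h : A → B) (xs : List A) (f : B → ℕ) → ∑ (map h xs) f ≡ ∑ xs (f ∘ h)
∑-map h []       f = refl
∑-map h (x ∷ xs) f = cong (f (h x) +_) (∑-map h xs f)

∑-concatMap : ∀ (h : A → List B) (xs : List A) (f : B → ℕ) → ∑ (concatMap h xs) f ≡ ∑ xs (λ x → ∑ (h x) f)
∑-concatMap h []       f = refl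
∑-concatMap h (x ∷ xs) f = trans (∑-++ (h x) _ f) (cong (∑ (h x) f +_) (∑-concatMap h xs f))

≤∑ : ∀ {xs : List A} {x} (f : A → ℕ) → x ∈ˡ xs → f x ≤ ∑ xs f
≤∑ f (here refl) = m≤m+n _ _
≤∑ f (there p)   = ≤-trans (≤∑ f p) (m≤n+m _ _)

∑-∃ : ∀ (xs : List A) (f : A → ℕ) → 0 < ∑ xs f → ∃ λ x → 0 < f x
∑-∃ (x ∷ xs) f p with f x in eq
... | suc _ = x , subst (0 <_) (sym eq) (s≤s z≤n)
... | zero  = ∑-∃ xs f p

-- Averaging with the division cleared: if `length xs * f x < K` held throughout, summing over `xs`
-- would contradict `K ≤ ∑ xs f`.
∑-pigeon : ∀ (xs : List A) (f : A → ℕ) K → 0 < length xs → K ≤ ∑ xs f → ∃ λ x → K ≤ length xs * f x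
∑-pigeon {A = A} xs f K 0<len K≤ = choose xs 0<len
  (≤-trans (≤-reflexive (∑-const xs K)) (≤-trans (*-monoʳ-≤ L K≤) (≤-reflexive (sym (∑-*ˡ xs L f)))))
  where
  L = length xs
  choose : ∀ (ys : List A) → 0 < length ys → ∑ ys (λ _ → K) ≤ ∑ ys (λ x → L * f x) → ∃ λ x → K ≤ L * f x
  choose (y ∷ ys) _ p with K ≤? L * f y
  ... | yes q = y , q
  choose (y ∷ [])      _ p | no q = contradiction (subst₂ _≤_ (+-identityʳ K) (+-identityʳ _) p) q
  choose (y ∷ z ∷ ys) _ p | no q = choose (z ∷ ys) (s≤s z≤n)
    (≮⇒≥ λ lt → <⇒≱ (+-mono-< (≰⇒> q) lt) p)

𝟙 : {P : Set} → Dec P → ℕ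
𝟙 (yes _) = 1
𝟙 (no _)  = 0

𝟙≤1 : {P : Set} (d : Dec P) → 𝟙 d ≤ 1
𝟙≤1 (yes _) = s≤s z≤n
𝟙≤1 (no _)  = z≤n

𝟙-yes : {P : Set} (d : Dec P) → P → 𝟙 d ≡ 1
𝟙-yes (yes _) p = refl
𝟙-yes (no ¬p) p = contradiction p ¬p

𝟙-no : {P : Set} (d : Dec P) → ¬ P → 𝟙 d ≡ 0
𝟙-no (yes p) ¬p = contradiction p ¬p
𝟙-no (no _)  ¬p = refl

𝟙-elim : {P : Set} (d : Dec P) → 0 < 𝟙 d → P
𝟙-elim (yes p) _ = p

𝟙-mono : {P Q : Set} (d : Dec P) (e : Dec Q) → (P → Q) → 𝟙 d ≤ 𝟙 e
𝟙-mono (yes p) e f = ≤-reflexive (sym (𝟙-yes e (f p)))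
𝟙-mono (no _)  e f = z≤n

𝟙-cong : {P Q : Set} (d : Dec P) (e : Dec Q) → (P → Q) → (Q → P) → 𝟙 d ≡ 𝟙 e
𝟙-cong d e f g = ≤-antisym (𝟙-mono d e f) (𝟙-mono e d g)

𝟙-× : {P Q : Set} (d : Dec P) (e : Dec Q) → 𝟙 (d ×-dec e) ≡ 𝟙 d * 𝟙 e
𝟙-× (yes _) (yes _) = refl
𝟙-× (yes _) (no _)  = refl
𝟙-× (no _)  e       = refl

# : List A → {P : A → Set} → Decidable P → ℕ
# xs P? = ∑ xs (λ x → 𝟙 (P? x))

#-mono : ∀ (xs : List A) {P Q : A → Set} (P? : Decidable P) (Q? : Decidable Q) →
  (∀ x → P x → Q x) → # xs P? ≤ # xs Q?
#-mono xs P? Q? f = ∑-mono xs λ x → 𝟙-mono (P? x) (Q? x) (f x)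

#-cong : ∀ (xs : List A) {P Q : A → Set} (P? : Decidable P) (Q? : Decidable Q) →
  (∀ x → P x → Q x) → (∀ x → Q x → P x) → # xs P? ≡ # xs Q?
#-cong xs P? Q? f g = ≤-antisym (#-mono xs P? Q? f) (#-mono xs Q? P? g)

#-⊎ : ∀ (xs : List A) {P Q R : A → Set} (P? : Decidable P) (Q? : Decidable Q) (R? : Decidable R) →
  (∀ x → P x → Q x ⊎ R x) → # xs P? ≤ # xs Q? + # xs R?
#-⊎ xs {P} {Q} {R} P? Q? R? f = ≤-trans (∑-mono xs g) (≤-reflexive (∑-+ xs _ _))
  where
  g : ∀ x → 𝟙 (P? x) ≤ 𝟙 (Q? x) + 𝟙 (R? x)
  g x with P? x
  ... | no _ = z≤n
  ... | yes p with f x p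
  ...   | inj₁ q = ≤-trans (≤-reflexive (sym (𝟙-yes (Q? x) q))) (m≤m+n _ _)
  ...   | inj₂ r = ≤-trans (≤-reflexive (sym (𝟙-yes (R? x) r))) (m≤n+m _ _)

#-⋃ : ∀ (xs : List A) (ys : List B) {P : A → Set} {Q : B → A → Set}
  (P? : Decidable P) (Q? : ∀ y → Decidable (Q y)) →
  (∀ x → P x → ∃ λ y → y ∈ˡ ys × Q y x) → # xs P? ≤ ∑ ys (λ y → # xs (Q? y))
#-⋃ xs ys P? Q? f = ≤-trans (∑-mono xs g) (≤-reflexive (∑-swap xs ys _))
  where
  g : ∀ x → 𝟙 (P? x) ≤ ∑ ys (λ y → 𝟙 (Q? y x))
  g x with P? x
  ... | no _ = z≤n
  ... | yes p with f x p
  ...   | y , y∈ , q = ≤-trans (≤-reflexive (sym (𝟙-yes (Q? y x) q))) (≤∑ (λ y → 𝟙 (Q? y x)) y∈)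

#-∃ : ∀ (xs : List A) {P : A → Set} (P? : Decidable P) → 0 < # xs P? → ∃ P
#-∃ xs P? p with ∑-∃ xs _ p
... | x , q = x , 𝟙-elim (P? x) q

#-≤-length : ∀ (xs : List A) {P : A → Set} (P? : Decidable P) → # xs P? ≤ length xs
#-≤-length xs P? = ≤-trans (∑-mono xs (λ x → 𝟙≤1 (P? x))) (≤-reflexive (trans (∑-const xs 1) (*-identityʳ _)))

#-¬ : ∀ (xs : List A) {P : A → Set} (P? : Decidable P) → length xs ≡ # xs P? + # xs (¬? ∘ P?)
#-¬ []       P? = refl
#-¬ (x ∷ xs) P? with P? x
... | yes _ = cong suc (#-¬ xs P?)
... | no _  = trans (cong suc (#-¬ xs P?)) (sym (+-suc (# xs P?) _))

#-filter : ∀ (xs : List A) {P : A → Set} (P? : Decidable P) → length (filter P? xs) ≡ # xs P?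
#-filter []       P? = refl
#-filter (x ∷ xs) P? with P? x
... | yes _ = cong suc (#-filter xs P?)
... | no _  = #-filter xs P?

lookup-unique : ∀ {xs : List A} → Unique xs → Injective _≡_ _≡_ (lookup xs)
lookup-unique {xs = x ∷ xs} (p ∷ u) {zero}  {zero}  e = refl
lookup-unique {xs = x ∷ xs} (p ∷ u) {zero}  {suc j} e = contradiction e (All.lookup p (∈-lookup j))
lookup-unique {xs = x ∷ xs} (p ∷ u) {suc i} {zero}  e = contradiction (sym e) (All.lookup p (∈-lookup i))
lookup-unique {xs = x ∷ xs} (p ∷ u) {suc i} {suc j} e = cong suc (lookup-unique u e)

#-enum : ∀ {xs : List A} → Unique xs → {P : A → Set} (P? : Decidable P) → m ≡ # xs P? →
  ∃ λ (f : Fin m → A) → Injective _≡_ _≡_ f × (∀ i → P (f i)) × (∀ x → x ∈ˡ xs → P x → ∃ λ i → f i ≡ x)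
#-enum {A = A} {xs = xs} u {P} P? refl = subst (λ m → ∃ λ (f : Fin m → A) → Injective _≡_ _≡_ f × (∀ i → P (f i)) × (∀ x → x ∈ˡ xs → P x → ∃ λ i → f i ≡ x))
  (#-filter xs P?)
  (lookup (filter P? xs) , lookup-unique (UP.filter⁺ P? u) ,
    (λ i → proj₂ (∈-filter⁻ P? {xs = xs} (∈-lookup i))) ,
    λ x x∈ px → let q = ∈-filter⁺ P? x∈ px in index q , sym (lookup-index q))

#-choose : ∀ {xs : List A} → Unique xs → {P : A → Set} (P? : Decidable P) → m ≤ # xs P? →
  ∃ λ (f : Fin m → A) → Injective _≡_ _≡_ f × (∀ i → P (f i))
#-choose u P? m≤ with #-enum u P? refl
... | f , inj , Pf , _ = (λ i → f (inject≤ i m≤)) , (λ e → inject≤-injective m≤ m≤ _ _ (inj e)) , λ i → Pf _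

fins : ∀ n → List (Fin n)
fins zero    = []
fins (suc n) = zero ∷ map suc (fins n)

∈-fins : (i : Fin n) → i ∈ˡ fins n
∈-fins zero    = here refl
∈-fins (suc i) = there (∈-map⁺ suc (∈-fins i))

length-fins : ∀ n → length (fins n) ≡ n
length-fins zero    = refl
length-fins (suc n) = cong suc (trans (length-map suc (fins n)) (length-fins n))

fins-unique : ∀ n → Unique (fins n)
fins-unique zero    = []
fins-unique (suc n) = AllP.map⁺ (All.universal (λ _ ()) (fins n)) ∷ UP.map⁺ sucᶠ-injective (fins-unique n)

∑-fins-suc : ∀ n (f : Fin (suc n) → ℕ) → ∑ (fins (suc n)) f ≡ f zero + ∑ (fins n) (f ∘ suc)
∑-fins-suc n f = cong (f zero +_) (∑-map suc (fins n) f)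

∑-fins-const : ∀ n c → ∑ (fins n) (λ _ → c) ≡ n * c
∑-fins-const n c = trans (∑-const (fins n) c) (cong (_* c) (length-fins n))

vecs : ∀ n s → List (Vec (Fin n) s)
vecs n zero    = [] ∷ []
vecs n (suc s) = concatMap (λ v → map (v ∷_) (vecs n s)) (fins n)

∑-vecs-suc : ∀ n s (f : Vec (Fin n) (suc s) → ℕ) →
  ∑ (vecs n (suc s)) f ≡ ∑ (fins n) (λ v → ∑ (vecs n s) (λ w → f (v ∷ w)))
∑-vecs-suc n s f = trans (∑-concatMap _ (fins n) f) (∑-cong (fins n) λ v → ∑-map (v ∷_) (vecs n s) f)

∑-vecs-const : ∀ n s c → ∑ (vecs n s) (λ _ → c) ≡ n ^ s * c
∑-vecs-const n zero    c = refl
∑-vecs-const n (suc s) c = trans (∑-vecs-suc n s _)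
  (trans (∑-cong (fins n) (λ _ → ∑-vecs-const n s c))
    (trans (∑-fins-const n _) (sym (*-assoc n (n ^ s) c))))

-- Singles out the coordinate `i` instead of the first one; the counts of cliques with one entry
-- removed rest on it.
∑-vecs-insert : ∀ n s (i : Fin (suc s)) (f : Vec (Fin n) (suc s) → ℕ) →
  ∑ (vecs n (suc s)) f ≡ ∑ (vecs n s) (λ w → ∑ (fins n) (λ v → f (insertAt w i v)))
∑-vecs-insert n s zero f = trans (∑-vecs-suc n s f) (∑-swap (fins n) (vecs n s) _)
∑-vecs-insert n (suc s) (suc i) f =
  trans (∑-vecs-suc n (suc s) f)
    (trans (∑-cong (fins n) λ u → ∑-vecs-insert n s i (λ w → f (u ∷ w)))
      (sym (∑-vecs-suc n s (λ w → ∑ (fins n) (λ v → f (insertAt w (suc i) v))))))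

sets : ∀ n → List (Subset n)
sets = allSubsets

∑-sets-suc : ∀ n (f : Subset (suc n) → ℕ) →
  ∑ (sets (suc n)) f ≡ ∑ (sets n) (f ∘ (inside ∷_)) + ∑ (sets n) (f ∘ (outside ∷_))
∑-sets-suc n f = trans (∑-++ (map (true ∷_) (sets n)) _ f)
  (cong₂ _+_ (∑-map (true ∷_) (sets n) f) (∑-map (false ∷_) (sets n) f))

∈-sets : (S : Subset n) → S ∈ˡ sets n
∈-sets []          = here refl
∈-sets (true ∷ S)  = ∈-++⁺ˡ (∈-map⁺ (true ∷_) (∈-sets S))
∈-sets (false ∷ S) = ∈-++⁺ʳ _ (∈-map⁺ (false ∷_) (∈-sets S))

length-sets : ∀ n → length (sets n) ≡ 2 ^ n
length-sets zero    = refl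
length-sets (suc n) = trans (length-++ (map (true ∷_) (sets n)))
  (cong₂ _+_ (trans (length-map _ (sets n)) (length-sets n))
    (trans (length-map _ (sets n)) (trans (length-sets n) (sym (+-identityʳ _)))))

sets-unique : ∀ n → Unique (sets n)
sets-unique zero    = [] ∷ []
sets-unique (suc n) = UP.++⁺ (UP.map⁺ (λ { refl → refl }) (sets-unique n)) (UP.map⁺ (λ { refl → refl }) (sets-unique n))
  λ (p , q) → disj (∈-map⁻ _ p) (∈-map⁻ _ q)
  where
  disj : ∀ {S : Subset (suc n)} → (∃ λ T → T ∈ˡ sets n × S ≡ true ∷ T) → (∃ λ T → T ∈ˡ sets n × S ≡ false ∷ T) → ⊥
  disj (_ , _ , refl) (_ , _ , ())

_≟ˢ_ : (S T : Subset n) → Dec (S ≡ T)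
_≟ˢ_ = ≡-dec Bool._≟_

#-sets≤1 : ∀ {n} {P : Subset n → Set} (P? : Decidable P) → (∀ S T → P S → P T → S ≡ T) → # (sets n) P? ≤ 1
#-sets≤1 {n} P? uniq with # (sets n) P? ≤? 1
... | yes p = p
... | no ¬p with #-choose {m = 2} (sets-unique n) P? (≰⇒> ¬p)
...   | f , inj , Pf with inj {zero} {suc zero} (uniq _ _ (Pf _) (Pf _))
...     | ()

-- Double counting of the pairs with `x ≡ f i`: each `i` occurs because `xs` is exhaustive, and by
-- injectivity an entry `x` belongs to at most one `i`.
#-inject : ∀ (_≟_ : (x y : A) → Dec (x ≡ y)) (xs : List A) → (∀ x → x ∈ˡ xs) →
  {P : A → Set} (P? : Decidable P) (f : Fin m → A) → Injective _≡_ _≡_ f → (∀ i → P (f i)) → m ≤ # xs P?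
#-inject {m = m} _≟_ xs full {P} P? f inj Pf = begin
  m  ≡⟨ trans (sym (*-identityʳ m)) (sym (∑-fins-const m 1)) ⟩
  ∑ (fins m) (λ _ → 1)  ≤⟨ ∑-mono (fins m) (λ i →
                                                            ≤-trans (≤-reflexive (sym (𝟙-yes (f i ≟ f i) refl)))
                                                              (≤∑ (λ x → 𝟙 (x ≟ f i)) (full (f i)))) ⟩
  ∑ (fins m) (λ i → ∑ xs (λ x → 𝟙 (x ≟ f i)))  ≡⟨ ∑-swap (fins m) xs _ ⟩
  ∑ xs (λ x → ∑ (fins m) (λ i → 𝟙 (x ≟ f i)))  ≤⟨ ∑-mono xs bound ⟩
  # xs P?  ∎
  where
  open ≤-Reasoning
  bound : ∀ x → ∑ (fins m) (λ i → 𝟙 (x ≟ f i)) ≤ 𝟙 (P? x)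
  bound x with # (fins m) (λ i → x ≟ f i) in eq
  ... | zero = z≤n
  ... | suc zero with #-∃ (fins m) (λ i → x ≟ f i) (subst (0 <_) (sym eq) (s≤s z≤n))
  ...   | i , refl = ≤-reflexive (sym (𝟙-yes (P? (f i)) (Pf i)))
  bound x | suc (suc k) with #-choose {m = 2} (fins-unique m) (λ i → x ≟ f i) (subst (2 ≤_) (sym eq) (s≤s (s≤s z≤n)))
  ... | g , ginj , Pg with ginj {zero} {suc zero} (inj (trans (sym (Pg zero)) (Pg (suc zero))))
  ...   | ()

-- Subsets of given size, and how many pass through given vertices.

add : Fin n → Subset n → Subset n
add v S = S [ v ]≔ inside

v∈add : ∀ (v : Fin n) S → v ∈ add v S
v∈add zero    (_ ∷ S) = here
v∈add (suc v) (_ ∷ S) = there (v∈add v S)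

⊆add : ∀ (v : Fin n) S {x} → x ∈ S → x ∈ add v S
⊆add zero    (_ ∷ S) here      = here
⊆add zero    (_ ∷ S) (there p) = there p
⊆add (suc v) (_ ∷ S) here      = here
⊆add (suc v) (_ ∷ S) (there p) = there (⊆add v S p)

∈add⁻ : ∀ (v : Fin n) S {x} → x ∈ add v S → x ≡ v ⊎ x ∈ S
∈add⁻ zero    (_ ∷ S) here      = inj₁ refl
∈add⁻ zero    (_ ∷ S) (there p) = inj₂ (there p)
∈add⁻ (suc v) (_ ∷ S) here      = inj₂ here
∈add⁻ (suc v) (_ ∷ S) (there p) with ∈add⁻ v S p
... | inj₁ refl = inj₁ refl
... | inj₂ q    = inj₂ (there q)

∣add∣ : ∀ (v : Fin n) S → v ∉ S → ∣ add v S ∣ ≡ suc ∣ S ∣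
∣add∣ zero    (true ∷ S)  v∉ = contradiction here v∉
∣add∣ zero    (false ∷ S) v∉ = refl
∣add∣ (suc v) (true ∷ S)  v∉ = cong suc (∣add∣ v S (v∉ ∘ there))
∣add∣ (suc v) (false ∷ S) v∉ = ∣add∣ v S (v∉ ∘ there)

∣add∣≤ : ∀ (v : Fin n) S → ∣ add v S ∣ ≤ suc ∣ S ∣
∣add∣≤ zero    (true ∷ S)  = n≤1+n _
∣add∣≤ zero    (false ∷ S) = ≤-refl
∣add∣≤ (suc v) (true ∷ S)  = s≤s (∣add∣≤ v S)
∣add∣≤ (suc v) (false ∷ S) = ∣add∣≤ v S

∣∪∣≤ : ∀ (p q : Subset n) → ∣ p ∪ q ∣ ≤ ∣ p ∣ + ∣ q ∣
∣∪∣≤ []          []          = z≤n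
∣∪∣≤ (true ∷ p)  (true ∷ q)  = s≤s (≤-trans (∣∪∣≤ p q) (+-monoʳ-≤ ∣ p ∣ (n≤1+n _)))
∣∪∣≤ (true ∷ p)  (false ∷ q) = s≤s (∣∪∣≤ p q)
∣∪∣≤ (false ∷ p) (true ∷ q)  = ≤-trans (s≤s (∣∪∣≤ p q)) (≤-reflexive (sym (+-suc ∣ p ∣ _)))
∣∪∣≤ (false ∷ p) (false ∷ q) = ∣∪∣≤ p q

∣∣-# : ∀ (S : Subset n) → ∣ S ∣ ≡ # (fins n) (_∈? S)
∣∣-# []          = refl
∣∣-# {suc n} (b ∷ S) = trans (step b) (sym (∑-fins-suc n (λ x → 𝟙 (x ∈? (b ∷ S)))))
  where
  tl : ∀ b → ∣ S ∣ ≡ ∑ (fins n) (λ x → 𝟙 (suc x ∈? (b ∷ S)))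
  tl b = trans (∣∣-# S) (#-cong (fins n) (_∈? S) (λ x → suc x ∈? (b ∷ S)) (λ _ → there) (λ _ → drop-there))
  step : ∀ b → ∣ b ∷ S ∣ ≡ 𝟙 (zero ∈? (b ∷ S)) + ∑ (fins n) (λ x → 𝟙 (suc x ∈? (b ∷ S)))
  step true  = cong suc (tl true)
  step false = tl false

-- Adding `v` is a bijection from the sets without `v` onto those with it. Both sides range over all
-- subsets, so that no link of `v` has to be constructed.
#-∋ : ∀ (v : Fin n) {P : Subset n → Set} (P? : Decidable P) →
  # (sets n) (λ S → v ∈? S ×-dec P? S) ≡ # (sets n) (λ S → ¬? (v ∈? S) ×-dec P? (add v S))
#-∋ {suc n} zero P? = trans (∑-sets-suc n _) (trans (trans (cong₂ _+_ l₁ l₂) (+-comm c 0)) (sym (trans (∑-sets-suc n _) (cong₂ _+_ r₁ r₂))))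
  where
  c = # (sets n) (P? ∘ (inside ∷_))
  l₁ : # (sets n) (λ S → zero ∈? (inside ∷ S) ×-dec P? (inside ∷ S)) ≡ c
  l₁ = #-cong (sets n) (λ S → zero ∈? (inside ∷ S) ×-dec P? (inside ∷ S)) (P? ∘ (inside ∷_)) (λ _ → proj₂) (λ _ p → here , p)
  l₂ : # (sets n) (λ S → zero ∈? (outside ∷ S) ×-dec P? (outside ∷ S)) ≡ 0
  l₂ = trans (∑-cong (sets n) (λ S → 𝟙-no (zero ∈? (outside ∷ S) ×-dec P? (outside ∷ S)) λ ())) (∑-zero (sets n))
  r₁ : # (sets n) (λ S → ¬? (zero ∈? (inside ∷ S)) ×-dec P? (inside ∷ S)) ≡ 0
  r₁ = trans (∑-cong (sets n) (λ S → 𝟙-no (¬? (zero ∈? (inside ∷ S)) ×-dec P? (inside ∷ S)) λ p → proj₁ p here)) (∑-zero (sets n))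
  r₂ : # (sets n) (λ S → ¬? (zero ∈? (outside ∷ S)) ×-dec P? (inside ∷ S)) ≡ c
  r₂ = #-cong (sets n) (λ S → ¬? (zero ∈? (outside ∷ S)) ×-dec P? (inside ∷ S)) (P? ∘ (inside ∷_)) (λ _ → proj₂) (λ _ p → (λ ()) , p)
#-∋ {suc n} (suc v) P? = trans (∑-sets-suc n _) (trans (cong₂ _+_ (step inside) (step outside)) (sym (∑-sets-suc n _)))
  where
  step : ∀ b → # (sets n) (λ S → suc v ∈? (b ∷ S) ×-dec P? (b ∷ S)) ≡
               # (sets n) (λ S → ¬? (suc v ∈? (b ∷ S)) ×-dec P? (b ∷ add v S))
  step b = trans
    (#-cong (sets n) (λ S → suc v ∈? (b ∷ S) ×-dec P? (b ∷ S)) (λ S → v ∈? S ×-dec P? (b ∷ S))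
      (λ _ (p , q) → drop-there p , q) (λ _ (p , q) → there p , q))
    (trans (#-∋ v (P? ∘ (b ∷_)))
      (#-cong (sets n) (λ S → ¬? (v ∈? S) ×-dec P? (b ∷ add v S)) (λ S → ¬? (suc v ∈? (b ∷ S)) ×-dec P? (b ∷ add v S))
        (λ _ (p , q) → p ∘ drop-there , q) (λ _ (p , q) → p ∘ there , q)))

_has_ : Subset n → ℕ → Set
S has k = ∣ S ∣ ≡ k

has? : ∀ k (S : Subset n) → Dec (S has k)
has? k S = ∣ S ∣ ≟ k

∋⁻ : ∀ k (v : Fin n) {P Q : Subset n → Set} (P? : Decidable P) (Q? : Decidable Q) →
  (∀ S → v ∉ S → P (add v S) → Q S) →
  # (sets n) (λ S → v ∈? S ×-dec (has? (suc k) S ×-dec P? S)) ≤ # (sets n) (λ S → has? k S ×-dec Q? S)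
∋⁻ {n} k v P? Q? f = ≤-trans (≤-reflexive (#-∋ v (λ S → has? (suc k) S ×-dec P? S)))
  (#-mono (sets n) (λ S → ¬? (v ∈? S) ×-dec (has? (suc k) (add v S) ×-dec P? (add v S))) (λ S → has? k S ×-dec Q? S)
    λ S (v∉ , h , p) → suc-injective (trans (sym (∣add∣ v S v∉)) h) , f S v∉ p)

∣∣>0⇒∃ : ∀ (S : Subset n) → 0 < ∣ S ∣ → ∃ (_∈ S)
∣∣>0⇒∃ {n} S p = #-∃ (fins n) (_∈? S) (subst (0 <_) (∣∣-# S) p)

∣∣≡0⇒∅ : ∀ (S : Subset n) → ∣ S ∣ ≡ 0 → S ≡ ∅
∣∣≡0⇒∅ []          _ = refl
∣∣≡0⇒∅ (false ∷ S) p = cong (false ∷_) (∣∣≡0⇒∅ S p)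

-- `n ^ k` stands in for the binomial coefficient: in the error terms only the order of magnitude
-- matters.
#-has≤ : ∀ n k → # (sets n) (has? {n} k) ≤ n ^ k
#-has≤ n zero = #-sets≤1 {n} (has? 0) λ S T p q → trans (∣∣≡0⇒∅ S p) (sym (∣∣≡0⇒∅ T q))
#-has≤ n (suc k) = begin
  # (sets n) (has? (suc k))  ≤⟨ #-⋃ (sets n) (fins n) (has? (suc k)) (λ v S → v ∈? S ×-dec (has? (suc k) S ×-dec has? (suc k) S))
    (λ S h → let v , v∈ = ∣∣>0⇒∃ S (subst (0 <_) (sym h) (s≤s z≤n)) in v , ∈-fins v , v∈ , h , h) ⟩
  ∑ (fins n) (λ v → # (sets n) (λ S → v ∈? S ×-dec (has? (suc k) S ×-dec has? (suc k) S))) ≤⟨ ∑-mono (fins n) (λ v →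
    ≤-trans (∋⁻ k v (has? (suc k)) (has? k) (λ S v∉ h → suc-injective (trans (sym (∣add∣ v S v∉)) h)))
            (≤-trans (#-mono (sets n) (λ S → has? k S ×-dec has? k S) (has? k) (λ _ → proj₁)) (#-has≤ n k))) ⟩
  ∑ (fins n) (λ v → n ^ k)  ≡⟨ ∑-fins-const n (n ^ k) ⟩
  n * n ^ k  ∎
  where open ≤-Reasoning

#-∋∋ : ∀ k {x y : Fin n} → x ≢ y → # (sets n) (λ S → x ∈? S ×-dec (has? (2 + k) S ×-dec y ∈? S)) ≤ n ^ k
#-∋∋ {n} k {x} {y} x≢y = begin
  # (sets n) (λ S → x ∈? S ×-dec (has? (2 + k) S ×-dec y ∈? S))  ≤⟨ ∋⁻ (suc k) x (y ∈?_) (y ∈?_) drop ⟩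
  # (sets n) (λ S → has? (1 + k) S ×-dec y ∈? S)  ≤⟨ #-mono (sets n) (λ S → has? (1 + k) S ×-dec y ∈? S)
    (λ S → y ∈? S ×-dec (has? (1 + k) S ×-dec y ∈? S)) (λ S (h , p) → p , h , p) ⟩
  # (sets n) (λ S → y ∈? S ×-dec (has? (1 + k) S ×-dec y ∈? S))  ≤⟨ ∋⁻ k y (y ∈?_) (λ S → y ∈? add y S) (λ S _ p → p) ⟩
  # (sets n) (λ S → has? k S ×-dec y ∈? add y S)  ≤⟨ #-mono (sets n) (λ S → has? k S ×-dec y ∈? add y S) (has? k) (λ _ → proj₁) ⟩
  # (sets n) (has? k)  ≤⟨ #-has≤ n k ⟩
  n ^ k  ∎
  where
  open ≤-Reasoning
  drop : ∀ S → x ∉ S → y ∈ add x S → y ∈ S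
  drop S _ p = [ (λ y≡x → contradiction (sym y≡x) x≢y) , id ]′ (∈add⁻ x S p)

-- With `r = 3 + k` this bounds by `n ^ (r ∸ 3)` the sets through a pair that are spoilt by one
-- further vertex; it is the yardstick for heavy pairs.
#-∋∋∋ : ∀ k {x y z : Fin n} → x ≢ y → x ≢ z → y ≢ z →
  # (sets n) (λ S → x ∈? S ×-dec (has? (3 + k) S ×-dec (y ∈? S ×-dec z ∈? S))) ≤ n ^ k
#-∋∋∋ {n} k {x} {y} {z} x≢y x≢z y≢z = begin
  # (sets n) (λ S → x ∈? S ×-dec (has? (3 + k) S ×-dec (y ∈? S ×-dec z ∈? S)))
    ≤⟨ ∋⁻ (2 + k) x (λ S → y ∈? S ×-dec z ∈? S) (λ S → y ∈? S ×-dec z ∈? S) (λ S _ (p , q) → drop x≢y S p , drop x≢z S q) ⟩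
  # (sets n) (λ S → has? (2 + k) S ×-dec (y ∈? S ×-dec z ∈? S))
    ≤⟨ #-mono (sets n) (λ S → has? (2 + k) S ×-dec (y ∈? S ×-dec z ∈? S)) (λ S → y ∈? S ×-dec (has? (2 + k) S ×-dec z ∈? S)) (λ S (h , p , q) → p , h , q) ⟩
  # (sets n) (λ S → y ∈? S ×-dec (has? (2 + k) S ×-dec z ∈? S))
    ≤⟨ #-∋∋ k y≢z ⟩
  n ^ k ∎
  where
  open ≤-Reasoning
  drop : ∀ {y} → x ≢ y → ∀ S → y ∈ add x S → y ∈ S
  drop x≢y S p = [ (λ y≡x → contradiction (sym y≡x) x≢y) , id ]′ (∈add⁻ x S p)

toSet : ∀ {s} → Vec (Fin n) s → Subset n
toSet []      = ∅
toSet (v ∷ w) = add v (toSet w)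

data Distinct {n} : ∀ {s} → Vec (Fin n) s → Set where
  []  : Distinct []
  _∷_ : ∀ {s v} {w : Vec (Fin n) s} → v ∉ toSet w → Distinct w → Distinct (v ∷ w)

distinct? : ∀ {s} (w : Vec (Fin n) s) → Dec (Distinct w)
distinct? []      = yes []
distinct? (v ∷ w) with v ∈? toSet w | distinct? w
... | yes p | _     = no λ { (q ∷ _) → q p }
... | no p  | yes d = yes (p ∷ d)
... | no _  | no d  = no λ { (_ ∷ e) → d e }

-- Induction on the first entry: a set of size `suc k` arises from each of its `suc k` elements `v`
-- and the remaining `k`-set. An inequality suffices, since ordered cliques only have to be bounded
-- from below.
orderings : ∀ k {P : Subset n → Set} (P? : Decidable P) →
  (k !) * # (sets n) (λ S → has? k S ×-dec P? S) ≤ # (vecs n k) (λ w → distinct? w ×-dec P? (toSet w))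
orderings {n} zero {P} P? = ≤-trans (≤-reflexive (+-identityʳ _)) step
  where
  step : # (sets n) (λ S → has? 0 S ×-dec P? S) ≤ 𝟙 (distinct? {n} [] ×-dec P? ∅) + 0
  step with P? ∅
  ... | yes p = #-sets≤1 (λ S → has? 0 S ×-dec P? S) λ S T (p , _) (q , _) → trans (∣∣≡0⇒∅ S p) (sym (∣∣≡0⇒∅ T q))
  ... | no ¬p = ≤-reflexive (trans (∑-cong (sets n) (λ S → 𝟙-no (has? 0 S ×-dec P? S) λ (h , p) → ¬p (subst P (∣∣≡0⇒∅ S h) p))) (∑-zero (sets n)))
orderings {n} (suc k) {P} P? = begin
  (suc k * (k !)) * # (sets n) Q?
    ≡⟨ cong (_* # (sets n) Q?) (*-comm (suc k) (k !)) ⟩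
  ((k !) * suc k) * # (sets n) Q?
    ≡⟨ *-assoc (k !) (suc k) _ ⟩
  (k !) * (suc k * # (sets n) Q?)
    ≡⟨ cong ((k !) *_) (sym (∑-*ˡ (sets n) (suc k) _)) ⟩
  (k !) * ∑ (sets n) (λ S → suc k * 𝟙 (Q? S))
    ≡⟨ cong ((k !) *_) (∑-cong (sets n) double) ⟩
  (k !) * ∑ (sets n) (λ S → ∑ (fins n) (λ v → 𝟙 (v ∈? S ×-dec Q? S)))
    ≡⟨ cong ((k !) *_) (∑-swap (sets n) (fins n) _) ⟩
  (k !) * ∑ (fins n) (λ v → # (sets n) (λ S → v ∈? S ×-dec Q? S))
    ≤⟨ *-monoʳ-≤ (k !) (∑-mono (fins n) λ v → ∋⁻ k v P? (λ S → ¬? (v ∈? S) ×-dec P? (add v S)) (λ S p q → p , q)) ⟩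
  (k !) * ∑ (fins n) (λ v → # (sets n) (λ S → has? k S ×-dec (¬? (v ∈? S) ×-dec P? (add v S))))
    ≡⟨ sym (∑-*ˡ (fins n) (k !) _) ⟩
  ∑ (fins n) (λ v → (k !) * # (sets n) (λ S → has? k S ×-dec (¬? (v ∈? S) ×-dec P? (add v S))))
    ≤⟨ ∑-mono (fins n) (λ v → ≤-trans (orderings k (λ S → ¬? (v ∈? S) ×-dec P? (add v S)))
         (#-mono (vecs n k) (λ w → distinct? w ×-dec (¬? (v ∈? toSet w) ×-dec P? (add v (toSet w)))) (λ w → distinct? (v ∷ w) ×-dec P? (toSet (v ∷ w)))
           λ w (d , p , q) → (p ∷ d) , q)) ⟩
  ∑ (fins n) (λ v → # (vecs n k) (λ w → distinct? (v ∷ w) ×-dec P? (toSet (v ∷ w))))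
    ≡⟨ sym (∑-vecs-suc n k _) ⟩
  # (vecs n (suc k)) (λ w → distinct? w ×-dec P? (toSet w)) ∎
  where
  open ≤-Reasoning
  Q? = λ S → has? (suc k) S ×-dec P? S
  double : ∀ S → suc k * 𝟙 (Q? S) ≡ ∑ (fins n) (λ v → 𝟙 (v ∈? S ×-dec Q? S))
  double S with Q? S
  ... | yes (h , p) = trans (*-identityʳ (suc k)) (trans (sym h) (trans (∣∣-# S)
          (#-cong (fins n) (_∈? S) (λ v → v ∈? S ×-dec yes (h , p)) (λ _ q → q , h , p) (λ _ → proj₁))))
  ... | no ¬q = trans (*-zeroʳ k) (sym (trans (∑-cong (fins n) (λ v → 𝟙-no (v ∈? S ×-dec no ¬q) (¬q ∘ proj₂))) (∑-zero (fins n))))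

#-preimage≤ : ∀ {M} (f : Fin M → Fin n) → Injective _≡_ _≡_ f → ∀ S → # (fins M) (λ m → f m ∈? S) ≤ ∣ S ∣
#-preimage≤ {n} {M} f inj S with #-enum (fins-unique M) (λ m → f m ∈? S) refl
... | g , ginj , Pg , _ = ≤-trans (#-inject _≟ᶠ_ (fins n) ∈-fins (_∈? S) (f ∘ g) (ginj ∘ inj) Pg) (≤-reflexive (sym (∣∣-# S)))

∃-∉ : ∀ (Z : Subset n) → ∣ Z ∣ < n → ∃ (_∉ Z)
∃-∉ {n} Z lt = #-∃ (fins n) (¬? ∘ (_∈? Z)) (≮⇒≥ λ { (s≤s z) → <⇒≢ lt (trans (∣∣-# Z)
  (trans (sym (trans (cong (# (fins n) (_∈? Z) +_) (n≤0⇒n≡0 z)) (+-identityʳ _))) (trans (sym (#-¬ (fins n) (_∈? Z))) (length-fins n)))) })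

-- The further elements are taken one at a time from outside `Z ∪ Y`, hence the room
-- `∣ Z ∣ + k ≤ n`. `Y` itself may meet `Z`.
extend : ∀ k (Y Z : Subset n) → ∣ Y ∣ ≤ k → ∣ Z ∣ + k ≤ n →
  ∃ λ T → (∀ {x} → x ∈ Y → x ∈ T) × ∣ T ∣ ≡ k × (∀ {x} → x ∈ T → x ∈ Y ⊎ x ∉ Z)
extend {n} k Y Z Y≤k Z+k≤n = go (k ∸ ∣ Y ∣) Y (m+[n∸m]≡n Y≤k)
  where
  go : ∀ d Y → ∣ Y ∣ + d ≡ k → ∃ λ T → (∀ {x} → x ∈ Y → x ∈ T) × ∣ T ∣ ≡ k × (∀ {x} → x ∈ T → x ∈ Y ⊎ x ∉ Z)
  go zero    Y e = Y , id , trans (sym (+-identityʳ _)) e , inj₁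
  go (suc d) Y e with ∃-∉ (Z ∪ Y) (≤-trans (s≤s (∣∪∣≤ Z Y)) (≤-trans (≤-reflexive (sym (+-suc ∣ Z ∣ ∣ Y ∣)))
                        (≤-trans (+-monoʳ-≤ ∣ Z ∣ (≤-trans (s≤s (m≤m+n ∣ Y ∣ d)) (≤-reflexive (trans (sym (+-suc ∣ Y ∣ d)) e)))) Z+k≤n)))
  ... | v , v∉ with go d (add v Y) (trans (cong (_+ d) (∣add∣ v Y (λ p → v∉ (x∈p∪q⁺ (inj₂ p))))) (trans (sym (+-suc ∣ Y ∣ d)) e))
  ...   | T , Y⊆T , hT , out = T , Y⊆T ∘ ⊆add v Y , hT , λ x∈ → fix (out x∈)
    where
    fix : ∀ {x} → x ∈ add v Y ⊎ x ∉ Z → x ∈ Y ⊎ x ∉ Z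
    fix (inj₂ q) = inj₂ q
    fix (inj₁ q) with ∈add⁻ v Y q
    ... | inj₁ refl = inj₂ λ p → v∉ (x∈p∪q⁺ (inj₁ p))
    ... | inj₂ p    = inj₁ p

-- Elementary symmetric polynomials and crossing sets.

-- The elementary symmetric polynomial of degree `s` in the variables `a`, expanded by whether the
-- first variable is used.
σ : ℕ → (Fin k → ℕ) → ℕ
σ zero a = 1
σ {zero}  (suc s) a = 0
σ {suc k} (suc s) a = σ (suc s) (a ∘ suc) + a zero * σ s (a ∘ suc)

σ-mono : ∀ s {a b : Fin k → ℕ} → (∀ i → a i ≤ b i) → σ s a ≤ σ s b
σ-mono zero p = ≤-refl
σ-mono {zero}  (suc s) p = z≤n
σ-mono {suc k} (suc s) p = +-mono-≤ (σ-mono (suc s) (p ∘ suc)) (*-mono-≤ (p zero) (σ-mono s (p ∘ suc)))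

σ-cong : ∀ s {a b : Fin k → ℕ} → (∀ i → a i ≡ b i) → σ s a ≡ σ s b
σ-cong s p = ≤-antisym (σ-mono s (≤-reflexive ∘ p)) (σ-mono s (≤-reflexive ∘ sym ∘ p))

σ-zero : ∀ s {a : Fin k → ℕ} → (∀ i → a i ≡ 0) → σ (suc s) a ≡ 0
σ-zero {zero}  s p = refl
σ-zero {suc k} s {a} p = cong₂ _+_ (σ-zero s (p ∘ suc)) (cong (_* σ s (a ∘ suc)) (p zero))

σ-at : ∀ s (a : Fin (suc k) → ℕ) c →
  σ (suc s) a ≡ σ (suc s) (a ∘ punchIn c) + a c * σ s (a ∘ punchIn c)
σ-at s a zero = refl
σ-at {suc k} zero a (suc c) = trans (cong (_+ a zero * 1) (σ-at zero (a ∘ suc) c))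
  (lemma (σ 1 (a ∘ suc ∘ punchIn c)) (a (suc c)) (a zero))
  where
  lemma : ∀ x y z → (x + y * 1) + z * 1 ≡ (x + z * 1) + y * 1
  lemma = solve-∀
σ-at {suc k} (suc s) a (suc c) = trans (cong₂ (λ x y → x + a zero * y) (σ-at (suc s) (a ∘ suc) c) (σ-at s (a ∘ suc) c))
  (lemma (σ (suc (suc s)) b) (σ (suc s) b) (σ s b) (a (suc c)) (a zero))
  where
  b = a ∘ suc ∘ punchIn c
  lemma : ∀ x y z u v → (x + u * y) + v * (y + u * z) ≡ (x + v * y) + u * (y + v * z)
  lemma = solve-∀

-- The polynomial is linear in each variable, with slope `σ s` in the remaining ones. In terms of
-- crossing sets the increment is the degree of a new vertex of class `c`.
σ-inc : ∀ s {a b : Fin (suc k) → ℕ} c → b c ≡ suc (a c) → (∀ d → d ≢ c → b d ≡ a d) →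
  σ (suc s) b ≡ σ (suc s) a + σ s (a ∘ punchIn c)
σ-inc s {a} {b} c p q = trans (σ-at s b c)
  (trans (cong₂ _+_ (σ-cong (suc s) off) (cong₂ _*_ p (σ-cong s off)))
    (trans (lemma (σ (suc s) (a ∘ punchIn c)) (a c) (σ s (a ∘ punchIn c)))
      (cong (_+ σ s (a ∘ punchIn c)) (sym (σ-at s a c)))))
  where
  off : ∀ i → b (punchIn c i) ≡ a (punchIn c i)
  off i = q _ (punchInᵢ≢i c i)
  lemma : ∀ x y z → x + suc y * z ≡ (x + y * z) + z
  lemma = solve-∀

σ-del : ∀ s {a b : Fin (suc k) → ℕ} c → b c ≡ 0 → (∀ d → d ≢ c → b d ≡ a d) → σ s b ≡ σ s (a ∘ punchIn c)
σ-del zero    c p q = refl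
σ-del (suc s) {a} {b} c p q = trans (σ-at s b c)
  (trans (cong₂ _+_ (σ-cong (suc s) (λ i → q _ (punchInᵢ≢i c i))) (cong (_* σ s (b ∘ punchIn c)) p)) (+-identityʳ _))

-- Classes are partial: a vertex with value `nothing` may not be used. So a class can be deleted,
-- and later the classes can be restricted to a neighbourhood.
Cross : (Fin n → Maybe (Fin k)) → Subset n → Set
Cross cls S = (∀ x → x ∈ S → cls x ≢ nothing) × (∀ x y → x ∈ S → y ∈ S → cls x ≡ cls y → x ≡ y)

_≟ᵐ_ : (c d : Maybe (Fin k)) → Dec (c ≡ d)
_≟ᵐ_ = Maybe.≡-dec _≟ᶠ_

cross? : (cls : Fin n → Maybe (Fin k)) (S : Subset n) → Dec (Cross cls S)
cross? cls S = all? (λ x → x ∈? S →-dec ¬? (cls x ≟ᵐ nothing)) ×-dec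
  all? (λ x → all? (λ y → x ∈? S →-dec (y ∈? S →-dec (cls x ≟ᵐ cls y →-dec x ≟ᶠ y))))

size : (Fin n → Maybe (Fin k)) → Fin k → ℕ
size {n} cls c = # (fins n) (λ x → cls x ≟ᵐ just c)

del : Fin k → (Fin n → Maybe (Fin k)) → Fin n → Maybe (Fin k)
del c cls x with cls x ≟ᵐ just c
... | yes _ = nothing
... | no _  = cls x

del-≡ : ∀ (c : Fin k) (cls : Fin n → Maybe (Fin k)) x → cls x ≢ just c → del c cls x ≡ cls x
del-≡ c cls x p with cls x ≟ᵐ just c
... | yes q = contradiction q p
... | no _  = refl

del-just : ∀ (c : Fin k) (cls : Fin n → Maybe (Fin k)) x {d} → del c cls x ≡ just d → cls x ≡ just d × d ≢ c
del-just c cls x e with cls x ≟ᵐ just c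
... | no ¬p = e , λ { refl → ¬p e }

del-cls : ∀ (c : Fin k) (cls : Fin n → Maybe (Fin k)) x → del c cls x ≢ nothing → cls x ≢ just c × del c cls x ≡ cls x
del-cls c cls x p with cls x ≟ᵐ just c
... | yes _ = contradiction refl p
... | no ¬q = ¬q , refl

size-suc : ∀ (cls : Fin (suc n) → Maybe (Fin k)) d → size cls d ≡ 𝟙 (cls zero ≟ᵐ just d) + size (cls ∘ suc) d
size-suc {n} cls d = ∑-fins-suc n (λ x → 𝟙 (cls x ≟ᵐ just d))

-- Induction on the vertices. If vertex `zero` is used, the rest of the set has to cross the classes
-- with that of `zero` deleted, which matches the expansion of `σ` at this class.
#-cross : ∀ s (cls : Fin n → Maybe (Fin k)) → # (sets n) (λ S → has? s S ×-dec cross? cls S) ≡ σ s (size cls)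
#-cross {n} zero cls = ≤-antisym
  (#-sets≤1 (λ S → has? 0 S ×-dec cross? cls S) λ S T (p , _) (q , _) → trans (∣∣≡0⇒∅ S p) (sym (∣∣≡0⇒∅ T q)))
  (≤-trans (≤-reflexive (sym (𝟙-yes (has? 0 (∅ {n}) ×-dec cross? cls ∅) (∣⊥∣≡0 n , (λ _ p → contradiction p ∉⊥) , λ _ _ p → contradiction p ∉⊥))))
    (≤∑ (λ S → 𝟙 (has? 0 S ×-dec cross? cls S)) (∈-sets ∅)))
#-cross {zero} {k} (suc s) cls = sym (σ-zero s {size cls} λ _ → refl)
#-cross {suc n} {k} (suc s) cls = trans (∑-sets-suc n _) (trans (cong₂ _+_ refl out) (step (cls zero) refl))
  where
  cls′ = cls ∘ suc
  out : # (sets n) (λ S → has? (suc s) (outside ∷ S) ×-dec cross? cls (outside ∷ S)) ≡ σ (suc s) (size cls′)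
  out = trans (#-cong (sets n) (λ S → has? (suc s) (outside ∷ S) ×-dec cross? cls (outside ∷ S)) (λ S → has? (suc s) S ×-dec cross? cls′ S)
      (λ S (h , p , q) → h , (λ x x∈ → p (suc x) (there x∈)) , λ x y x∈ y∈ e → sucᶠ-injective (q _ _ (there x∈) (there y∈) e))
      (λ S (h , p , q) → h , (λ { (suc x) (there x∈) → p x x∈ }) , λ { (suc x) (suc y) (there x∈) (there y∈) e → cong suc (q x y x∈ y∈ e) }))
    (#-cross (suc s) cls′)
  in-count = # (sets n) (λ S → has? (suc s) (inside ∷ S) ×-dec cross? cls (inside ∷ S))
  step : ∀ c → cls zero ≡ c → in-count + σ (suc s) (size cls′) ≡ σ (suc s) (size cls)
  step nothing e = cong₂ _+_
      (trans (∑-cong (sets n) (λ S → 𝟙-no (has? (suc s) (inside ∷ S) ×-dec cross? cls (inside ∷ S)) λ (_ , p , _) → p zero here e)) (∑-zero (sets n)))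
      (σ-cong (suc s) (λ d → sym (trans (size-suc cls d) (cong (_+ size cls′ d) (𝟙-no (cls zero ≟ᵐ just d) λ q → contradiction (trans (sym e) q) λ ())))))
  step (just c) e = same c e cls′ refl
    where
    -- The number of classes is a variable here, so that the existence of `c` can turn it into a
    -- successor.
    same : ∀ {k} (c : Fin k) → {cls : Fin (suc n) → Maybe (Fin k)} → cls zero ≡ just c → ∀ cls′ → cls′ ≡ cls ∘ suc →
      # (sets n) (λ S → has? (suc s) (inside ∷ S) ×-dec cross? cls (inside ∷ S)) + σ (suc s) (size cls′) ≡ σ (suc s) (size cls)
    same {suc k} c {cls} e cls′ refl = trans (+-comm _ (σ (suc s) (size cls′)))
      (trans (cong (σ (suc s) (size cls′) +_) inn)
        (sym (σ-inc s c (trans (size-suc cls c) (cong (_+ size cls′ c) (𝟙-yes (cls zero ≟ᵐ just c) e)))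
          λ d d≢c → trans (size-suc cls d) (cong (_+ size cls′ d) (𝟙-no (cls zero ≟ᵐ just d) λ q → d≢c (sym (Maybe.just-injective (trans (sym e) q))))))))
      where
      inn : # (sets n) (λ S → has? (suc s) (inside ∷ S) ×-dec cross? cls (inside ∷ S)) ≡ σ s (size cls′ ∘ punchIn c)
      inn = trans (#-cong (sets n) (λ S → has? (suc s) (inside ∷ S) ×-dec cross? cls (inside ∷ S)) (λ S → has? s S ×-dec cross? (del c cls′) S)
          (λ S (h , p , q) →
            let ≢c : ∀ x → x ∈ S → cls′ x ≢ just c
                ≢c x x∈ r = contradiction (q zero (suc x) here (there x∈) (trans e (sym r))) λ ()
            in suc-injective h , (λ x x∈ r → p (suc x) (there x∈) (trans (sym (del-≡ c cls′ x (≢c x x∈))) r)) ,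
               λ x y x∈ y∈ r → sucᶠ-injective (q _ _ (there x∈) (there y∈)
                 (trans (sym (del-≡ c cls′ x (≢c x x∈))) (trans r (del-≡ c cls′ y (≢c y y∈))))))
          (λ S (h , p , q) → cong suc h ,
            (λ { zero _ r → contradiction (trans (sym e) r) (λ ())
               ; (suc x) (there x∈) r → p x x∈ (trans (proj₂ (del-cls c cls′ x (p x x∈))) r) }) ,
            λ { zero zero _ _ _ → refl
              ; zero (suc y) _ (there y∈) r → contradiction (trans (sym r) e) (proj₁ (del-cls c cls′ y (p y y∈)))
              ; (suc x) zero (there x∈) _ r → contradiction (trans r e) (proj₁ (del-cls c cls′ x (p x x∈)))
              ; (suc x) (suc y) (there x∈) (there y∈) r → cong suc (q x y x∈ y∈
                  (trans (proj₂ (del-cls c cls′ x (p x x∈))) (trans r (sym (proj₂ (del-cls c cls′ y (p y y∈))))))) }))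
        (trans (#-cross s (del c cls′))
          (σ-del s c
            (trans (∑-cong (fins n) (λ x → 𝟙-no (del c cls′ x ≟ᵐ just c) λ r → proj₂ (del-just c cls′ x r) refl)) (∑-zero (fins n)))
            λ d d≢c → #-cong (fins n) (λ x → del c cls′ x ≟ᵐ just d) (λ x → cls′ x ≟ᵐ just d)
              (λ x r → proj₁ (del-just c cls′ x r))
              (λ x r → trans (del-≡ c cls′ x (λ r′ → d≢c (Maybe.just-injective (trans (sym r) r′)))) r)))

-- Balanced partitions maximise the number of crossing sets.

Balanced : (Fin k → ℕ) → Set
Balanced b = ∀ i j → b i ≤ suc (b j)

∑-at : ∀ (a : Fin (suc k) → ℕ) c → ∑ (fins (suc k)) a ≡ a c + ∑ (fins k) (a ∘ punchIn c)
∑-at {k} a zero = ∑-fins-suc k a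
∑-at {suc k} a (suc c) = trans (∑-fins-suc (suc k) a)
  (trans (cong (a zero +_) (∑-at (a ∘ suc) c))
    (trans (lemma (a zero) (a (suc c)) _)
      (cong (a (suc c) +_) (sym (∑-fins-suc k (a ∘ punchIn (suc c)))))))
  where
  lemma : ∀ x y z → x + (y + z) ≡ y + (x + z)
  lemma = solve-∀

argmax : ∀ (a : Fin (suc k) → ℕ) → ∃ λ c → ∀ i → a i ≤ a c
argmax {zero}  a = zero , λ { zero → ≤-refl }
argmax {suc k} a with argmax (a ∘ suc)
... | c , p with a zero ≤? a (suc c)
...   | yes q = suc c , λ { zero → q ; (suc i) → p i }
...   | no q  = zero , λ { zero → ≤-refl ; (suc i) → ≤-trans (p i) (<⇒≤ (≰⇒> q)) }

dec : Fin k → (Fin k → ℕ) → Fin k → ℕ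
dec c a i with i ≟ᶠ c
... | yes _ = a i ∸ 1
... | no _  = a i

dec-at : ∀ (c : Fin k) a → dec c a c ≡ a c ∸ 1
dec-at c a with c ≟ᶠ c
... | yes _ = refl
... | no p  = contradiction refl p

dec-off : ∀ (c : Fin k) a i → i ≢ c → dec c a i ≡ a i
dec-off c a i p with i ≟ᶠ c
... | yes q = contradiction q p
... | no _  = refl

dec≤ : ∀ (c : Fin k) a i → dec c a i ≤ a i
dec≤ c a i with i ≟ᶠ c
... | yes _ = m∸n≤m (a i) 1
... | no _  = ≤-refl

∑-dec : ∀ (c : Fin (suc k)) a → 0 < a c → ∑ (fins (suc k)) a ≡ suc (∑ (fins (suc k)) (dec c a))
∑-dec {k} c a p = trans (∑-at a c) (trans (cong₂ _+_ (sym (m+[n∸m]≡n p)) refl)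
  (cong suc (sym (trans (∑-at (dec c a) c) (cong₂ _+_ (dec-at c a) (∑-cong (fins k) λ i → dec-off c a _ (punchInᵢ≢i c i)))))))

σ-dec : ∀ s (c : Fin (suc k)) a → 0 < a c → σ (suc s) a ≡ σ (suc s) (dec c a) + σ s (a ∘ punchIn c)
σ-dec s c a p = trans (σ-inc s c (trans (sym (m+[n∸m]≡n p)) (cong suc (sym (dec-at c a)))) (λ d d≢c → sym (dec-off c a d d≢c)))
  (cong (σ (suc s) (dec c a) +_) (σ-cong s λ i → dec-off c a _ (punchInᵢ≢i c i)))

Balanced-dec : ∀ (c : Fin k) {b} → (∀ i → b i ≤ b c) → Balanced b → Balanced (dec c b)
Balanced-dec c {b} max bal i j with j ≟ᶠ c
... | no _     = ≤-trans (dec≤ c b i) (bal i j)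
... | yes refl with i ≟ᶠ c
...   | yes refl = n≤1+n _
...   | no _     = ≤-trans (max i) (m≤n+m∸n (b c) 1)

-- Compare a and b by removing one element of a largest part of each: the largest part of a
-- is at least that of the balanced b.
σ-balanced : ∀ s {a b : Fin k → ℕ} → Balanced b → ∑ (fins k) a ≤ ∑ (fins k) b → σ s a ≤ σ s b
σ-balanced {k} s {a} {b} = go k (∑ (fins k) b) s a b ≤-refl
  where
  go : ∀ k N s (a b : Fin k → ℕ) → ∑ (fins k) b ≤ N → Balanced b → ∑ (fins k) a ≤ ∑ (fins k) b → σ s a ≤ σ s b
  go k N zero a b _ _ _ = ≤-refl
  go zero N (suc s) a b _ _ _ = z≤n
  go (suc k) zero (suc s) a b b≤N bal a≤b = σ-mono (suc s) {a} {b} λ i →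
    ≤-trans (≤∑ a (∈-fins i)) (≤-trans a≤b (≤-trans b≤N z≤n))
  go (suc k) (suc N) (suc s) a b b≤N bal a≤b with argmax b | argmax a
  ... | d , maxb | c , maxa with b d in bd
  ...   | zero = σ-mono (suc s) {a} {b} λ i → ≤-trans (≤∑ a (∈-fins i)) (≤-trans a≤b (≤-trans (∑-mono (fins (suc k)) maxb) (≤-trans (≤-reflexive (∑-zero (fins (suc k)))) z≤n)))
  ...   | suc m with m≤n⇒m<n∨m≡n a≤b
  -- If the sums differ, only `b` loses an element; the induction runs on the bound `N` for the sum
  -- of `b`.
  ...     | inj₁ a<b = ≤-trans (go (suc k) N (suc s) a (dec d b) (≤-pred (≤-trans (≤-reflexive (sym eb)) b≤N))
                          (Balanced-dec d (λ i → ≤-trans (maxb i) (≤-reflexive (sym bd))) bal) (≤-pred (≤-trans a<b (≤-reflexive eb))))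
                        (σ-mono (suc s) {dec d b} {b} (dec≤ d b))
    where
    eb = ∑-dec d b (subst (0 <_) (sym bd) (s≤s z≤n))
  ...     | inj₂ a≡b = begin
    σ (suc s) a  ≡⟨ σ-dec s c a 0<ac ⟩
    σ (suc s) (dec c a) + σ s (a ∘ punchIn c)  ≤⟨ +-mono-≤
      (go (suc k) N (suc s) (dec c a) (dec d b) (≤-pred (≤-trans (≤-reflexive (sym eb)) b≤N))
         (Balanced-dec d (λ i → ≤-trans (maxb i) (≤-reflexive (sym bd))) bal)
         (≤-reflexive (suc-injective (trans (sym ea) (trans a≡b eb)))))
      (go k N s (a ∘ punchIn c) (b ∘ punchIn d)
         (≤-pred (≤-trans (≤-trans (+-monoˡ-≤ _ (subst (1 ≤_) (sym bd) (s≤s z≤n))) (≤-reflexive (sym (∑-at b d)))) b≤N))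
         (λ i j → bal _ _)
         (+-cancelˡ-≤ (b d) _ _ (≤-trans (+-monoˡ-≤ _ (≤-trans (≤-reflexive bd) ac≥)) (≤-reflexive (trans (sym (∑-at a c)) (trans a≡b (∑-at b d))))))) ⟩
    σ (suc s) (dec d b) + σ s (b ∘ punchIn d)  ≡⟨ sym (σ-dec s d b 0<bd) ⟩
    σ (suc s) b  ∎
    where
    open ≤-Reasoning
    0<bd : 0 < b d
    0<bd = subst (0 <_) (sym bd) (s≤s z≤n)
    eb = ∑-dec d b 0<bd
    -- Otherwise all parts of `a` are at most `m`, while all parts of `b` are at least `m` and `b d`
    -- exceeds it, against the equality of the sums.
    ac≥ : suc m ≤ a c
    ac≥ = ≮⇒≥ λ lt → <-irrefl a≡b (begin-strict
      ∑ (fins (suc k)) a  ≡⟨ ∑-at a d ⟩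
      a d + ∑ (fins k) (a ∘ punchIn d)  <⟨ +-mono-<-≤ (≤-<-trans (maxa d) (<-≤-trans lt (≤-reflexive (sym bd))))
                                              (∑-mono (fins k) λ i → ≤-trans (maxa _) (≤-trans (≤-pred lt) (≤-pred (≤-trans (≤-reflexive (sym bd)) (bal d _))))) ⟩
      b d + ∑ (fins k) (b ∘ punchIn d)  ≡⟨ sym (∑-at b d) ⟩
      ∑ (fins (suc k)) b  ∎)
    0<ac : 0 < a c
    0<ac = ≤-trans (s≤s z≤n) ac≥
    ea = ∑-dec c a 0<ac

∑-fins-snoc : ∀ n (f : ℕ → ℕ) → ∑ (fins (suc n)) (f ∘ toℕ) ≡ ∑ (fins n) (f ∘ toℕ) + f n
∑-fins-snoc zero    f = +-comm (f 0) 0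
∑-fins-snoc (suc n) f = trans (∑-fins-suc (suc n) (f ∘ toℕ))
  (trans (cong (f 0 +_) (∑-fins-snoc n (f ∘ suc)))
    (trans (sym (+-assoc (f 0) _ _)) (cong (_+ f (suc n)) (sym (∑-fins-suc n (f ∘ toℕ))))))

-- Falling factorials and symmetric polynomials at equal arguments.

fall : ℕ → ℕ → ℕ
fall m       zero    = 1
fall zero    (suc s) = 0
fall (suc m) (suc s) = suc m * fall m s

fall-step : ∀ m s → fall m (suc s) + s * fall m s ≡ m * fall m s
fall-step zero    zero    = refl
fall-step zero    (suc s) = *-zeroʳ s
fall-step (suc m) zero    = +-identityʳ _
fall-step (suc m) (suc s) = trans (lemma₁ (suc m) (fall m (suc s)) s (fall m s))
  (trans (cong (λ z → suc m * (z + fall m s)) (fall-step m s)) (lemma₂ m (fall m s)))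
  where
  lemma₁ : ∀ a b c d → a * b + suc c * (a * d) ≡ a * ((b + c * d) + d)
  lemma₁ = solve-∀
  lemma₂ : ∀ m f → suc m * (m * f + f) ≡ suc m * (suc m * f)
  lemma₂ = solve-∀

fall-suc : ∀ m s → fall (suc m) (suc s) ≡ fall m (suc s) + suc s * fall m s
fall-suc m s = trans (lemma m (fall m s)) (trans (cong (_+ fall m s) (sym (fall-step m s))) (lemma₂ (fall m (suc s)) s (fall m s)))
  where
  lemma : ∀ m f → suc m * f ≡ m * f + f
  lemma = solve-∀
  lemma₂ : ∀ a s f → (a + s * f) + f ≡ a + suc s * f
  lemma₂ = solve-∀

-- `σ s` at ones is a binomial coefficient. The identity links the number of edges of the Turán
-- hypergraph with the number of ordered cliques.
σ-const : ∀ m s q → (s !) * σ s (λ (_ : Fin m) → q) ≡ fall m s * q ^ s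
σ-const m       zero    q = refl
σ-const zero    (suc s) q = *-zeroʳ (suc s !)
σ-const (suc m) (suc s) q = trans (lemma (suc s) (s !) (σ (suc s) (λ (_ : Fin m) → q)) q (σ s (λ (_ : Fin m) → q)))
  (trans (cong₂ (λ x y → x + suc s * q * y) (σ-const m (suc s) q) (σ-const m s q))
    (trans (lemma₂ (fall m (suc s)) q (q ^ s) (suc s) (fall m s)) (cong (_* q ^ suc s) (sym (fall-suc m s)))))
  where
  lemma : ∀ a b x q y → a * b * (x + q * y) ≡ a * b * x + a * q * (b * y)
  lemma = solve-∀
  lemma₂ : ∀ f q p s g → f * (q * p) + s * q * (g * p) ≡ (f + s * g) * (q * p)
  lemma₂ = solve-∀

σ-scale : ∀ m s q → σ s (λ (_ : Fin m) → q) ≡ σ s (λ (_ : Fin m) → 1) * q ^ s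
σ-scale m       zero    q = refl
σ-scale zero    (suc s) q = refl
σ-scale (suc m) (suc s) q = trans (cong₂ (λ x y → x + q * y) (σ-scale m (suc s) q) (σ-scale m s q))
  (lemma (σ (suc s) (λ (_ : Fin m) → 1)) q (q ^ s) (σ s (λ (_ : Fin m) → 1)))
  where
  lemma : ∀ x q p y → x * (q * p) + q * (y * p) ≡ (x + 1 * y) * (q * p)
  lemma = solve-∀

σ-ones-pos : ∀ m s → s ≤ m → 0 < σ s (λ (_ : Fin m) → 1)
σ-ones-pos m       zero    _       = s≤s z≤n
σ-ones-pos (suc m) (suc s) (s≤s p) = ≤-trans (≤-trans (σ-ones-pos m s p) (≤-reflexive (sym (*-identityˡ _)))) (m≤n+m (1 * σ s (λ (_ : Fin m) → 1)) (σ (suc s) (λ (_ : Fin m) → 1)))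

-- Boolean tests and the Turán hypergraph.

allB⇒ : ∀ {A : Set} (p : A → Bool) xs → T (allB p xs) → ∀ {x} → x ∈ˡ xs → T (p x)
allB⇒ p (y ∷ xs) t q with p y in eq
allB⇒ p (y ∷ xs) t (here refl) | true = subst T (sym eq) tt
allB⇒ p (y ∷ xs) t (there q)   | true = allB⇒ p xs t q

allB⇐ : ∀ {A : Set} (p : A → Bool) xs → (∀ x → T (p x)) → T (allB p xs)
allB⇐ p []       f = tt
allB⇐ p (y ∷ xs) f with p y | f y
... | true | _ = allB⇐ p xs f

lookupB⇔ : ∀ {n} (S : Subset n) x → (T (lookupB S x) → x ∈ S) × (x ∈ S → T (lookupB S x))
lookupB⇔ (true ∷ S) zero = (λ _ → here) , λ _ → tt
lookupB⇔ (false ∷ S) zero = (λ ()) , λ ()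
lookupB⇔ (b ∷ S) (suc x) = (λ p → there (proj₁ (lookupB⇔ S x) p)) , λ { (there p) → proj₂ (lookupB⇔ S x) p }

not⁻ : ∀ {b} → T (not b) → ¬ T b
not⁻ {false} _ ()

not⁺ : ∀ {b} → ¬ T b → T (not b)
not⁺ {false} _ = tt
not⁺ {true}  f = ⊥-elim (f tt)

∧⁺ : ∀ {a b} → T a → T b → T (a ∧ b)
∧⁺ {true} _ p = p

∧⁻ : ∀ {a b} → T (a ∧ b) → T a × T b
∧⁻ {true} p = tt , p

∨⁻ : ∀ {a b} → T (a ∨ b) → T a ⊎ T b
∨⁻ {true}  p = inj₁ tt
∨⁻ {false} p = inj₂ p

∨⁺ˡ : ∀ {a b} → T a → T (a ∨ b)
∨⁺ˡ {true} _ = tt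

∨⁺ʳ : ∀ {a b} → T b → T (a ∨ b)
∨⁺ʳ {true}  _ = tt
∨⁺ʳ {false} p = p

module Turán (ℓ′ : ℕ) where

  ℓ : ℕ
  ℓ = suc ℓ′

  residue : ℕ → Fin ℓ
  residue x = fromℕ< (m%n<n x ℓ)

  class : ∀ {n} → Fin n → Maybe (Fin ℓ)
  class x = just (residue (toℕ x))

  sz : ℕ → Fin ℓ → ℕ
  sz n = size (class {n})

  sz-suc : ∀ n c → sz (suc n) c ≡ sz n c + 𝟙 (just (residue n) ≟ᵐ just c)
  sz-suc n c = ∑-fins-snoc n (λ x → 𝟙 (just (residue x) ≟ᵐ just c))

  -- Vertices are dealt to the classes in turn, so the first `ρ` classes are one ahead.
  sz-values : ∀ n q ρ → n ≡ ρ + q * ℓ → ρ < ℓ → ∀ c → (toℕ c < ρ → sz n c ≡ suc q) × (ρ ≤ toℕ c → sz n c ≡ q)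
  sz-values zero zero zero e _ c = (λ ()) , λ _ → refl
  sz-values (suc n) q (suc ρ) e ρ<ℓ c = lt , ge
    where
    e′ = suc-injective e
    ih = sz-values n q ρ e′ (<⇒≤ ρ<ℓ) c
    res : toℕ (residue n) ≡ ρ
    res = trans (toℕ-fromℕ< (m%n<n n ℓ)) (trans (cong (_% ℓ) e′) (trans ([m+kn]%n≡m%n ρ q ℓ) (m<n⇒m%n≡m (<⇒≤ ρ<ℓ))))
    off : toℕ c ≢ ρ → 𝟙 (just (residue n) ≟ᵐ just c) ≡ 0
    off p = 𝟙-no (just (residue n) ≟ᵐ just c) λ r → p (trans (cong toℕ (sym (Maybe.just-injective r))) res)
    lt : toℕ c < suc ρ → sz (suc n) c ≡ suc q
    lt p with m≤n⇒m<n∨m≡n (≤-pred p)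
    ... | inj₁ c<ρ  = trans (sz-suc n c) (trans (cong₂ _+_ (proj₁ ih c<ρ) (off (<⇒≢ c<ρ))) (+-identityʳ _))
    ... | inj₂ refl = trans (sz-suc n c) (trans (cong₂ _+_ (proj₂ ih ≤-refl)
      (𝟙-yes (just (residue n) ≟ᵐ just c) (cong just (toℕ-injective res)))) (+-comm q 1))
    ge : suc ρ ≤ toℕ c → sz (suc n) c ≡ q
    ge p = trans (sz-suc n c) (trans (cong₂ _+_ (proj₂ ih (<⇒≤ p)) (off (≢-sym (<⇒≢ p)))) (+-identityʳ _))
  sz-values (suc n) (suc q) zero e _ c = (λ ()) , λ _ → val
    where
    e′ : n ≡ ℓ′ + q * ℓ
    e′ = suc-injective e
    ih = sz-values n q ℓ′ e′ ≤-refl c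
    res : toℕ (residue n) ≡ ℓ′
    res = trans (toℕ-fromℕ< (m%n<n n ℓ)) (trans (cong (_% ℓ) e′) (trans ([m+kn]%n≡m%n ℓ′ q ℓ) (m<n⇒m%n≡m ≤-refl)))
    val : sz (suc n) c ≡ suc q
    val with m≤n⇒m<n∨m≡n (≤-pred (toℕ<n c))
    ... | inj₁ c<  = trans (sz-suc n c) (trans (cong₂ _+_ (proj₁ ih c<)
            (𝟙-no (just (residue n) ≟ᵐ just c) λ r → <⇒≢ c< (trans (cong toℕ (sym (Maybe.just-injective r))) res))) (+-identityʳ _))
    ... | inj₂ c≡ = trans (sz-suc n c) (trans (cong₂ _+_ (proj₂ ih (≤-reflexive (sym c≡)))
            (𝟙-yes (just (residue n) ≟ᵐ just c) (cong just (toℕ-injective (trans res (sym c≡)))))) (+-comm q 1))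

  sz-bounds : ∀ n c → n / ℓ ≤ sz n c × sz n c ≤ suc (n / ℓ)
  sz-bounds n c with toℕ c <? n % ℓ | sz-values n (n / ℓ) (n % ℓ) (m≡m%n+[m/n]*n n ℓ) (m%n<n n ℓ) c
  ... | yes p | v , _ = ≤-trans (n≤1+n _) (≤-reflexive (sym (v p))) , ≤-reflexive (v p)
  ... | no p  | _ , v = ≤-reflexive (sym (v (≮⇒≥ p))) , ≤-trans (≤-reflexive (v (≮⇒≥ p))) (n≤1+n _)

  sz-balanced : ∀ n → Balanced (sz n)
  sz-balanced n i j = ≤-trans (proj₂ (sz-bounds n i)) (s≤s (proj₁ (sz-bounds n j)))

  residue≡⇒% : ∀ x y → residue x ≡ residue y → x % ℓ ≡ y % ℓ
  residue≡⇒% x y e = trans (sym (toℕ-fromℕ< (m%n<n x ℓ))) (trans (cong toℕ e) (toℕ-fromℕ< (m%n<n y ℓ)))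

  %⇒residue≡ : ∀ x y → x % ℓ ≡ y % ℓ → residue x ≡ residue y
  %⇒residue≡ x y e = toℕ-injective (trans (toℕ-fromℕ< (m%n<n x ℓ)) (trans e (sym (toℕ-fromℕ< (m%n<n y ℓ)))))

  crossing⇒ : ∀ {n} (S : Subset n) → T (crossing ℓ S) → Cross class S
  crossing⇒ {n} S t = (λ _ _ ()) , inj
    where
    noPair : ∀ x y → x ∈ S → y ∈ S → toℕ x < toℕ y → residue (toℕ x) ≢ residue (toℕ y)
    noPair x y x∈ y∈ lt e = not⁻ (allB⇒ _ (allFin n) (allB⇒ _ (allFin n) t (∈-allFin x)) (∈-allFin y))
      (∧⁺ (proj₂ (lookupB⇔ S x) x∈) (∧⁺ (proj₂ (lookupB⇔ S y) y∈) (∧⁺ (<⇒<ᵇ lt) (≡⇒≡ᵇ _ _ (residue≡⇒% (toℕ x) (toℕ y) e)))))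
    inj : ∀ x y → x ∈ S → y ∈ S → class x ≡ class y → x ≡ y
    inj x y x∈ y∈ e with <-cmp (toℕ x) (toℕ y)
    ... | tri< lt _ _ = contradiction (Maybe.just-injective e) (noPair x y x∈ y∈ lt)
    ... | tri≈ _ eq _ = toℕ-injective eq
    ... | tri> _ _ gt = contradiction (sym (Maybe.just-injective e)) (noPair y x y∈ x∈ gt)

  crossing⇐ : ∀ {n} (S : Subset n) → Cross class S → T (crossing ℓ S)
  crossing⇐ {n} S (_ , inj) = allB⇐ _ (allFin n) λ x → allB⇐ _ (allFin n) λ y → not⁺ λ t →
    let x∈ , t₁ = ∧⁻ {lookupB S x} t ; y∈ , t₂ = ∧⁻ {lookupB S y} t₁ ; lt , e = ∧⁻ {toℕ x <ᵇ toℕ y} t₂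
    in <-irrefl (cong toℕ (inj x y (proj₁ (lookupB⇔ S x) x∈) (proj₁ (lookupB⇔ S y) y∈)
         (cong just (%⇒residue≡ (toℕ x) (toℕ y) (≡ᵇ⇒≡ _ _ e))))) (<ᵇ⇒< _ _ lt)

  turan-# : ∀ r n → turan r n ℓ ≡ # (sets n) (λ S → has? r S ×-dec cross? (class {n}) S)
  turan-# r n = trans (#-filter (allSubsets n) (λ S → T? ((∣ S ∣ ≡ᵇ r) ∧ crossing ℓ S)))
    (#-cong (sets n) (λ S → T? ((∣ S ∣ ≡ᵇ r) ∧ crossing ℓ S)) (λ S → has? r S ×-dec cross? (class {n}) S)
      (λ S t → let h , c = ∧⁻ {∣ S ∣ ≡ᵇ r} t in ≡ᵇ⇒≡ _ _ h , crossing⇒ S c)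
      (λ S (h , c) → ∧⁺ (≡⇒≡ᵇ _ _ h) (crossing⇐ S c)))

  turan-σ : ∀ r n → turan r n ℓ ≡ σ r (sz n)
  turan-σ r n = trans (turan-# r n) (#-cross r (class {n}))

  turan-≥ : ∀ r n → σ r (λ (_ : Fin ℓ) → n / ℓ) ≤ turan r n ℓ
  turan-≥ r n = ≤-trans (σ-mono r λ c → proj₁ (sz-bounds n c)) (≤-reflexive (sym (turan-σ r n)))

  -- The new vertex joins the class of its residue and forms an edge with every crossing set of the
  -- other classes, each of size at least `n / ℓ`. This makes the minimum degree obtained by
  -- deleting vertices explicit.
  turan-suc : ∀ r n → turan (suc r) n ℓ + σ r (λ (_ : Fin ℓ′) → n / ℓ) ≤ turan (suc r) (suc n) ℓ
  turan-suc r n = begin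
    turan (suc r) n ℓ + σ r (λ (_ : Fin ℓ′) → n / ℓ)  ≤⟨ +-mono-≤ (≤-reflexive (turan-σ (suc r) n)) (σ-mono r λ c → proj₁ (sz-bounds n _)) ⟩
    σ (suc r) (sz n) + σ r (sz n ∘ punchIn (residue n))  ≡⟨ sym (σ-inc r (residue n)
       (trans (sz-suc n (residue n)) (trans (cong (sz n (residue n) +_) (𝟙-yes (just (residue n) ≟ᵐ just (residue n)) refl)) (+-comm _ 1)))
       λ d d≢ → trans (sz-suc n d) (trans (cong (sz n d +_) (𝟙-no (just (residue n) ≟ᵐ just d) λ e → d≢ (sym (Maybe.just-injective e)))) (+-identityʳ _))) ⟩
    σ (suc r) (sz (suc n))  ≡⟨ sym (turan-σ (suc r) (suc n)) ⟩
    turan (suc r) (suc n) ℓ  ∎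
    where open ≤-Reasoning

  ∑-size : ∀ {n k} (X : Fin n → Fin k) → ∑ (fins k) (size (just ∘ X)) ≡ n
  ∑-size {n} {k} X = trans (∑-swap (fins k) (fins n) _) (trans (∑-cong (fins n) λ x → one (X x)) (trans (∑-fins-const n 1) (*-identityʳ n)))
    where
    one : ∀ {k} (c : Fin k) → ∑ (fins k) (λ d → 𝟙 (just c ≟ᵐ just d)) ≡ 1
    one {suc k} c = trans (∑-at (λ d → 𝟙 (just c ≟ᵐ just d)) c) (cong₂ _+_ (𝟙-yes (just c ≟ᵐ just c) refl)
      (trans (∑-cong (fins k) λ i → 𝟙-no (just c ≟ᵐ just (punchIn c i)) λ e → punchInᵢ≢i c i (sym (Maybe.just-injective e))) (∑-zero (fins k))))

  cross≤turan : ∀ r {n} (X : Fin n → Fin ℓ) → # (sets n) (λ S → has? r S ×-dec cross? (just ∘ X) S) ≤ turan r n ℓ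
  cross≤turan r {n} X = ≤-trans (≤-reflexive (#-cross r (just ∘ X)))
    (≤-trans (σ-balanced r (sz-balanced n) (≤-reflexive (trans (∑-size X) (sym (∑-size (λ (x : Fin n) → residue (toℕ x)))))))
      (≤-reflexive (sym (turan-σ r n))))

-- Moon-Moser inequalities for ordered cliques.

2xy≤x²+y² : ∀ x y → 2 * (x * y) ≤ x * x + y * y
2xy≤x²+y² x y with ≤-total x y
... | inj₁ x≤y = go x y x≤y
  where
  lemma : ∀ x k → x * x + (x + k) * (x + k) ≡ 2 * (x * (x + k)) + k * k
  lemma = solve-∀
  go : ∀ x y → x ≤ y → 2 * (x * y) ≤ x * x + y * y
  go x y x≤y with m≤n⇒∃[o]m+o≡n x≤y
  ... | k , refl = ≤-trans (m≤m+n _ (k * k)) (≤-reflexive (sym (lemma x k)))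
... | inj₂ y≤x with m≤n⇒∃[o]m+o≡n y≤x
...   | k , refl = ≤-trans (m≤m+n _ (k * k)) (≤-reflexive (sym (lemma y k)))
  where
  lemma : ∀ y k → (y + k) * (y + k) + y * y ≡ 2 * ((y + k) * y) + k * k
  lemma = solve-∀

-- Cauchy-Schwarz with weights `a`, by induction: the mixed terms between the new entry and an old
-- one are bounded by `2xy≤x²+y²`.
∑-cauchy : ∀ {A : Set} (xs : List A) (a d : A → ℕ) →
  ∑ xs (λ x → a x * d x) * ∑ xs (λ x → a x * d x) ≤ ∑ xs a * ∑ xs (λ x → a x * (d x * d x))
∑-cauchy []       a d = z≤n
∑-cauchy (x ∷ xs) a d = begin
  (a x * d x + S₁) * (a x * d x + S₁)  ≡⟨ expand (a x) (d x) S₁ ⟩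
  a x * d x * (a x * d x) + a x * (2 * (d x * S₁)) + S₁ * S₁  ≤⟨ +-mono-≤ (+-monoʳ-≤ (a x * d x * (a x * d x)) (*-monoʳ-≤ (a x) cross)) (∑-cauchy xs a d) ⟩
  a x * d x * (a x * d x) + a x * (S₀ * (d x * d x) + S₂) + S₀ * S₂  ≡⟨ collect (a x) (d x) S₀ S₂ ⟩
  (a x + S₀) * (a x * (d x * d x) + S₂)  ∎
  where
  open ≤-Reasoning
  S₁ = ∑ xs (λ x → a x * d x)
  S₀ = ∑ xs a
  S₂ = ∑ xs (λ x → a x * (d x * d x))
  expand : ∀ a d S₁ → (a * d + S₁) * (a * d + S₁) ≡ a * d * (a * d) + a * (2 * (d * S₁)) + S₁ * S₁
  expand = solve-∀
  collect : ∀ a d S₀ S₂ → a * d * (a * d) + a * (S₀ * (d * d) + S₂) + S₀ * S₂ ≡ (a + S₀) * (a * (d * d) + S₂)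
  collect = solve-∀
  term : ∀ d a e → 2 * (d * (a * e)) ≡ a * (2 * (d * e))
  term = solve-∀
  term₂ : ∀ a d e → a * (d * d + e * e) ≡ a * (d * d) + a * (e * e)
  term₂ = solve-∀
  cross : 2 * (d x * S₁) ≤ S₀ * (d x * d x) + S₂
  cross = begin
    2 * (d x * S₁)  ≡⟨ cong (2 *_) (sym (∑-*ˡ xs (d x) _)) ⟩
    2 * ∑ xs (λ y → d x * (a y * d y))  ≡⟨ sym (∑-*ˡ xs 2 _) ⟩
    ∑ xs (λ y → 2 * (d x * (a y * d y)))  ≤⟨ ∑-mono xs (λ y → ≤-trans (≤-reflexive (term (d x) (a y) (d y)))
                                                                            (≤-trans (*-monoʳ-≤ (a y) (2xy≤x²+y² (d x) (d y))) (≤-reflexive (term₂ (a y) (d x) (d y))))) ⟩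
    ∑ xs (λ y → a y * (d x * d x) + a y * (d y * d y))  ≡⟨ trans (∑-+ xs _ _) (cong (_+ S₂) (∑-*ʳ xs (d x * d x) a)) ⟩
    S₀ * (d x * d x) + S₂  ∎

#-fins≤1 : ∀ {n} {P : Fin n → Set} (P? : Decidable P) → (∀ i j → P i → P j → i ≡ j) → # (fins n) P? ≤ 1
#-fins≤1 {n} P? uniq with # (fins n) P? ≤? 1
... | yes p = p
... | no ¬p with #-choose {m = 2} (fins-unique n) P? (≰⇒> ¬p)
...   | f , inj , Pf with inj {zero} {suc zero} (uniq _ _ (Pf _) (Pf _))
...     | ()

#-≡ : ∀ (a : Fin n) → # (fins n) (_≟ᶠ a) ≡ 1
#-≡ {n} a = ≤-antisym (#-fins≤1 (_≟ᶠ a) λ i j p q → trans p (sym q))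
  (≤-trans (≤-reflexive (sym (𝟙-yes (a ≟ᶠ a) refl))) (≤∑ (λ x → 𝟙 (x ≟ᶠ a)) (∈-fins a)))

fall-last : ∀ s b → fall (s + b) (suc s) ≡ b * fall (s + b) s
fall-last s b = +-cancelʳ-≡ (s * fall (s + b) s) _ _ (trans (fall-step (s + b) s) (lemma s b (fall (s + b) s)))
  where
  lemma : ∀ s b f → (s + b) * f ≡ b * f + s * f
  lemma = solve-∀

fall-pos : ∀ m s → s ≤ m → 0 < fall m s
fall-pos m       zero    _       = s≤s z≤n
fall-pos (suc m) (suc s) (s≤s p) = ≤-trans (fall-pos m s p) (m≤m+n _ _)

module Cliques {n : ℕ} (Γ : Fin n → Fin n → Set) (Γ? : ∀ x y → Dec (Γ x y)) (Γ-sym : ∀ {x y} → Γ x y → Γ y x) where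

  Adj : ∀ {s} → Fin n → Vec (Fin n) s → Set
  Adj v w = ∀ j → Γ v (Vec.lookup w j)

  adj? : ∀ {s} v (w : Vec (Fin n) s) → Dec (Adj v w)
  adj? v w = all? (λ j → Γ? v (Vec.lookup w j))

  Clique : ∀ {s} → Vec (Fin n) s → Set
  Clique []      = ⊤
  Clique (v ∷ w) = Adj v w × Clique w

  clique? : ∀ {s} (w : Vec (Fin n) s) → Dec (Clique w)
  clique? []      = yes tt
  clique? (v ∷ w) = adj? v w ×-dec clique? w

  Clique-insert⁻ : ∀ {s} (w : Vec (Fin n) s) i v → Clique (insertAt w i v) → Adj v w × Clique w
  Clique-insert⁻ w       zero    v c       = c
  Clique-insert⁻ (x ∷ w) (suc i) v (p , c) with Clique-insert⁻ w i v c
  ... | q , d = (λ { zero → Γ-sym (subst (Γ x) (insertAt-lookup w i v) (p i)) ; (suc j) → q j }) ,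
                (λ j → subst (Γ x) (insertAt-punchIn w i v j) (p (punchIn i j))) , d

  Clique-insert⁺ : ∀ {s} (w : Vec (Fin n) s) i v → Adj v w → Clique w → Clique (insertAt w i v)
  Clique-insert⁺ w       zero    v p c       = p , c
  Clique-insert⁺ (x ∷ w) (suc i) v p (q , c) = adj , Clique-insert⁺ w i v (p ∘ suc) c
    where
    adj : Adj x (insertAt w i v)
    adj j with i ≟ᶠ j
    ... | yes refl = subst (Γ x) (sym (insertAt-lookup w i v)) (Γ-sym (p zero))
    ... | no i≢j   = subst (λ j → Γ x (Vec.lookup (insertAt w i v) j)) (punchIn-punchOut i≢j)
                       (subst (Γ x) (sym (insertAt-punchIn w i v (punchOut i≢j))) (q (punchOut i≢j)))

  Clique-lookup : ∀ {s} (w : Vec (Fin n) s) → Clique w → ∀ i j → i ≢ j → Γ (Vec.lookup w i) (Vec.lookup w j)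
  Clique-lookup (v ∷ w) (p , c) zero    zero    i≢j = contradiction refl i≢j
  Clique-lookup (v ∷ w) (p , c) zero    (suc j) i≢j = p j
  Clique-lookup (v ∷ w) (p , c) (suc i) zero    i≢j = Γ-sym (p i)
  Clique-lookup (v ∷ w) (p , c) (suc i) (suc j) i≢j = Clique-lookup w c i j (i≢j ∘ cong suc)

  h : ℕ → ℕ
  h s = # (vecs n s) clique?

  deg : ∀ {s} → Vec (Fin n) s → ℕ
  deg w = # (fins n) (λ v → adj? v w)

  deg≤n : ∀ {s} (w : Vec (Fin n) s) → deg w ≤ n
  deg≤n w = ≤-trans (#-≤-length (fins n) (λ v → adj? v w)) (≤-reflexive (length-fins n))

  codegrees : ∀ {s} → Vec (Fin n) (suc s) → ℕ
  codegrees {s} w = ∑ (fins (suc s)) (λ i → deg (removeAt w i))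

  m₂ : ℕ → ℕ
  m₂ s = ∑ (vecs n s) (λ w → 𝟙 (clique? w) * (deg w * deg w))

  -- A clique is a smaller clique with one common neighbour inserted at place `i`, so every smaller
  -- clique `w` is met `deg w` times.
  ∑-cliques-insert : ∀ s (i : Fin (suc s)) (f : Vec (Fin n) s → ℕ) →
    ∑ (vecs n (suc s)) (λ w → 𝟙 (clique? w) * f (removeAt w i)) ≡ ∑ (vecs n s) (λ w → 𝟙 (clique? w) * (deg w * f w))
  ∑-cliques-insert s i f = trans (∑-vecs-insert n s i _) (∑-cong (vecs n s) λ w →
    trans (∑-cong (fins n) λ v → trans (cong₂ _*_ (trans (𝟙-cong (clique? (insertAt w i v)) (adj? v w ×-dec clique? w)
              (Clique-insert⁻ w i v) (λ (p , c) → Clique-insert⁺ w i v p c)) (𝟙-× (adj? v w) (clique? w)))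
            (cong f (removeAt-insertAt w i v))) (lemma (𝟙 (adj? v w)) (𝟙 (clique? w)) (f w)))
      (trans (∑-*ʳ (fins n) (𝟙 (clique? w) * f w) (λ v → 𝟙 (adj? v w))) (lemma₂ (deg w) (𝟙 (clique? w)) (f w))))
    where
    lemma : ∀ a b c → a * b * c ≡ a * (b * c)
    lemma = solve-∀
    lemma₂ : ∀ a b c → a * (b * c) ≡ b * (a * c)
    lemma₂ = solve-∀

  h-suc : ∀ s → h (suc s) ≡ ∑ (vecs n s) (λ w → 𝟙 (clique? w) * deg w)
  h-suc s = trans (∑-cong (vecs n (suc s)) λ w → sym (*-identityʳ _))
    (trans (∑-cliques-insert s zero (λ _ → 1)) (∑-cong (vecs n s) λ w → cong (𝟙 (clique? w) *_) (*-identityʳ (deg w))))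

  ∑-codegrees : ∀ s → ∑ (vecs n (suc s)) (λ w → 𝟙 (clique? w) * codegrees w) ≡ suc s * m₂ s
  ∑-codegrees s = trans (∑-cong (vecs n (suc s)) λ w → sym (∑-*ˡ (fins (suc s)) (𝟙 (clique? w)) (λ i → deg (removeAt w i))))
    (trans (∑-swap (vecs n (suc s)) (fins (suc s)) _)
      (trans (∑-cong (fins (suc s)) λ i → ∑-cliques-insert s i deg) (∑-fins-const (suc s) (m₂ s))))

  Adj-removeAt : ∀ {s} v (w : Vec (Fin n) (suc s)) i {j} → i ≢ j → Adj v (removeAt w i) → Γ v (Vec.lookup w j)
  Adj-removeAt v w i i≢j p = subst (Γ v) (removeAt-punchOut w i≢j) (p (punchOut i≢j))

  -- a vertex not adjacent to all of w is adjacent to at most one of the subtuples of w missing one entry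
  codegrees≤ : ∀ {s} (w : Vec (Fin n) (suc s)) → codegrees w ≤ n + s * deg w
  codegrees≤ {s} w = begin
    codegrees w  ≡⟨ ∑-swap (fins (suc s)) (fins n) _ ⟩
    ∑ (fins n) (λ v → # (fins (suc s)) (λ i → adj? v (removeAt w i)))  ≤⟨ ∑-mono (fins n) bound ⟩
    ∑ (fins n) (λ v → 1 + s * 𝟙 (adj? v w))  ≡⟨ trans (∑-+ (fins n) _ _) (cong₂ _+_ (trans (∑-fins-const n 1) (*-identityʳ n)) (∑-*ˡ (fins n) s _)) ⟩
    n + s * deg w  ∎
    where
    open ≤-Reasoning
    bound : ∀ v → # (fins (suc s)) (λ i → adj? v (removeAt w i)) ≤ 1 + s * 𝟙 (adj? v w)
    bound v with adj? v w
    ... | yes _ = ≤-trans (#-≤-length (fins (suc s)) (λ i → adj? v (removeAt w i))) (≤-reflexive (trans (length-fins (suc s)) (cong suc (sym (*-identityʳ s)))))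
    ... | no ¬p = ≤-trans (#-fins≤1 (λ i → adj? v (removeAt w i)) uniq) (m≤m+n 1 _)
      where
      uniq : ∀ i i′ → Adj v (removeAt w i) → Adj v (removeAt w i′) → i ≡ i′
      uniq i i′ p p′ with i ≟ᶠ i′
      ... | yes e = e
      ... | no i≢i′ = contradiction all ¬p
        where
        all : Adj v w
        all j with i ≟ᶠ j
        ... | no i≢j = Adj-removeAt v w i i≢j p
        ... | yes refl = Adj-removeAt v w i′ (i≢i′ ∘ sym) p′

  -- Summation of `codegrees≤` over the cliques with `suc s` entries. Joined with `h-cauchy` it
  -- gives the Moon-Moser inequality between three consecutive clique numbers.
  moon-moser : ∀ s → suc s * m₂ s ≤ n * h (suc s) + s * h (suc (suc s))
  moon-moser s = begin
    suc s * m₂ s  ≡⟨ sym (∑-codegrees s) ⟩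
    ∑ (vecs n (suc s)) (λ w → 𝟙 (clique? w) * codegrees w)  ≤⟨ ∑-mono (vecs n (suc s)) (λ w → *-monoʳ-≤ (𝟙 (clique? w)) (codegrees≤ w)) ⟩
    ∑ (vecs n (suc s)) (λ w → 𝟙 (clique? w) * (n + s * deg w))  ≡⟨ ∑-cong (vecs n (suc s)) (λ w → lemma (𝟙 (clique? w)) n s (deg w)) ⟩
    ∑ (vecs n (suc s)) (λ w → n * 𝟙 (clique? w) + s * (𝟙 (clique? w) * deg w))  ≡⟨ trans (∑-+ (vecs n (suc s)) _ _) (cong₂ _+_ (∑-*ˡ (vecs n (suc s)) n _)
                                                                                             (trans (∑-*ˡ (vecs n (suc s)) s _) (cong (s *_) (sym (h-suc (suc s)))))) ⟩
    n * h (suc s) + s * h (suc (suc s))  ∎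
    where
    open ≤-Reasoning
    lemma : ∀ a n s d → a * (n + s * d) ≡ n * a + s * (a * d)
    lemma = solve-∀

  h-cauchy : ∀ s → h (suc s) * h (suc s) ≤ h s * m₂ s
  h-cauchy s = subst (λ z → z * z ≤ h s * m₂ s) (sym (h-suc s)) (∑-cauchy (vecs n s) (λ w → 𝟙 (clique? w)) deg)

  module _ (Q : ℕ) where

    -- With ℓ = 1 + s + a: the ratio h (1 + s) / h s falls short of its value (a + 1) n / ℓ in the
    -- Turán graph by at least s n / (ℓ Q).  By Moon–Moser a shortfall propagates to smaller s.
    Short : ℕ → ℕ → Set
    Short s a = (suc s + a) * Q * h (suc s) + s * n * h s ≤ suc a * Q * n * h s

    -- Moon-Moser bounds `suc s` times the ratio at `s` by `n` plus `s` times the ratio at `suc s`.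
    -- In units of `n / (ℓ Q)` a shortfall of `suc s` is thus multiplied by `s` and divided by
    -- `suc s`, which leaves `s`; this is why `Short` carries the factor `s`.
    Short-pred : ∀ s a → suc s ≤ Q → Short (suc s) a → Short s (suc a)
    Short-pred s a s≤Q short with h (suc s) in eq
    ... | zero = begin
      (suc s + suc a) * Q * 0 + s * n * h s  ≡⟨ cong (_+ s * n * h s) (*-zeroʳ ((suc s + suc a) * Q)) ⟩
      s * n * h s  ≤⟨ *-monoˡ-≤ (h s) (*-monoˡ-≤ n (≤-trans (≤-trans (n≤1+n s) s≤Q) (m≤m+n Q _))) ⟩
      suc (suc a) * Q * n * h s  ∎
      where open ≤-Reasoning
    ... | suc h₁ = *-cancelˡ-≤ (suc s * suc h₁) (begin
      suc s * H₁ * ((suc s + suc a) * Q * H₁ + s * n * H₀)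
        ≡⟨ e₁ s a Q H₁ n H₀ ⟩
      (suc (suc s) + a) * Q * (suc s * (H₁ * H₁)) + suc s * s * n * H₀ * H₁
        ≤⟨ +-monoˡ-≤ _ (*-monoʳ-≤ ((suc (suc s) + a) * Q) mm) ⟩
      (suc (suc s) + a) * Q * (H₀ * (n * H₁ + s * H₂)) + suc s * s * n * H₀ * H₁
        ≡⟨ e₂ s a Q H₁ n H₀ H₂ ⟩
      (suc (suc s) + a) * Q * n * H₁ * H₀ + s * H₀ * ((suc (suc s) + a) * Q * H₂ + suc s * n * H₁)
        ≤⟨ +-monoʳ-≤ ((suc (suc s) + a) * Q * n * H₁ * H₀) (*-monoʳ-≤ (s * H₀) short) ⟩
      (suc (suc s) + a) * Q * n * H₁ * H₀ + s * H₀ * (suc a * Q * n * H₁)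
        ≡⟨ e₃ s a Q H₁ n H₀ ⟩
      suc s * H₁ * (suc (suc a) * Q * n * H₀) ∎)
      where
      open ≤-Reasoning
      H₁ = suc h₁
      H₀ = h s
      H₂ = h (suc (suc s))
      mm : suc s * (H₁ * H₁) ≤ H₀ * (n * H₁ + s * H₂)
      mm = subst (λ z → suc s * (z * z) ≤ H₀ * (n * z + s * H₂)) eq
        (≤-trans (*-monoʳ-≤ (suc s) (h-cauchy s)) (≤-trans (≤-reflexive (c s H₀ (m₂ s))) (*-monoʳ-≤ H₀ (moon-moser s))))
        where
        c : ∀ s x y → suc s * (x * y) ≡ x * (suc s * y)
        c = solve-∀
      e₁ : ∀ s a Q H₁ n H₀ → suc s * H₁ * ((suc s + suc a) * Q * H₁ + s * n * H₀) ≡ (suc (suc s) + a) * Q * (suc s * (H₁ * H₁)) + suc s * s * n * H₀ * H₁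
      e₁ = solve-∀
      e₂ : ∀ s a Q H₁ n H₀ H₂ → (suc (suc s) + a) * Q * (H₀ * (n * H₁ + s * H₂)) + suc s * s * n * H₀ * H₁ ≡ (suc (suc s) + a) * Q * n * H₁ * H₀ + s * H₀ * ((suc (suc s) + a) * Q * H₂ + suc s * n * H₁)
      e₂ = solve-∀
      e₃ : ∀ s a Q H₁ n H₀ → (suc (suc s) + a) * Q * n * H₁ * H₀ + s * H₀ * (suc a * Q * n * H₁) ≡ suc s * H₁ * (suc (suc a) * Q * n * H₀)
      e₃ = solve-∀

    h₁≡n : h 1 ≡ n
    h₁≡n = trans (h-suc 0) (trans (+-identityʳ _) (trans (*-identityˡ _) (trans (∑-cong (fins n) λ v → 𝟙-yes (adj? v []) λ ()) (trans (∑-fins-const n 1) (*-identityʳ n)))))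

    -- The ratios are multiplied from `h 1 ≡ n` upwards, where shortfalls are available by
    -- `Short-pred`. Only the one at the bottom is kept; it leaves the summand `n ^ suc (suc s)`.
    Short⇒few : 0 < Q → ∀ s a → suc (suc s) + a ≤ Q → Short (suc s) a →
      (suc (suc s) + a) ^ suc (suc s) * Q * h (suc (suc s)) + n ^ suc (suc s) ≤ fall (suc (suc s) + a) (suc (suc s)) * Q * n ^ suc (suc s)
    Short⇒few 0<Q zero a ℓ≤Q short = begin
      (2 + a) ^ 2 * Q * h 2 + n ^ 2  ≤⟨ +-monoʳ-≤ ((2 + a) ^ 2 * Q * h 2) (m≤m+n _ _) ⟩
      (2 + a) ^ 2 * Q * h 2 + (n ^ 2 + (1 + a) * n ^ 2)  ≡⟨ e₁ a Q (h 2) n ⟩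
      (2 + a) * ((2 + a) * Q * h 2 + 1 * n * n)  ≤⟨ *-monoʳ-≤ (2 + a) (subst (λ z → (2 + a) * Q * h 2 + 1 * n * z ≤ suc a * Q * n * z) h₁≡n short) ⟩
      (2 + a) * (suc a * Q * n * n)  ≡⟨ e₂ a Q n ⟩
      fall (2 + a) 2 * Q * n ^ 2  ∎
      where
      open ≤-Reasoning
      e₁ : ∀ a Q x n → (2 + a) * ((2 + a) * 1) * Q * x + (n * (n * 1) + (1 + a) * (n * (n * 1))) ≡ (2 + a) * ((2 + a) * Q * x + 1 * n * n)
      e₁ = solve-∀
      e₂ : ∀ a Q n → (2 + a) * (suc a * Q * n * n) ≡ (2 + a) * ((1 + a) * 1) * Q * (n * (n * 1))
      e₂ = solve-∀
    Short⇒few 0<Q (suc s) a ℓ≤Q short = begin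
      L ^ suc t * Q * h (suc t) + n ^ suc t
        ≤⟨ +-mono-≤ (≤-reflexive (e₁ L (L ^ t) Q (h (suc t)))) (m≤m+n _ _) ⟩
      L ^ t * (L * Q * h (suc t)) + suc a * n ^ suc t
        ≤⟨ +-monoˡ-≤ _ (*-monoʳ-≤ (L ^ t) (≤-trans (m≤m+n _ _) short)) ⟩
      L ^ t * (suc a * Q * n * h t) + suc a * n ^ suc t
        ≡⟨ e₂ (L ^ t) a Q n (h t) (n ^ t) ⟩
      suc a * n * (L ^ t * Q * h t + n ^ t)
        ≤⟨ *-monoʳ-≤ (suc a * n) (subst (λ L → L ^ t * Q * h t + n ^ t ≤ fall L t * Q * n ^ t) (+-suc t a) (Short⇒few 0<Q s (suc a) (subst (_≤ Q) (sym (+-suc t a)) ℓ≤Q) (Short-pred (suc s) a (≤-trans (≤-trans (n≤1+n _) (m≤m+n _ a)) ℓ≤Q) short))) ⟩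
      suc a * n * (fall L t * Q * n ^ t)
        ≡⟨ e₃ a n (fall L t) Q (n ^ t) ⟩
      suc a * fall L t * Q * n ^ suc t
        ≡⟨ cong (λ z → z * Q * n ^ suc t) (sym (subst (λ L → fall L (suc t) ≡ suc a * fall L t) (+-suc t a) (fall-last t (suc a)))) ⟩
      fall L (suc t) * Q * n ^ suc t ∎
      where
      open ≤-Reasoning
      t = suc (suc s)
      L = suc t + a
      e₁ : ∀ L p Q x → L * p * Q * x ≡ p * (L * Q * x)
      e₁ = solve-∀
      e₂ : ∀ p a Q n x y → p * (suc a * Q * n * x) + suc a * (n * y) ≡ suc a * n * (p * Q * x + y)
      e₂ = solve-∀
      e₃ : ∀ a n f Q y → suc a * n * (f * Q * y) ≡ suc a * f * Q * (n * y)
      e₃ = solve-∀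

-- Rich cliques in a graph with nearly the Turán number of r-cliques.

module DenseCliques {n : ℕ} (Γ : Fin n → Fin n → Set) (Γ? : ∀ x y → Dec (Γ x y)) (Γ-sym : ∀ {x y} → Γ x y → Γ y x)
  (ℓ′ r′ Q : ℕ) (r≤ℓ : 2 + r′ ≤ suc ℓ′) (ℓ≤Q : suc ℓ′ ≤ Q) (0<n : 0 < n) where

  open Cliques Γ Γ? Γ-sym public

  private
    ℓ = suc ℓ′
    r = 2 + r′

  0<Q : 0 < Q
  0<Q = ≤-trans (s≤s z≤n) ℓ≤Q

  module _ (many : fall ℓ r * Q * n ^ r < ℓ ^ r * Q * h r + n ^ r) where

    -- A shortfall at a size between `r ∸ 1` and `ℓ ∸ 1` would propagate down to `r ∸ 1` and leave
    -- too few `r`-cliques.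
    ¬Short : ∀ d a → r + d + a ≡ ℓ → ¬ Short Q (suc r′ + d) a
    ¬Short zero a refl short = <⇒≱ many
      (subst (λ L → L ^ r * Q * h r + n ^ r ≤ fall L r * Q * n ^ r) (cong (_+ a) (sym (+-identityʳ r)))
        (Short⇒few Q 0<Q r′ a (subst (_≤ Q) (cong (_+ a) (+-identityʳ r)) ℓ≤Q) (subst (λ d → Short Q d a) (+-identityʳ (suc r′)) short)))
    ¬Short (suc d) a e short = ¬Short d (suc a) (trans (+-suc (r + d) a) (trans (cong (_+ a) (sym (+-suc r d))) e))
      (Short-pred Q (suc r′ + d) a (≤-trans (≤-trans (≤-trans (+-monoʳ-≤ r (n≤1+n d)) (m≤m+n (r + suc d) a)) (≤-reflexive e)) ℓ≤Q)
        (subst (λ s → Short Q s a) (+-suc (suc r′) d) short))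

    -- A step that is not short multiplies the number of cliques by at least `n / (ℓ * Q)`, so
    -- cliques of every size from `r` to `ℓ` make up a positive proportion of the tuples.
    h-grows : ∀ d → r + d ≤ ℓ → n ^ (r + d) ≤ ℓ ^ r * Q * (ℓ * Q) ^ d * h (r + d)
    h-grows zero _ = subst (λ x → n ^ x ≤ ℓ ^ r * Q * 1 * h x) (sym (+-identityʳ r)) (subst (λ c → n ^ r ≤ c * h r) (sym (*-identityʳ (ℓ ^ r * Q)))
      (+-cancelʳ-≤ (n ^ r) _ _ (≤-trans (≤-trans (≤-reflexive (cong (n ^ r +_) (sym (+-identityʳ _))))
        (*-monoˡ-≤ (n ^ r) {x = 2} {y = fall ℓ r * Q} (≤-trans (≤-trans (≤-trans (s≤s (s≤s z≤n)) r≤ℓ) ℓ≤Q) (m≤n*m′ Q (fall-pos ℓ r r≤ℓ))))) (<⇒≤ many))))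
      where
      m≤n*m′ : ∀ m {k} → 0 < k → m ≤ k * m
      m≤n*m′ m {suc k} _ = m≤m+n m _
    h-grows (suc d) r+d≤ℓ with m≤n⇒∃[o]m+o≡n r+d≤ℓ
    ... | a , e = subst (λ x → n ^ x ≤ ℓ ^ r * Q * (ℓ * Q) ^ suc d * h x) (sym (+-suc r d)) (begin
      n * n ^ (r + d)  ≤⟨ *-monoʳ-≤ n (h-grows d (≤-trans (+-monoʳ-≤ r (n≤1+n d)) r+d≤ℓ)) ⟩
      n * (ℓ ^ r * Q * (ℓ * Q) ^ d * h (r + d))  ≡⟨ e₁ n (ℓ ^ r * Q * (ℓ * Q) ^ d) (h (r + d)) ⟩
      ℓ ^ r * Q * (ℓ * Q) ^ d * (n * h (r + d))  ≤⟨ *-monoʳ-≤ (ℓ ^ r * Q * (ℓ * Q) ^ d) step ⟩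
      ℓ ^ r * Q * (ℓ * Q) ^ d * (ℓ * Q * h (suc r + d))  ≡⟨ e₂ (ℓ ^ r * Q) (ℓ * Q) ((ℓ * Q) ^ d) (h (suc r + d)) ⟩
      ℓ ^ r * Q * (ℓ * Q) ^ suc d * h (suc r + d)  ∎)
      where
      open ≤-Reasoning
      e₁ : ∀ n c x → n * (c * x) ≡ c * (n * x)
      e₁ = solve-∀
      e₂ : ∀ c q p x → c * p * (q * x) ≡ c * (q * p) * x
      e₂ = solve-∀
      s = r + d
      ℓ≡ : suc s + a ≡ ℓ
      ℓ≡ = trans (cong (_+ a) (sym (+-suc r d))) e
      step : n * h s ≤ ℓ * Q * h (suc s)
      step = +-cancelʳ-≤ (s * n * h s) _ _ (begin
        n * h s + s * n * h s  ≡⟨ e₃ n (h s) s ⟩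
        suc s * (n * h s)  ≤⟨ *-monoˡ-≤ (n * h s) (≤-trans (≤-trans (m≤m+n (suc s) a) (≤-reflexive ℓ≡)) ℓ≤Q) ⟩
        Q * (n * h s)  ≤⟨ m≤m+n _ (a * (Q * (n * h s))) ⟩
        suc a * (Q * (n * h s))  ≡⟨ e₄ a Q n (h s) ⟩
        suc a * Q * n * h s  ≤⟨ <⇒≤ (≰⇒> (subst (λ x → ¬ Short Q x a) (+-suc (suc r′) d) (¬Short (suc d) a e))) ⟩
        (suc s + a) * Q * h (suc s) + s * n * h s  ≡⟨ cong (λ L → L * Q * h (suc s) + s * n * h s) ℓ≡ ⟩
        ℓ * Q * h (suc s) + s * n * h s  ∎)
        where
        e₃ : ∀ n h s → n * h + s * n * h ≡ suc s * (n * h)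
        e₃ = solve-∀
        e₄ : ∀ a Q n h → suc a * (Q * (n * h)) ≡ suc a * Q * n * h
        e₄ = solve-∀

    -- The condition says that `codegrees w` is at least `(1 - ℓ / Q) n`. In the Turán graph it
    -- equals `n`: each vertex is joined to all of `w` except the entry in its own class.
    Rich : Vec (Fin n) ℓ → Set
    Rich w = Clique w × Q * n ≤ Q * codegrees w + ℓ * n

    rich? : Decidable Rich
    rich? w = clique? w ×-dec (Q * n ≤? Q * codegrees w + ℓ * n)

    -- By Cauchy-Schwarz and `¬Short` at `ℓ′`, the average of `Q * codegrees w` is at least
    -- `(Q - ℓ′) n`. Richness asks only for `(Q - ℓ) n`; the difference `n` has to be paid by the
    -- rich cliques, each of which contributes at most `suc Q * ℓ * n`.
    h≤rich : 0 < h ℓ′ → h ℓ ≤ suc Q * ℓ * # (vecs n ℓ) rich?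
    h≤rich 0<h with h ℓ′ in eq
    h≤rich (s≤s _) | suc h′ = *-cancelˡ-≤ n {{>-nonZero 0<n}} (+-cancelˡ-≤ (Q * (n * h ℓ)) _ _ (begin
      Q * (n * h ℓ) + n * h ℓ  ≤⟨ +-monoˡ-≤ (n * h ℓ) avg ⟩
      (Q * (ℓ * m₂ ℓ′) + ℓ′ * (n * h ℓ)) + n * h ℓ  ≡⟨ e₁ (Q * (ℓ * m₂ ℓ′)) ℓ′ (n * h ℓ) ⟩
      Q * (ℓ * m₂ ℓ′) + ℓ * (n * h ℓ)  ≡⟨ cong (λ z → Q * z + ℓ * (n * h ℓ)) (sym (∑-codegrees ℓ′)) ⟩
      Q * ∑ vs (λ w → c w * codegrees w) + ℓ * (n * h ℓ)  ≡⟨ cong₂ _+_ (sym (∑-*ˡ vs Q _)) (trans (sym (*-assoc ℓ n (h ℓ))) (sym (∑-*ˡ vs (ℓ * n) c))) ⟩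
      ∑ vs (λ w → Q * (c w * codegrees w)) + ∑ vs (λ w → ℓ * n * c w)  ≡⟨ sym (∑-+ vs _ _) ⟩
      ∑ vs (λ w → Q * (c w * codegrees w) + ℓ * n * c w)  ≤⟨ ∑-mono vs bound ⟩
      ∑ vs (λ w → Q * n * c w + n * (suc Q * ℓ) * 𝟙 (rich? w))  ≡⟨ trans (∑-+ vs _ _) (cong₂ _+_ (∑-*ˡ vs (Q * n) c) (∑-*ˡ vs (n * (suc Q * ℓ)) _)) ⟩
      Q * n * h ℓ + n * (suc Q * ℓ) * # vs rich?  ≡⟨ cong₂ _+_ (*-assoc Q n (h ℓ)) (*-assoc n (suc Q * ℓ) (# vs rich?)) ⟩
      Q * (n * h ℓ) + n * (suc Q * ℓ * # vs rich?)  ∎))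
      where
      open ≤-Reasoning
      vs = vecs n ℓ
      c : Vec (Fin n) ℓ → ℕ
      c w = 𝟙 (clique? w)
      e₁ : ∀ x l y → (x + l * y) + y ≡ x + suc l * y
      e₁ = solve-∀
      H = suc h′
      d = ℓ ∸ r
      notShort : Q * n * H < ℓ * Q * h ℓ + ℓ′ * n * H
      notShort = subst (λ z → Q * n * z < ℓ * Q * h ℓ + ℓ′ * n * z) eq (subst₂ (λ x y → x * n * h ℓ′ < y * Q * h ℓ + ℓ′ * n * h ℓ′) (+-identityʳ Q) (+-identityʳ ℓ)
        (≰⇒> (subst (λ s → ¬ Short Q s 0) (suc-injective (m+[n∸m]≡n r≤ℓ)) (¬Short d 0 (trans (+-identityʳ _) (m+[n∸m]≡n r≤ℓ))))))
      avg : Q * (n * h ℓ) ≤ Q * (ℓ * m₂ ℓ′) + ℓ′ * (n * h ℓ)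
      avg = *-cancelˡ-≤ H (begin
        H * (Q * (n * h ℓ))  ≡⟨ a₁ H Q n (h ℓ) ⟩
        h ℓ * (Q * n * H)  ≤⟨ *-monoʳ-≤ (h ℓ) (<⇒≤ notShort) ⟩
        h ℓ * (ℓ * Q * h ℓ + ℓ′ * n * H)  ≡⟨ a₂ (h ℓ) ℓ Q ℓ′ n H ⟩
        ℓ * Q * (h ℓ * h ℓ) + H * (ℓ′ * (n * h ℓ))  ≤⟨ +-monoˡ-≤ _ (*-monoʳ-≤ (ℓ * Q) (subst (λ z → h ℓ * h ℓ ≤ z * m₂ ℓ′) eq (h-cauchy ℓ′))) ⟩
        ℓ * Q * (H * m₂ ℓ′) + H * (ℓ′ * (n * h ℓ))  ≡⟨ a₃ ℓ Q H (m₂ ℓ′) (ℓ′ * (n * h ℓ)) ⟩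
        H * (Q * (ℓ * m₂ ℓ′) + ℓ′ * (n * h ℓ))  ∎)
        where
        a₁ : ∀ H Q n x → H * (Q * (n * x)) ≡ x * (Q * n * H)
        a₁ = solve-∀
        a₂ : ∀ x l Q l′ n H → x * (l * Q * x + l′ * n * H) ≡ l * Q * (x * x) + H * (l′ * (n * x))
        a₂ = solve-∀
        a₃ : ∀ l Q H m y → l * Q * (H * m) + H * y ≡ H * (Q * (l * m) + y)
        a₃ = solve-∀
      codegrees≤ℓn : ∀ w → codegrees w ≤ ℓ * n
      codegrees≤ℓn w = ≤-trans (∑-mono (fins ℓ) λ i → deg≤n (removeAt w i)) (≤-reflexive (∑-fins-const ℓ n))
      bound : ∀ w → Q * (c w * codegrees w) + ℓ * n * c w ≤ Q * n * c w + n * (suc Q * ℓ) * 𝟙 (rich? w)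
      bound w with clique? w
      ... | no _ = ≤-trans (≤-reflexive (cong₂ _+_ (*-zeroʳ Q) (*-zeroʳ (ℓ * n)))) z≤n
      ... | yes cl with Q * n ≤? Q * codegrees w + ℓ * n
      ...   | yes _ = ≤-trans (≤-trans (+-monoˡ-≤ (ℓ * n * 1) (*-monoʳ-≤ Q (≤-trans (≤-reflexive (*-identityˡ _)) (codegrees≤ℓn w)))) (≤-reflexive (b₁ Q ℓ n))) (m≤n+m _ (Q * n * 1))
        where
        b₁ : ∀ Q l n → Q * (l * n) + l * n * 1 ≡ n * (suc Q * l) * 1
        b₁ = solve-∀
      ...   | no lt = ≤-trans (≤-reflexive (b₂ Q (codegrees w) (ℓ * n))) (≤-trans (<⇒≤ (≰⇒> lt)) (≤-trans (≤-reflexive (sym (*-identityʳ (Q * n)))) (m≤m+n _ _)))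
        where
        b₂ : ∀ Q x y → Q * (1 * x) + y * 1 ≡ Q * x + y
        b₂ = solve-∀

    rich-dense : n ^ ℓ ≤ ℓ ^ r * Q * (ℓ * Q) ^ (ℓ ∸ r) * (suc Q * ℓ) * # (vecs n ℓ) rich?
    rich-dense = ≤-trans grown (≤-trans (*-monoʳ-≤ C (h≤rich 0<h)) (≤-reflexive (sym (*-assoc C (suc Q * ℓ) _))))
      where
      C = ℓ ^ r * Q * (ℓ * Q) ^ (ℓ ∸ r)
      grown : n ^ ℓ ≤ C * h ℓ
      grown = subst (λ x → n ^ x ≤ C * h x) (m+[n∸m]≡n r≤ℓ) (h-grows (ℓ ∸ r) (≤-reflexive (m+[n∸m]≡n r≤ℓ)))
      0<h : 0 < h ℓ′
      0<h with h ℓ′ in eq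
      ... | suc _ = s≤s z≤n
      ... | zero  = contradiction (≤-trans (m^n>0′ n ℓ 0<n) (≤-trans grown (≤-reflexive (trans (cong (C *_) (trans (h-suc ℓ′) (n≤0⇒n≡0
              (≤-trans (∑-mono (vecs n ℓ′) (λ w → *-monoʳ-≤ (𝟙 (clique? w)) (deg≤n w))) (≤-reflexive (trans (∑-*ʳ (vecs n ℓ′) n _) (cong (_* n) eq))))))) (*-zeroʳ C))))) λ ()
        where
        m^n>0′ : ∀ m k → 0 < m → 0 < m ^ k
        m^n>0′ (suc m) k _ = m^n>0 (suc m) k

-- Complete multipartite blow-ups in dense relations.

sel : ∀ {n T k} → (Fin k → Fin T → Fin n) → Vec (Fin T) k → Vec (Fin n) k
sel B []      = []
sel B (m ∷ f) = B zero m ∷ sel (B ∘ suc) f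

lookup-sel : ∀ {n T k} (B : Fin k → Fin T → Fin n) f i → Vec.lookup (sel B f) i ≡ B i (Vec.lookup f i)
lookup-sel B (m ∷ f) zero    = refl
lookup-sel B (m ∷ f) (suc i) = lookup-sel (B ∘ suc) f i

fromDec : ∀ {n} {P : Fin n → Set} → Decidable P → Subset n
fromDec P? = Vec.tabulate (does ∘ P?)

∈-fromDec⁺ : ∀ {n} {P : Fin n → Set} (P? : Decidable P) {x} → P x → x ∈ fromDec P?
∈-fromDec⁺ P? {x} p = lookup⇒[]= x _ (trans (lookup∘tabulate (does ∘ P?) x) (dec-true (P? x) p))

∈-fromDec⁻ : ∀ {n} {P : Fin n → Set} (P? : Decidable P) {x} → x ∈ fromDec P? → P x
∈-fromDec⁻ P? {x} q with P? x | trans (sym (lookup∘tabulate (does ∘ P?) x)) ([]=⇒lookup q)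
... | yes p | _ = p

∣fromDec∣ : ∀ {n} {P : Fin n → Set} (P? : Decidable P) → ∣ fromDec P? ∣ ≡ # (fins n) P?
∣fromDec∣ {n} P? = trans (∣∣-# (fromDec P?)) (#-cong (fins n) (_∈? fromDec P?) P? (λ _ → ∈-fromDec⁻ P?) (λ _ → ∈-fromDec⁺ P?))

0<*⇒0< : ∀ a {b} → 0 < a * b → 0 < a
0<*⇒0< (suc a) _ = s≤s z≤n

AllIn : ∀ {n M k} → (Vec (Fin n) (suc k) → Set) → (Fin M → Fin n) → Subset M → Vec (Fin n) k → Set
AllIn R y I w = ∀ m → m ∈ I → R (y m ∷ w)

allIn? : ∀ {n M k} {R : Vec (Fin n) (suc k) → Set} → Decidable R → (y : Fin M → Fin n) (I : Subset M) → Decidable (AllIn R y I)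
allIn? R? y I w = all? (λ m → m ∈? I →-dec R? (y m ∷ w))

-- Among boundedly many heavy first coordinates y, pigeonhole over the subsets of those related to w.
heavy-fibre : ∀ k T c M n → 4 * c * T < M → 0 < n → {R : Vec (Fin n) (suc k) → Set} (R? : Decidable R) (y : Fin M → Fin n) →
  (∀ m → n ^ k ≤ 2 * c * # (vecs n k) (λ w → R? (y m ∷ w))) →
  ∃ λ (I : Subset M) → T ≤ # (fins M) (_∈? I) × n ^ k ≤ 4 * c * 2 ^ M * # (vecs n k) (allIn? R? y I)
heavy-fibre k T c M n T<M 0<n {R} R? y good =
  finish (∑-pigeon (sets M) (λ I → # (vecs n k) (big? I)) X (≤-trans (m^n>0 2 M) (≤-reflexive (sym (length-sets M)))) X≤)
  where
  open ≤-Reasoning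
  d : Vec (Fin n) k → ℕ
  d w = # (fins M) (λ m → R? (y m ∷ w))
  d-bound : ∀ w → d w ≤ T + M * 𝟙 (T ≤? d w)
  d-bound w with T ≤? d w
  ... | yes _ = ≤-trans (≤-trans (#-≤-length (fins M) (λ m → R? (y m ∷ w))) (≤-reflexive (trans (length-fins M) (sym (*-identityʳ M))))) (m≤n+m _ T)
  ... | no lt = ≤-trans (<⇒≤ (≰⇒> lt)) (m≤m+n T _)
  X = # (vecs n k) (λ w → T ≤? d w)
  -- A tuple with fewer than `T` partners counts at most `T`, any other at most `M`. As
  -- `4 * c * T < M`, the former account for less than half of the total.
  nk≤X : n ^ k ≤ 4 * c * X
  nk≤X = *-cancelˡ-≤ M {{>-nonZero (≤-trans (s≤s z≤n) T<M)}} (+-cancelʳ-≤ (4 * c * T * n ^ k) _ _ (begin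
    M * n ^ k + 4 * c * T * n ^ k  ≤⟨ +-monoʳ-≤ (M * n ^ k) (*-monoˡ-≤ (n ^ k) (<⇒≤ T<M)) ⟩
    M * n ^ k + M * n ^ k  ≡⟨ e₁ (M * n ^ k) ⟩
    2 * (M * n ^ k)  ≡⟨ cong (2 *_) (sym (∑-fins-const M (n ^ k))) ⟩
    2 * ∑ (fins M) (λ _ → n ^ k)  ≤⟨ *-monoʳ-≤ 2 (∑-mono (fins M) good) ⟩
    2 * ∑ (fins M) (λ m → 2 * c * # (vecs n k) (λ w → R? (y m ∷ w)))  ≡⟨ cong (2 *_) (trans (∑-*ˡ (fins M) (2 * c) _) (cong (2 * c *_) (∑-swap (fins M) (vecs n k) _))) ⟩
    2 * (2 * c * ∑ (vecs n k) d)  ≤⟨ *-monoʳ-≤ 2 (*-monoʳ-≤ (2 * c) (∑-mono (vecs n k) d-bound)) ⟩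
    2 * (2 * c * ∑ (vecs n k) (λ w → T + M * 𝟙 (T ≤? d w)))  ≡⟨ cong (λ z → 2 * (2 * c * z)) (trans (∑-+ (vecs n k) _ _) (cong₂ _+_ (∑-vecs-const n k T) (∑-*ˡ (vecs n k) M _))) ⟩
    2 * (2 * c * (n ^ k * T + M * X))  ≡⟨ e₂ c (n ^ k) T M X ⟩
    M * (4 * c * X) + 4 * c * T * n ^ k  ∎))
    where
    e₁ : ∀ x → x + x ≡ 2 * x
    e₁ = solve-∀
    e₂ : ∀ c p T M X → 2 * (2 * c * (p * T + M * X)) ≡ M * (4 * c * X) + 4 * c * T * p
    e₂ = solve-∀
  big? : ∀ I w → Dec (T ≤ ∣ I ∣ × AllIn R y I w)
  big? I w = (T ≤? ∣ I ∣) ×-dec allIn? R? y I w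
  X≤ : X ≤ ∑ (sets M) (λ I → # (vecs n k) (big? I))
  X≤ = #-⋃ (vecs n k) (sets M) (λ w → T ≤? d w) big? λ w p → fromDec (λ m → R? (y m ∷ w)) , ∈-sets _ ,
    ≤-trans p (≤-reflexive (sym (∣fromDec∣ (λ m → R? (y m ∷ w))))) , λ m q → ∈-fromDec⁻ (λ m → R? (y m ∷ w)) q
  large : ∀ I → 0 < # (vecs n k) (big? I) → T ≤ # (fins M) (_∈? I)
  large I p = ≤-trans (proj₁ (proj₂ (#-∃ (vecs n k) (big? I) p))) (≤-reflexive (∣∣-# I))
  finish : (∃ λ I → X ≤ length (sets M) * # (vecs n k) (big? I)) →
    ∃ λ (I : Subset M) → T ≤ # (fins M) (_∈? I) × n ^ k ≤ 4 * c * 2 ^ M * # (vecs n k) (allIn? R? y I)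
  finish (I , p) = I , large I (0<*⇒0< _ (≤-trans (m^n>0 n {{>-nonZero 0<n}} k) (≤-trans dense-I (≤-reflexive (*-comm (4 * c * 2 ^ M) _))))) ,
    ≤-trans dense-I (*-monoʳ-≤ (4 * c * 2 ^ M) (#-mono (vecs n k) (big? I) (allIn? R? y I) λ _ → proj₂))
    where
    dense-I : n ^ k ≤ 4 * c * 2 ^ M * # (vecs n k) (big? I)
    dense-I = ≤-trans nk≤X (≤-trans (*-monoʳ-≤ (4 * c) (≤-trans p (≤-reflexive (cong (_* # (vecs n k) (big? I)) (length-sets M)))))
      (≤-reflexive (sym (*-assoc (4 * c) (2 ^ M) _))))

-- At least `n / (2 c)` first entries carry half of the average density. `M` of them are kept, and
-- `heavy-fibre` finds at least `T` of these with many common `w`.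
dense-fibre : ∀ k T c M n → 4 * c * T < M → 2 * c * M < n → {R : Vec (Fin n) (suc k) → Set} (R? : Decidable R) →
  n ^ suc k ≤ c * # (vecs n (suc k)) R? →
  ∃ λ (y : Fin M → Fin n) → ∃ λ (I : Subset M) → Injective _≡_ _≡_ y × T ≤ # (fins M) (_∈? I) ×
    n ^ k ≤ 4 * c * 2 ^ M * # (vecs n k) (allIn? R? y I)
dense-fibre k T c M n T<M N≤n {R} R? dense = finish (#-choose (fins-unique n) good? M≤good)
  where
  open ≤-Reasoning
  0<n : 0 < n
  0<n = ≤-trans (s≤s z≤n) N≤n
  rv : Fin n → ℕ
  rv v = # (vecs n k) (λ w → R? (v ∷ w))
  0<nk : 0 < n ^ k
  0<nk = m^n>0 n {{>-nonZero 0<n}} k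
  dense′ : n * n ^ k ≤ c * ∑ (fins n) rv
  dense′ = ≤-trans dense (≤-reflexive (cong (c *_) (∑-vecs-suc n k _)))
  good? = λ v → n ^ k ≤? 2 * c * rv v
  rv≤ : ∀ v → rv v ≤ n ^ k
  rv≤ v = ≤-trans (∑-mono (vecs n k) λ w → 𝟙≤1 (R? (v ∷ w))) (≤-reflexive (trans (∑-vecs-const n k 1) (*-identityʳ _)))
  good-bound : ∀ v → 2 * c * rv v ≤ 2 * c * n ^ k * 𝟙 (good? v) + n ^ k
  good-bound v with good? v
  ... | yes _ = ≤-trans (≤-trans (*-monoʳ-≤ (2 * c) (rv≤ v)) (≤-reflexive (sym (*-identityʳ _)))) (m≤m+n _ _)
  ... | no lt = ≤-trans (<⇒≤ (≰⇒> lt)) (m≤n+m _ _)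
  n≤good : n ≤ 2 * c * # (fins n) good?
  n≤good = *-cancelˡ-≤ (n ^ k) {{>-nonZero 0<nk}} (+-cancelʳ-≤ (n ^ k * n) _ _ (begin
    n ^ k * n + n ^ k * n  ≡⟨ e₁ n (n ^ k) ⟩
    2 * (n * n ^ k)  ≤⟨ *-monoʳ-≤ 2 dense′ ⟩
    2 * (c * ∑ (fins n) rv)  ≡⟨ trans (sym (*-assoc 2 c _)) (sym (∑-*ˡ (fins n) (2 * c) rv)) ⟩
    ∑ (fins n) (λ v → 2 * c * rv v)  ≤⟨ ∑-mono (fins n) good-bound ⟩
    ∑ (fins n) (λ v → 2 * c * n ^ k * 𝟙 (good? v) + n ^ k)  ≡⟨ trans (∑-+ (fins n) _ _) (cong₂ _+_ (∑-*ˡ (fins n) (2 * c * n ^ k) _) (∑-fins-const n (n ^ k))) ⟩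
    2 * c * n ^ k * # (fins n) good? + n * n ^ k  ≡⟨ e₂ c (n ^ k) (# (fins n) good?) n ⟩
    n ^ k * (2 * c * # (fins n) good?) + n ^ k * n  ∎))
    where
    e₁ : ∀ n p → p * n + p * n ≡ 2 * (n * p)
    e₁ = solve-∀
    e₂ : ∀ c p g n → 2 * c * p * g + n * p ≡ p * (2 * c * g) + p * n
    e₂ = solve-∀
  M≤good : M ≤ # (fins n) good?
  M≤good = *-cancelˡ-≤ (2 * c) {{>-nonZero (0<*⇒0< (2 * c) (≤-trans 0<n n≤good))}} (≤-trans (<⇒≤ N≤n) n≤good)
  finish : (∃ λ (y : Fin M → Fin n) → Injective _≡_ _≡_ y × (∀ m → n ^ k ≤ 2 * c * rv (y m))) →
    ∃ λ (y : Fin M → Fin n) → ∃ λ (I : Subset M) → Injective _≡_ _≡_ y × T ≤ # (fins M) (_∈? I) ×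
      n ^ k ≤ 4 * c * 2 ^ M * # (vecs n k) (allIn? R? y I)
  finish (y , yinj , good) =
    let I , T≤I , dense-I = heavy-fibre k T c M n T<M 0<n R? y good in y , I , yinj , T≤I , dense-I

-- Disjointness of the blocks is not part of the conclusion: in the application vertices of
-- different blocks form heavy pairs and are therefore distinct.
Blowup : ℕ → ℕ → ℕ → Set₁
Blowup k T c = ∃ λ N → ∀ n → N ≤ n → {R : Vec (Fin n) k → Set} (R? : Decidable R) → n ^ k ≤ c * # (vecs n k) R? →
  ∃ λ (B : Fin k → Fin T → Fin n) → (∀ i → Injective _≡_ _≡_ (B i)) × (∀ f → R (sel B f))

blowup-zero : ∀ T c → Blowup 0 T c
blowup-zero T c = 0 , λ n _ {R} R? p → (λ ()) , (λ ()) , λ { [] → nonempty R? p }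
  where
  nonempty : ∀ {n} {R : Vec (Fin n) 0 → Set} (R? : Decidable R) → 1 ≤ c * # (vecs n 0) R? → R []
  nonempty R? p with R? []
  ... | yes q = q
  ... | no _  = contradiction (≤-trans p (≤-reflexive (*-zeroʳ c))) λ ()

blowup-suc : ∀ k T c M → 4 * c * T < M → Blowup k T (4 * c * 2 ^ M) → Blowup (suc k) T c
blowup-suc k T c M T<M (N , ih) = suc (2 * c * M + N) , main
  where
  module _ {n : ℕ} {R : Vec (Fin n) (suc k) → Set} (y : Fin M → Fin n) (I : Subset M) (yinj : Injective _≡_ _≡_ y) where
    join : (∃ λ (B : Fin k → Fin T → Fin n) → (∀ i → Injective _≡_ _≡_ (B i)) × (∀ f → AllIn R y I (sel B f))) →
      (∃ λ (g : Fin T → Fin M) → Injective _≡_ _≡_ g × (∀ i → g i ∈ I)) →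
      ∃ λ (B : Fin (suc k) → Fin T → Fin n) → (∀ i → Injective _≡_ _≡_ (B i)) × (∀ f → R (sel B f))
    join (B , inj , good) (g , ginj , g∈) = B′ , inj′ , sel′
      where
      B′ : Fin (suc k) → Fin T → Fin n
      B′ zero    = y ∘ g
      B′ (suc i) = B i
      inj′ : ∀ i → Injective _≡_ _≡_ (B′ i)
      inj′ zero    = ginj ∘ yinj
      inj′ (suc i) = inj i
      sel′ : ∀ f → R (sel B′ f)
      sel′ (m ∷ f) = good f (g m) (g∈ m)
  main : ∀ n → suc (2 * c * M + N) ≤ n → {R : Vec (Fin n) (suc k) → Set} (R? : Decidable R) → n ^ suc k ≤ c * # (vecs n (suc k)) R? →
    ∃ λ (B : Fin (suc k) → Fin T → Fin n) → (∀ i → Injective _≡_ _≡_ (B i)) × (∀ f → R (sel B f))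
  main n N≤n {R} R? dense =
    let y , I , yinj , T≤I , dense-I = dense-fibre k T c M n T<M (≤-trans (s≤s (m≤m+n (2 * c * M) N)) N≤n) R? dense
    in join {R = R} y I yinj (ih n (≤-trans (m≤n+m N (2 * c * M)) (≤-trans (n≤1+n _) N≤n)) {AllIn R y I} (allIn? R? y I) dense-I)
         (#-choose (fins-unique M) (_∈? I) T≤I)

-- Erdős's theorem on complete multipartite subhypergraphs.
blowup : ∀ k T c → Blowup k T c
blowup zero    T c = blowup-zero T c
blowup (suc k) T c = blowup-suc k T c (suc (4 * c * T)) ≤-refl (blowup k T (4 * c * 2 ^ suc (4 * c * T)))

-- Rainbow copies as a finite search.

anyVec? : ∀ {A : Set} → (∀ {P : A → Set} → Decidable P → Dec (∃ P)) →
  ∀ k {P : Vec A k → Set} → Decidable P → Dec (∃ P)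
anyVec? any zero P? = map′ ([] ,_) (λ { ([] , p) → p }) (P? [])
anyVec? any (suc k) P? = map′ (λ { (x , w , p) → x ∷ w , p }) (λ { (x ∷ w , p) → x , w , p })
  (any (λ x → anyVec? any k (λ w → P? (x ∷ w))))

Edge : ∀ K → (Fin K → Fin K → Bool) → Fin K → Fin K → Set
Edge K adj i j = T ((toℕ i <ᵇ toℕ j) ∧ adj i j)

module RainbowSystems (r K : ℕ) (adj : Fin K → Fin K → Bool) where

  Exact : (Fin K → Fin n) → Fin K → Fin K → Subset n → Set
  Exact core i j S = ∣ S ∣ ≡ r × core i ∈ S × core j ∈ S × (∀ k → core k ∈ S → k ≡ i ⊎ k ≡ j)

  -- Together with `Exact` this makes two sets meet at most in common ends of their edges.
  Compatible : (Subset n → ℕ) → (Fin K → Fin n) → Subset n → Subset n → Set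
  Compatible χ core S S′ = (∀ x → x ∈ S → x ∈ S′ → ∃ λ k → core k ≡ x) × χ S ≢ χ S′

  Rainbow : (Subset n → ℕ) → (Fin K → Fin n) → (Fin K → Fin K → Subset n) → Set
  Rainbow χ core ext = (∀ i j → core i ≡ core j → i ≡ j)
    × (∀ i j → Edge K adj i j → Exact core i j (ext i j))
    × (∀ i j i′ j′ → Edge K adj i j → Edge K adj i′ j′ → ¬ (i ≡ i′ × j ≡ j′) → Compatible χ core (ext i j) (ext i′ j′))

  edge? : ∀ i j → Dec (Edge K adj i j)
  edge? i j = T? ((toℕ i <ᵇ toℕ j) ∧ adj i j)

  rainbow? : ∀ (χ : Subset n → ℕ) core ext → Dec (Rainbow χ core ext)
  rainbow? χ core ext = all? (λ i → all? λ j → core i ≟ᶠ core j →-dec i ≟ᶠ j)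
    ×-dec (all? (λ i → all? λ j → edge? i j →-dec (has? r (ext i j) ×-dec (core i ∈? ext i j ×-dec (core j ∈? ext i j ×-dec
            all? λ k → core k ∈? ext i j →-dec (k ≟ᶠ i ⊎-dec k ≟ᶠ j)))))
    ×-dec all? (λ i → all? λ j → all? λ i′ → all? λ j′ → edge? i j →-dec (edge? i′ j′ →-dec (¬? (i ≟ᶠ i′ ×-dec j ≟ᶠ j′) →-dec
            (all? (λ x → x ∈? ext i j →-dec (x ∈? ext i′ j′ →-dec any? (λ k → core k ≟ᶠ x))) ×-dec ¬? (χ (ext i j) ≟ χ (ext i′ j′)))))))

  -- Tables replace functions so that a system can be searched for, which makes arguments by
  -- contradiction available. Colours are natural numbers, so a colouring can be restricted to fewer
  -- vertices without a change of its range.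
  RainbowSystem : (Subset n → ℕ) → Set
  RainbowSystem {n} χ = ∃ λ (c : Vec (Fin n) K) → ∃ λ (e : Vec (Vec (Subset n) K) K) →
    Rainbow χ (Vec.lookup c) (λ i j → Vec.lookup (Vec.lookup e i) j)

  rainbowSystem? : (χ : Subset n → ℕ) → Dec (RainbowSystem χ)
  rainbowSystem? {n} χ = anyVec? any? K λ c → anyVec? (λ P? → anyVec? anySubset? K P?) K λ e → rainbow? χ _ _

  toSystem : ∀ {χ : Subset n → ℕ} core ext → Rainbow χ core ext → RainbowSystem χ
  toSystem {n} {χ} core ext (inj , exact , comp) = c , e , inj′ , exact′ , comp′
    where
    c = Vec.tabulate core
    e = Vec.tabulate (λ i → Vec.tabulate (ext i))
    c≡ : ∀ i → Vec.lookup c i ≡ core i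
    c≡ = lookup∘tabulate core
    e≡ : ∀ i j → Vec.lookup (Vec.lookup e i) j ≡ ext i j
    e≡ i j = trans (cong (λ w → Vec.lookup w j) (lookup∘tabulate (λ i → Vec.tabulate (ext i)) i)) (lookup∘tabulate (ext i) j)
    inj′ : ∀ i j → Vec.lookup c i ≡ Vec.lookup c j → i ≡ j
    inj′ i j q = inj i j (trans (sym (c≡ i)) (trans q (c≡ j)))
    exact′ : ∀ i j → Edge K adj i j → Exact (Vec.lookup c) i j (Vec.lookup (Vec.lookup e i) j)
    exact′ i j ed with exact i j ed
    ... | h , p , q , only rewrite e≡ i j | c≡ i | c≡ j = h , p , q , λ k k∈ → only k (subst (_∈ ext i j) (c≡ k) k∈)
    comp′ : ∀ i j i′ j′ → Edge K adj i j → Edge K adj i′ j′ → ¬ (i ≡ i′ × j ≡ j′) →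
      Compatible χ (Vec.lookup c) (Vec.lookup (Vec.lookup e i) j) (Vec.lookup (Vec.lookup e i′) j′)
    comp′ i j i′ j′ ed ed′ ne with comp i j i′ j′ ed ed′ ne
    ... | meet , χ≢ rewrite e≡ i j | e≡ i′ j′ = (λ x p q → let k , z = meet x p q in k , trans (c≡ k) z) , χ≢

#-minus-two : ∀ (S : Subset n) {a b} → a ∈ S → b ∈ S → a ≢ b →
  ∣ S ∣ ≡ 2 + # (fins n) (λ x → x ∈? S ×-dec (¬? (x ≟ᶠ a) ×-dec ¬? (x ≟ᶠ b)))
#-minus-two {n} S {a} {b} a∈ b∈ a≢b = trans (∣∣-# S) (trans (∑-cong (fins n) split) (trans (∑-+ (fins n) _ _)
    (cong₂ _+_ (#-≡ a) (trans (∑-+ (fins n) _ _) (cong (_+ # (fins n) P?) (#-≡ b))))))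
  where
  P? = λ x → x ∈? S ×-dec (¬? (x ≟ᶠ a) ×-dec ¬? (x ≟ᶠ b))
  split : ∀ x → 𝟙 (x ∈? S) ≡ 𝟙 (x ≟ᶠ a) + (𝟙 (x ≟ᶠ b) + 𝟙 (P? x))
  split x with x ∈? S | x ≟ᶠ a | x ≟ᶠ b
  ... | yes _ | yes refl | yes refl = contradiction refl a≢b
  ... | yes _ | yes _    | no _     = refl
  ... | yes _ | no _     | yes _    = refl
  ... | yes _ | no _     | no _     = refl
  ... | no x∉ | yes refl | _        = contradiction a∈ x∉
  ... | no x∉ | no _     | yes refl = contradiction b∈ x∉
  ... | no _  | no _     | no _     = refl

module RainbowCopies (r K : ℕ) (adj : Fin K → Fin K → Bool) where

  open RainbowSystems r K adj

  -- The `r ∸ 2` new vertices of an edge go to the elements of its set other than the two ends. By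
  -- `Exact` these are no core vertices, and for different edges they differ because the sets meet
  -- only in the core.
  toCopy : ∀ {m} {χ : Subset n → Fin m} → RainbowSystem (toℕ ∘ χ) → RainbowCopy (Expansion r K adj) χ
  toCopy {n} {m} {χ} (c , e , inj , exact , comp) = φ , φ-inj , rainbow
    where
    H = Expansion r K adj
    core = Vec.lookup c
    ext = λ i j → Vec.lookup (Vec.lookup e i) j
    rest? : ∀ i j x → Dec (x ∈ ext i j × x ≢ core i × x ≢ core j)
    rest? i j x = x ∈? ext i j ×-dec (¬? (x ≟ᶠ core i) ×-dec ¬? (x ≟ᶠ core j))
    edge-≢ : ∀ {i j} → Edge K adj i j → i ≢ j
    edge-≢ {i} ed refl = <-irrefl refl (<ᵇ⇒< (toℕ i) (toℕ i) (proj₁ (∧⁻ {toℕ i <ᵇ toℕ i} ed)))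
    abstract
      enum : ∀ i j → Edge K adj i j → ∃ λ (f : Fin (r ∸ 2) → Fin n) → Injective _≡_ _≡_ f ×
        (∀ k → f k ∈ ext i j × f k ≢ core i × f k ≢ core j) × (∀ x → x ∈ˡ fins n → (x ∈ ext i j × x ≢ core i × x ≢ core j) → ∃ λ k → f k ≡ x)
      enum i j ed = let h , p , q , _ = exact i j ed in #-enum (fins-unique n) (rest? i j)
        (cong (_∸ 2) (trans (sym h) (#-minus-two (ext i j) p q (edge-≢ ed ∘ inj i j))))
    φ : V H → Fin n
    φ (inj₁ x) = core x
    φ (inj₂ (((i , j) , ed) , k)) = proj₁ (enum i j ed) k
    φ∈ : ∀ i j ed k → φ (inj₂ (((i , j) , ed) , k)) ∈ ext i j × φ (inj₂ (((i , j) , ed) , k)) ≢ core i × φ (inj₂ (((i , j) , ed) , k)) ≢ core j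
    φ∈ i j ed = proj₁ (proj₂ (proj₂ (enum i j ed)))
    notCore : ∀ i j ed k x → φ (inj₂ (((i , j) , ed) , k)) ≢ core x
    notCore i j ed k x eq with φ∈ i j ed k
    ... | p , ≢i , ≢j with proj₂ (proj₂ (proj₂ (exact i j ed))) x (subst (_∈ ext i j) eq p)
    ...   | inj₁ refl = ≢i eq
    ...   | inj₂ refl = ≢j eq
    φ-inj : Injective _≡_ _≡_ φ
    φ-inj {inj₁ x} {inj₁ y} eq = cong inj₁ (inj x y eq)
    φ-inj {inj₁ x} {inj₂ (((i , j) , ed) , k)} eq = contradiction (sym eq) (notCore i j ed k x)
    φ-inj {inj₂ (((i , j) , ed) , k)} {inj₁ x} eq = contradiction eq (notCore i j ed k x)
    φ-inj {inj₂ (((i , j) , ed) , k)} {inj₂ (((i′ , j′) , ed′) , k′)} eq with i ≟ᶠ i′ ×-dec j ≟ᶠ j′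
    ... | no ne with proj₁ (comp i j i′ j′ ed ed′ ne) _ (proj₁ (φ∈ i j ed k)) (subst (_∈ ext i′ j′) (sym eq) (proj₁ (φ∈ i′ j′ ed′ k′)))
    ...   | x , z = contradiction (sym z) (notCore i j ed k x)
    φ-inj {inj₂ (((i , j) , ed) , k)} {inj₂ (((i , j) , ed′) , k′)} eq | yes (refl , refl) with T-irrelevant ed ed′
    ... | refl = cong (λ k → inj₂ (((i , j) , ed) , k)) (proj₁ (proj₂ (enum i j ed)) eq)
    image : ∀ i j ed s → IsImage H φ ((i , j) , ed) s → s ≡ ext i j
    image i j ed s im = ⊆-antisym sub sup
      where
      ex = exact i j ed
      sub : ∀ {x} → x ∈ s → x ∈ ext i j
      sub {x} x∈ with Equivalence.to (im x) x∈
      ... | inj₁ y , inj₁ refl , refl = proj₁ (proj₂ ex)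
      ... | inj₁ y , inj₂ refl , refl = proj₁ (proj₂ (proj₂ ex))
      ... | inj₂ (_ , k) , refl , refl = proj₁ (φ∈ i j ed k)
      sup : ∀ {x} → x ∈ ext i j → x ∈ s
      sup {x} x∈ with x ≟ᶠ core i | x ≟ᶠ core j
      ... | yes p | _     = Equivalence.from (im x) (inj₁ i , inj₁ refl , sym p)
      ... | no _  | yes p = Equivalence.from (im x) (inj₁ j , inj₂ refl , sym p)
      ... | no p  | no q with proj₂ (proj₂ (proj₂ (enum i j ed))) x (∈-fins x) (x∈ , p , q)
      ...   | k , z = Equivalence.from (im x) (inj₂ (((i , j) , ed) , k) , refl , z)
    rainbow : ∀ (a b : E H) (s s′ : Subset n) → a ≢ b → IsImage H φ a s → IsImage H φ b s′ → χ s ≢ χ s′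
    rainbow ((i , j) , ed) ((i′ , j′) , ed′) s s′ ne im im′ eq with image i j ed s im | image i′ j′ ed′ s′ im′
    ... | refl | refl = proj₂ (comp i j i′ j′ ed ed′ same) (cong toℕ eq)
      where
      same : ¬ (i ≡ i′ × j ≡ j′)
      same (refl , refl) = ne (cong ((i , j) ,_) (T-irrelevant ed ed′))

-- Heavy pairs and greedy embedding.

-- Each new set avoids, apart from its exempted points `X e`, everything chosen before; `B` bounds
-- what can pile up. Of two sets the later one avoids the earlier, which explains the disjunction.
greedy : ∀ m (r B : ℕ) (Q : Fin m → Subset n → Set) (X : Fin m → Fin n → Set) (Z₀ : Subset n) → ∣ Z₀ ∣ + m * r ≤ B →
  (∀ e Z → ∣ Z ∣ ≤ B → ∃ λ S → Q e S × ∣ S ∣ ≤ r × (∀ z → z ∈ S → z ∈ Z → X e z)) →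
  ∃ λ (f : Fin m → Subset n) → (∀ e → Q e (f e)) × (∀ e z → z ∈ f e → z ∈ Z₀ → X e z) ×
    (∀ e e′ → e ≢ e′ → (∀ z → z ∈ f e → z ∈ f e′ → X e z) ⊎ (∀ z → z ∈ f e → z ∈ f e′ → X e′ z))
greedy zero r B Q X Z₀ _ pick = (λ ()) , (λ ()) , (λ ()) , λ ()
greedy (suc m) r B Q X Z₀ bound pick with pick zero Z₀ (m+n≤o⇒m≤o ∣ Z₀ ∣ bound)
... | S , qS , S≤r , avoid with greedy m r B (Q ∘ suc) (X ∘ suc) (Z₀ ∪ S)
      (≤-trans (+-monoˡ-≤ (m * r) (≤-trans (∣∪∣≤ Z₀ S) (+-monoʳ-≤ ∣ Z₀ ∣ S≤r))) (≤-trans (≤-reflexive (+-assoc ∣ Z₀ ∣ r (m * r))) bound)) (pick ∘ suc)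
...   | f , qf , avf , sep = f′ , q′ , av′ , sep′
  where
  f′ : Fin (suc m) → Subset _
  f′ zero    = S
  f′ (suc e) = f e
  q′ : ∀ e → Q e (f′ e)
  q′ zero    = qS
  q′ (suc e) = qf e
  av′ : ∀ e z → z ∈ f′ e → z ∈ Z₀ → X e z
  av′ zero    = avoid
  av′ (suc e) z p q = avf e z p (x∈p∪q⁺ (inj₁ q))
  sep′ : ∀ e e′ → e ≢ e′ → (∀ z → z ∈ f′ e → z ∈ f′ e′ → X e z) ⊎ (∀ z → z ∈ f′ e → z ∈ f′ e′ → X e′ z)
  sep′ zero    zero     ne = contradiction refl ne
  sep′ zero    (suc e′) ne = inj₂ λ z p q → avf e′ z q (x∈p∪q⁺ (inj₂ p))
  sep′ (suc e) zero     ne = inj₁ λ z p q → avf e z p (x∈p∪q⁺ (inj₂ q))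
  sep′ (suc e) (suc e′) ne = sep e e′ (ne ∘ cong suc)

-- Serves to tell sets apart: a set of at least three elements that avoids another one up to two
-- points differs from it.
pair-small : ∀ (S : Subset n) {a b k} → ∣ S ∣ ≡ 3 + k → ¬ (∀ z → z ∈ S → z ≡ a ⊎ z ≡ b)
pair-small S {a} {b} h p = contradiction (≤-trans (≤-reflexive (sym h)) (≤-trans (p⊆q⇒∣p∣≤∣q∣ sub) (≤-trans (∣∪∣≤ ⁅ a ⁆ ⁅ b ⁆) (≤-reflexive (cong₂ _+_ (∣⁅x⁆∣≡1 a) (∣⁅x⁆∣≡1 b))))))
  λ { (s≤s (s≤s ())) }
  where
  sub : ∀ {z} → z ∈ S → z ∈ ⁅ a ⁆ ∪ ⁅ b ⁆
  sub {z} z∈ with p z z∈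
  ... | inj₁ refl = x∈p∪q⁺ (inj₁ (x∈⁅x⁆ z))
  ... | inj₂ refl = x∈p∪q⁺ (inj₂ (x∈⁅x⁆ z))

∣∅∣≤ : ∀ {n} k → ∣ ∅ {n} ∣ ≤ k
∣∅∣≤ {n} k = ≤-trans (≤-reflexive (∣⊥∣≡0 n)) z≤n

Same : ∀ {K} → Fin K → Fin K → Fin K → Fin K → Set
Same u w x y = (x ≡ u × y ≡ w) ⊎ (x ≡ w × y ≡ u)

same? : ∀ {K} (u w x y : Fin K) → Dec (Same u w x y)
same? u w x y = (x ≟ᶠ u ×-dec y ≟ᶠ w) ⊎-dec (x ≟ᶠ w ×-dec y ≟ᶠ u)

-- G plays the role of a rainbow subgraph with one edge of each colour.
module Representatives {n : ℕ} (r′ Cap : ℕ) (χ : Subset n → ℕ) (G : Subset n → Set) (G? : Decidable G)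
  (G-size : ∀ {S} → G S → ∣ S ∣ ≡ 4 + r′) (G-inj : ∀ {S S′} → G S → G S′ → χ S ≡ χ S′ → S ≡ S′) where

  r : ℕ
  r = 4 + r′

  codeg : Fin n → Fin n → ℕ
  codeg x y = # (sets n) (λ S → x ∈? S ×-dec (y ∈? S ×-dec G? S))

  Heavy : Fin n → Fin n → Set
  Heavy x y = x ≢ y × Cap * n ^ (1 + r′) < codeg x y

  heavy? : ∀ x y → Dec (Heavy x y)
  heavy? x y = ¬? (x ≟ᶠ y) ×-dec (Cap * n ^ (1 + r′) <? codeg x y)

  Heavy-sym : ∀ {x y} → Heavy x y → Heavy y x
  Heavy-sym {x} {y} (x≢y , p) = x≢y ∘ sym , ≤-trans p (#-mono (sets n) (λ S → x ∈? S ×-dec (y ∈? S ×-dec G? S)) (λ S → y ∈? S ×-dec (x ∈? S ×-dec G? S)) λ S (a , b , c) → b , a , c)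

  -- For each of the at most `Cap` vertices of `Z`, at most `n ^ (r ∸ 3)` sets contain it together
  -- with `x` and `y`; the codegree of a heavy pair exceeds the total.
  heavy-pick : ∀ {x y} → Heavy x y → ∀ Z → ∣ Z ∣ ≤ Cap → ∃ λ S → G S × x ∈ S × y ∈ S × (∀ z → z ∈ S → z ∈ Z → z ≡ x ⊎ z ≡ y)
  heavy-pick {x} {y} (x≢y , big) Z Z≤ with anySubset? (λ S → G? S ×-dec (x ∈? S ×-dec (y ∈? S ×-dec all? λ z → z ∈? S →-dec (z ∈? Z →-dec (z ≟ᶠ x ⊎-dec z ≟ᶠ y)))))
  ... | yes p = p
  ... | no ¬p = contradiction big (≤⇒≯ (begin
    codeg x y  ≤⟨ #-⋃ (sets n) (fins n) (λ S → x ∈? S ×-dec (y ∈? S ×-dec G? S)) bad? covered ⟩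
    ∑ (fins n) (λ z → # (sets n) (bad? z)) ≤⟨ ∑-mono (fins n) each ⟩
    ∑ (fins n) (λ z → 𝟙 (z ∈? Z) * P)  ≡⟨ trans (∑-*ʳ (fins n) P (λ z → 𝟙 (z ∈? Z))) (cong (_* P) (sym (∣∣-# Z))) ⟩
    ∣ Z ∣ * P  ≤⟨ *-monoˡ-≤ P Z≤ ⟩
    Cap * P  ∎))
    where
    open ≤-Reasoning
    P = n ^ (1 + r′)
    Bad : Fin n → Subset n → Set
    Bad z S = (z ∈ Z × x ≢ z × y ≢ z) × (x ∈ S × (∣ S ∣ ≡ r × (y ∈ S × z ∈ S)))
    bad? : ∀ z S → Dec (Bad z S)
    bad? z S = (z ∈? Z ×-dec (¬? (x ≟ᶠ z) ×-dec ¬? (y ≟ᶠ z))) ×-dec (x ∈? S ×-dec (has? r S ×-dec (y ∈? S ×-dec z ∈? S)))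
    each : ∀ z → # (sets n) (bad? z) ≤ 𝟙 (z ∈? Z) * P
    each z with z ∈? Z ×-dec (¬? (x ≟ᶠ z) ×-dec ¬? (y ≟ᶠ z))
    ... | no ¬q = ≤-trans (≤-reflexive (trans (∑-cong (sets n) λ S → 𝟙-no (no ¬q ×-dec (x ∈? S ×-dec (has? r S ×-dec (y ∈? S ×-dec z ∈? S)))) (¬q ∘ proj₁)) (∑-zero (sets n)))) z≤n
    ... | yes (z∈ , x≢z , y≢z) = ≤-trans (#-mono (sets n) (λ S → yes (z∈ , x≢z , y≢z) ×-dec (x ∈? S ×-dec (has? r S ×-dec (y ∈? S ×-dec z ∈? S)))) (λ S → x ∈? S ×-dec (has? r S ×-dec (y ∈? S ×-dec z ∈? S))) (λ _ → proj₂))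
        (≤-trans (#-∋∋∋ (1 + r′) x≢y x≢z y≢z) (≤-reflexive (trans (sym (*-identityˡ P)) (cong (_* P) (sym (𝟙-yes (z ∈? Z) z∈))))))
    covered : ∀ S → x ∈ S × y ∈ S × G S → ∃ λ z → z ∈ˡ fins n × Bad z S
    covered S (x∈ , y∈ , g) with any? (λ z → z ∈? S ×-dec (z ∈? Z ×-dec (¬? (x ≟ᶠ z) ×-dec ¬? (y ≟ᶠ z))))
    ... | yes (z , z∈S , z∈Z , x≢z , y≢z) = z , ∈-fins z , (z∈Z , x≢z , y≢z) , x∈ , G-size g , y∈ , z∈S
    ... | no none = contradiction (S , g , x∈ , y∈ , only) ¬p
      where
      only : ∀ z → z ∈ S → z ∈ Z → z ≡ x ⊎ z ≡ y
      only z p q with x ≟ᶠ z | y ≟ᶠ z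
      ... | yes e | _     = inj₁ (sym e)
      ... | no _  | yes e = inj₂ (sym e)
      ... | no a  | no b  = contradiction (z , p , q , a , b) none

  -- The member of `G` with the colour of `S`, or `∅` if there is none. A member of `G` that avoids
  -- it up to two points cannot have the colour of `S`.
  rep : Subset n → Subset n
  rep S with anySubset? (λ R → G? R ×-dec (χ R ≟ χ S))
  ... | yes (R , _) = R
  ... | no _        = ∅

  rep-≡ : ∀ S {R} → G R → χ R ≡ χ S → R ≡ rep S
  rep-≡ S {R} g e with anySubset? (λ R → G? R ×-dec (χ R ≟ χ S))
  ... | yes (R′ , g′ , e′) = G-inj g g′ (trans e (sym e′))
  ... | no ¬p = contradiction (R , g , e) ¬p

  ∣rep∣≤ : ∀ S → ∣ rep S ∣ ≤ r
  ∣rep∣≤ S with anySubset? (λ R → G? R ×-dec (χ R ≟ χ S))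
  ... | yes (R , g , _) = ≤-reflexive (G-size g)
  ... | no _ = ∣∅∣≤ {n} r

  module _ (K : ℕ) (adj : Fin K → Fin K → Bool) (cap : K + 4 * r + K * K * r ≤ Cap) where

    open RainbowSystems r K adj

    -- The heavy edges receive sets of `G` greedily. These avoid the core, `S₁`, `S₂` and the
    -- representatives of both colours, so that their colours differ from each other and from those
    -- of `S₁` and `S₂`. In `cap`, `K` pays for the core, `4 * r` for the four sets and `K * K * r`
    -- for the sets chosen.
    embed : (core : Fin K → Fin n) → (∀ i j → core i ≡ core j → i ≡ j) →
      (u₁ w₁ u₂ w₂ : Fin K) (S₁ S₂ : Subset n) →
      (∀ x y → Edge K adj x y → Heavy (core x) (core y) ⊎ (Same u₁ w₁ x y ⊎ Same u₂ w₂ x y)) →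
      Exact core u₁ w₁ S₁ → Exact core u₂ w₂ S₂ →
      Compatible χ core S₁ S₂ → RainbowSystem χ
    embed core inj u₁ w₁ u₂ w₂ S₁ S₂ kinds ex₁ ex₂ (meet , χ≢) = place (greedy (K * K) r Cap (λ e → Q′ (dec₂ e)) (λ e → X (dec₂ e)) Z₀
        (≤-trans (+-monoˡ-≤ (K * K * r) ∣Z₀∣≤) cap) (λ e → pick (dec₂ e)))
      where
      image? = λ x → any? (λ k → core k ≟ᶠ x)
      Im = fromDec image?
      ∣Im∣≤ : ∣ Im ∣ ≤ K
      ∣Im∣≤ = ≤-trans (≤-reflexive (∣fromDec∣ image?)) (≤-trans (#-⋃ (fins n) (fins K) image? (λ k x → x ≟ᶠ core k) (λ x (k , e) → k , ∈-fins k , sym e))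
        (≤-reflexive (trans (∑-cong (fins K) λ k → #-≡ (core k)) (trans (∑-fins-const K 1) (*-identityʳ K)))))
      Z₀ = Im ∪ (S₁ ∪ (S₂ ∪ (rep S₁ ∪ rep S₂)))
      ∣Z₀∣≤ : ∣ Z₀ ∣ ≤ K + 4 * r
      ∣Z₀∣≤ = ≤-trans (∣∪∣≤ Im _) (+-mono-≤ ∣Im∣≤ (≤-trans (∣∪∣≤ S₁ _) (+-mono-≤ (≤-reflexive (proj₁ ex₁))
        (≤-trans (∣∪∣≤ S₂ _) (+-mono-≤ (≤-reflexive (proj₁ ex₂)) (≤-trans (∣∪∣≤ (rep S₁) (rep S₂)) (+-mono-≤ (∣rep∣≤ S₁) (≤-trans (∣rep∣≤ S₂) (≤-reflexive (sym (+-identityʳ r)))))))))))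
      X : Fin K × Fin K → Fin n → Set
      X (x , y) z = z ≡ core x ⊎ z ≡ core y
      dec₂ = remQuot {K} K
      -- The greedy choice runs over all ordered pairs, so the requirement is conditional and light
      -- pairs receive `∅`.
      Q′ : Fin K × Fin K → Subset n → Set
      Q′ (x , y) S = Heavy (core x) (core y) → G S × core x ∈ S × core y ∈ S
      pick : ∀ e Z → ∣ Z ∣ ≤ Cap → ∃ λ S → Q′ e S × ∣ S ∣ ≤ r × (∀ z → z ∈ S → z ∈ Z → X e z)
      pick (x , y) Z Z≤ = choose (heavy? (core x) (core y))
        where
        chosen : (∃ λ S → G S × core x ∈ S × core y ∈ S × (∀ z → z ∈ S → z ∈ Z → z ≡ core x ⊎ z ≡ core y)) →
          ∃ λ S → Q′ (x , y) S × ∣ S ∣ ≤ r × (∀ z → z ∈ S → z ∈ Z → X (x , y) z)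
        chosen (S , g , x∈ , y∈ , av) = S , (λ _ → g , x∈ , y∈) , ≤-reflexive (G-size g) , av
        choose : Dec (Heavy (core x) (core y)) → ∃ λ S → Q′ (x , y) S × ∣ S ∣ ≤ r × (∀ z → z ∈ S → z ∈ Z → X (x , y) z)
        choose (no ¬h) = ∅ , (λ h → contradiction h ¬h) , ∣∅∣≤ {n} r , λ z p → contradiction p ∉⊥
        choose (yes h) = chosen (heavy-pick h Z Z≤)
      in₁ : ∀ {z} → z ∈ S₁ → z ∈ Z₀
      in₁ p = x∈p∪q⁺ (inj₂ (x∈p∪q⁺ (inj₁ p)))
      in₂ : ∀ {z} → z ∈ S₂ → z ∈ Z₀
      in₂ p = x∈p∪q⁺ (inj₂ (x∈p∪q⁺ (inj₂ (x∈p∪q⁺ (inj₁ p)))))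
      inR₁ : ∀ {z} → z ∈ rep S₁ → z ∈ Z₀
      inR₁ p = x∈p∪q⁺ (inj₂ (x∈p∪q⁺ (inj₂ (x∈p∪q⁺ (inj₂ (x∈p∪q⁺ (inj₁ p)))))))
      inR₂ : ∀ {z} → z ∈ rep S₂ → z ∈ Z₀
      inR₂ p = x∈p∪q⁺ (inj₂ (x∈p∪q⁺ (inj₂ (x∈p∪q⁺ (inj₂ (x∈p∪q⁺ (inj₂ p)))))))
      inIm : ∀ k → core k ∈ Z₀
      inIm k = x∈p∪q⁺ (inj₁ (∈-fromDec⁺ image? (k , refl)))
      place : (∃ λ (g : Fin (K * K) → Subset n) → (∀ e → Q′ (dec₂ e) (g e)) × (∀ e z → z ∈ g e → z ∈ Z₀ → X (dec₂ e) z) ×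
        (∀ e e′ → e ≢ e′ → (∀ z → z ∈ g e → z ∈ g e′ → X (dec₂ e) z) ⊎ (∀ z → z ∈ g e → z ∈ g e′ → X (dec₂ e′) z))) → RainbowSystem χ
      place (g , g-G , g-Z , g-sep) = toSystem {χ = χ} core ext (inj , exact , comp)
        where
        f : Fin K → Fin K → Subset n
        f x y = g (combine x y)
        rq : ∀ x y → dec₂ (combine x y) ≡ (x , y)
        rq = remQuot-combine
        f-G : ∀ x y → Q′ (x , y) (f x y)
        f-G x y = subst (λ p → Q′ p (f x y)) (rq x y) (g-G (combine x y))
        f-Z : ∀ x y z → z ∈ f x y → z ∈ Z₀ → X (x , y) z
        f-Z x y = subst (λ p → ∀ z → z ∈ f x y → z ∈ Z₀ → X p z) (rq x y) (g-Z (combine x y))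
        f-sep : ∀ x y x′ y′ → ¬ (x ≡ x′ × y ≡ y′) → (∀ z → z ∈ f x y → z ∈ f x′ y′ → X (x , y) z) ⊎ (∀ z → z ∈ f x y → z ∈ f x′ y′ → X (x′ , y′) z)
        f-sep x y x′ y′ ne = subst₂ (λ p q → (∀ z → z ∈ f x y → z ∈ f x′ y′ → X p z) ⊎ (∀ z → z ∈ f x y → z ∈ f x′ y′ → X q z))
          (rq x y) (rq x′ y′) (g-sep (combine x y) (combine x′ y′) (ne ∘ combine-injective x y x′ y′))
        ext : Fin K → Fin K → Subset n
        ext x y with same? u₁ w₁ x y | same? u₂ w₂ x y
        ... | yes _ | _     = S₁
        ... | no _  | yes _ = S₂
        ... | no _  | no _  = f x y
        data Kind (x y : Fin K) : Subset n → Set where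
          first  : Same u₁ w₁ x y → Kind x y S₁
          second : Same u₂ w₂ x y → Kind x y S₂
          other  : G (f x y) → core x ∈ f x y → core y ∈ f x y → Kind x y (f x y)
        kind : ∀ x y → Edge K adj x y → Kind x y (ext x y)
        kind x y ed with same? u₁ w₁ x y | same? u₂ w₂ x y
        ... | yes p | _     = first p
        ... | no _  | yes p = second p
        ... | no ¬p | no ¬q with kinds x y ed
        ...   | inj₁ h = let g , a , b = f-G x y h in other g a b
        ...   | inj₂ (inj₁ p) = contradiction p ¬p
        ...   | inj₂ (inj₂ q) = contradiction q ¬q
        core-X : ∀ x y z → X (x , y) z → ∃ λ k → core k ≡ z
        core-X x y z (inj₁ e) = x , sym e
        core-X x y z (inj₂ e) = y , sym e
        Exact-same : ∀ {u w S x y} → Same u w x y → Exact core u w S → Exact core x y S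
        Exact-same (inj₁ (refl , refl)) e = e
        Exact-same (inj₂ (refl , refl)) (h , a , b , o) = h , b , a , λ k p → [ inj₂ , inj₁ ]′ (o k p)
        exact : ∀ x y → Edge K adj x y → Exact core x y (ext x y)
        exact x y ed = exact-kind (kind x y ed)
          where
          exact-kind : ∀ {S} → Kind x y S → Exact core x y S
          exact-kind (first p)  = Exact-same p ex₁
          exact-kind (second p) = Exact-same p ex₂
          exact-kind (other g a b) = G-size g , a , b , λ k p → [ (λ e → inj₁ (inj _ _ e)) , (λ e → inj₂ (inj _ _ e)) ]′ (f-Z x y (core k) p (inIm k))
        ed⇒< : ∀ x y → Edge K adj x y → toℕ x < toℕ y
        ed⇒< x y ed = <ᵇ⇒< (toℕ x) (toℕ y) (proj₁ (∧⁻ {toℕ x <ᵇ toℕ y} ed))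
        same-unique : ∀ {u w} x y x′ y′ → Edge K adj x y → Edge K adj x′ y′ → Same u w x y → Same u w x′ y′ → x ≡ x′ × y ≡ y′
        same-unique x y x′ y′ ed ed′ (inj₁ (refl , refl)) (inj₁ (refl , refl)) = refl , refl
        same-unique x y x′ y′ ed ed′ (inj₂ (refl , refl)) (inj₂ (refl , refl)) = refl , refl
        same-unique x y x′ y′ ed ed′ (inj₁ (refl , refl)) (inj₂ (refl , refl)) = contradiction (ed⇒< x y ed) (<-asym (ed⇒< y x ed′))
        same-unique x y x′ y′ ed ed′ (inj₂ (refl , refl)) (inj₁ (refl , refl)) = contradiction (ed⇒< x y ed) (<-asym (ed⇒< y x ed′))
        new-colour : ∀ x y S → G (f x y) → (∀ {z} → z ∈ rep S → z ∈ Z₀) → χ (f x y) ≢ χ S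
        new-colour x y S g inR e = pair-small (f x y) (G-size g) λ z z∈ → f-Z x y z z∈ (inR (subst (z ∈_) (rep-≡ S g e) z∈))
        swap : ∀ {S S′} → Compatible χ core S S′ → Compatible χ core S′ S
        swap (m , c) = (λ x p q → m x q p) , c ∘ sym
        comp : ∀ x y x′ y′ → Edge K adj x y → Edge K adj x′ y′ → ¬ (x ≡ x′ × y ≡ y′) → Compatible χ core (ext x y) (ext x′ y′)
        comp x y x′ y′ ed ed′ ne = comp-kind (kind x y ed) (kind x′ y′ ed′)
          where
          both : ∀ {p} → G (f x y) → G (f x′ y′) → (∀ z → z ∈ f x y → z ∈ f x′ y′ → X p z) → Compatible χ core (f x y) (f x′ y′)
          both {a , b} g g′ s = (λ z p q → core-X a b z (s z p q)) , λ e → pair-small (f x y) (G-size g) λ z z∈ → s z z∈ (subst (z ∈_) (G-inj g g′ e) z∈)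
          comp-kind : ∀ {S S′} → Kind x y S → Kind x′ y′ S′ → Compatible χ core S S′
          comp-kind (first p)  (first q)  = contradiction (same-unique x y x′ y′ ed ed′ p q) ne
          comp-kind (second p) (second q) = contradiction (same-unique x y x′ y′ ed ed′ p q) ne
          comp-kind (first _)  (second _) = meet , χ≢
          comp-kind (second _) (first _)  = swap (meet , χ≢)
          comp-kind (other g _ _) (first _)  = (λ z p q → core-X x y z (f-Z x y z p (in₁ q))) , new-colour x y S₁ g inR₁
          comp-kind (other g _ _) (second _) = (λ z p q → core-X x y z (f-Z x y z p (in₂ q))) , new-colour x y S₂ g inR₂
          comp-kind (first _)  (other g _ _) = swap ((λ z p q → core-X x′ y′ z (f-Z x′ y′ z p (in₁ q))) , new-colour x′ y′ S₁ g inR₁)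
          comp-kind (second _) (other g _ _) = swap ((λ z p q → core-X x′ y′ z (f-Z x′ y′ z p (in₂ q))) , new-colour x′ y′ S₂ g inR₂)
          comp-kind (other g _ _) (other g′ _ _) = [ both g g′ , both g g′ ]′ (f-sep x y x′ y′ ne)

-- Counting up to few exceptions, and estimates for powers.

Most : ∀ {A : Set} (xs : List A) {P : A → Set} → Decidable P → ℕ → Set
Most xs P? k = length xs ≤ # xs P? + k

Most-× : ∀ {A : Set} (xs : List A) {P Q : A → Set} (P? : Decidable P) (Q? : Decidable Q) {a b} →
  Most xs P? a → Most xs Q? b → Most xs (λ x → P? x ×-dec Q? x) (a + b)
Most-× xs {P} {Q} P? Q? {a} {b} mp mq = begin
  length xs  ≤⟨ mp ⟩
  # xs P? + a  ≤⟨ +-monoˡ-≤ a (#-⊎ xs P? PQ? (¬? ∘ Q?) split) ⟩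
  # xs PQ? + # xs (¬? ∘ Q?) + a  ≤⟨ +-monoˡ-≤ a (+-monoʳ-≤ (# xs PQ?) (+-cancelˡ-≤ (# xs Q?) _ _ (≤-trans (≤-reflexive (sym (#-¬ xs Q?))) mq))) ⟩
  # xs PQ? + b + a  ≡⟨ trans (+-assoc (# xs PQ?) b a) (cong (# xs PQ? +_) (+-comm b a)) ⟩
  # xs PQ? + (a + b)  ∎
  where
  open ≤-Reasoning
  PQ? = λ x → P? x ×-dec Q? x
  split : ∀ x → P x → (P x × Q x) ⊎ ¬ Q x
  split x p with Q? x
  ... | yes q = inj₁ (p , q)
  ... | no ¬q = inj₂ ¬q

Most-¬ : ∀ {A : Set} (xs : List A) {P Q : A → Set} (P? : Decidable P) (Q? : Decidable Q) {k} →
  (∀ x → ¬ P x → Q x) → # xs Q? ≤ k → Most xs P? k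
Most-¬ xs P? Q? f q≤ = ≤-trans (≤-reflexive (#-¬ xs P?)) (+-monoʳ-≤ (# xs P?) (≤-trans (#-mono xs (¬? ∘ P?) Q? f) q≤))

#-split : ∀ {A : Set} (xs : List A) {P Q : A → Set} (P? : Decidable P) (Q? : Decidable Q) →
  # xs P? ≡ # xs (λ x → P? x ×-dec Q? x) + # xs (λ x → P? x ×-dec ¬? (Q? x))
#-split xs P? Q? = trans (∑-cong xs λ x → one (P? x) (Q? x)) (∑-+ xs _ _)
  where
  one : ∀ {P Q : Set} (p : Dec P) (q : Dec Q) → 𝟙 p ≡ 𝟙 (p ×-dec q) + 𝟙 (p ×-dec ¬? q)
  one (yes _) (yes _) = refl
  one (yes _) (no _)  = refl
  one (no _)  _       = refl

#-lost : ∀ {A : Set} (xs : List A) {P Q R : A → Set} (P? : Decidable P) (Q? : Decidable Q) (R? : Decidable R) →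
  (∀ x → P x → ¬ Q x → R x) → # xs P? ≤ # xs (λ x → P? x ×-dec Q? x) + # xs R?
#-lost xs P? Q? R? f = ≤-trans (≤-reflexive (#-split xs P? Q?)) (+-monoʳ-≤ _ (#-mono xs (λ x → P? x ×-dec ¬? (Q? x)) R? λ x (p , ¬q) → f x p ¬q))

^-superadditive : ∀ p z k → p ^ suc k + z ^ suc k ≤ (p + z) ^ suc k
^-superadditive p z zero    = ≤-reflexive (trans (cong₂ _+_ (*-identityʳ p) (*-identityʳ z)) (sym (*-identityʳ (p + z))))
^-superadditive p z (suc k) = begin
  p * p ^ suc k + z * z ^ suc k  ≤⟨ +-mono-≤ (*-monoʳ-≤ p (m≤m+n (p ^ suc k) (z ^ suc k))) (*-monoʳ-≤ z (m≤n+m (z ^ suc k) (p ^ suc k))) ⟩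
  p * (p ^ suc k + z ^ suc k) + z * (p ^ suc k + z ^ suc k)  ≡⟨ sym (*-distribʳ-+ (p ^ suc k + z ^ suc k) p z) ⟩
  (p + z) * (p ^ suc k + z ^ suc k)  ≤⟨ *-monoʳ-≤ (p + z) (^-superadditive p z k) ⟩
  (p + z) * (p + z) ^ suc k  ∎
  where open ≤-Reasoning

*-^ : ∀ k a b → (a * b) ^ k ≡ a ^ k * b ^ k
*-^ zero    a b = refl
*-^ (suc k) a b = trans (cong (a * b *_) (*-^ k a b)) (lemma a b (a ^ k) (b ^ k))
  where
  lemma : ∀ a b x y → a * b * (x * y) ≡ a * x * (b * y)
  lemma = solve-∀

n≤J*⌈n/J⌉ : ∀ n J → n ≤ suc J * suc (n / suc J)
n≤J*⌈n/J⌉ n J = begin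
  n  ≡⟨ m≡m%n+[m/n]*n n (suc J) ⟩
  n % suc J + n / suc J * suc J  ≤⟨ +-monoˡ-≤ _ (<⇒≤ (m%n<n n (suc J))) ⟩
  suc J + n / suc J * suc J  ≡⟨ lemma (suc J) (n / suc J) ⟩
  suc J * suc (n / suc J)  ∎
  where
  open ≤-Reasoning
  lemma : ∀ J d → J + d * J ≡ J * suc d
  lemma = solve-∀

-- The mean value bound for powers; it compares `n ^ r` with the power of the last multiple of `ℓ`
-- up to `n`.
^-shift : ∀ a b k → (a + b) ^ suc k ≤ a ^ suc k + suc k * b * (a + b) ^ k
^-shift a b zero    = ≤-reflexive (lemma a b)
  where
  lemma : ∀ a b → (a + b) * 1 ≡ a * 1 + 1 * b * 1
  lemma = solve-∀
^-shift a b (suc k) = begin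
  (a + b) * (a + b) ^ suc k  ≡⟨ *-distribʳ-+ ((a + b) ^ suc k) a b ⟩
  a * (a + b) ^ suc k + b * (a + b) ^ suc k  ≤⟨ +-monoˡ-≤ _ (*-monoʳ-≤ a (^-shift a b k)) ⟩
  a * (a ^ suc k + suc k * b * (a + b) ^ k) + b * (a + b) ^ suc k  ≡⟨ l₁ a (a ^ suc k) (suc k) b ((a + b) ^ k) ((a + b) ^ suc k) ⟩
  a ^ suc (suc k) + (suc k * b * (a * (a + b) ^ k) + b * (a + b) ^ suc k)  ≤⟨ +-monoʳ-≤ (a ^ suc (suc k)) (+-monoˡ-≤ _ (*-monoʳ-≤ (suc k * b) (*-monoˡ-≤ ((a + b) ^ k) (m≤m+n a b)))) ⟩
  a ^ suc (suc k) + (suc k * b * (a + b) ^ suc k + b * (a + b) ^ suc k)  ≡⟨ cong (a ^ suc (suc k) +_) (l₂ (suc k) b ((a + b) ^ suc k)) ⟩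
  a ^ suc (suc k) + suc (suc k) * b * (a + b) ^ suc k  ∎
  where
  open ≤-Reasoning
  l₁ : ∀ a x k b y z → a * (x + k * b * y) + b * z ≡ a * x + (k * b * (a * y) + b * z)
  l₁ = solve-∀
  l₂ : ∀ k b z → k * b * z + b * z ≡ suc k * b * z
  l₂ = solve-∀

∈-toSet : ∀ {n s} (w : Vec (Fin n) s) i → Vec.lookup w i ∈ toSet w
∈-toSet (x ∷ w) zero    = v∈add x (toSet w)
∈-toSet (x ∷ w) (suc i) = ⊆add x (toSet w) (∈-toSet w i)

-- Almost all edges of G are cliques of heavy pairs.

module ManyCliques {n : ℕ} (r′ Cap : ℕ) (χ : Subset n → ℕ) (G : Subset n → Set) (G? : Decidable G)
  (G-size : ∀ {S} → G S → ∣ S ∣ ≡ 4 + r′) (G-inj : ∀ {S S′} → G S → G S′ → χ S ≡ χ S′ → S ≡ S′) where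

  open Representatives r′ Cap χ G G? G-size G-inj
  open Cliques Heavy heavy? Heavy-sym using (h; Clique; clique?)

  AllHeavy : Subset n → Set
  AllHeavy S = ∀ x y → x ∈ S → y ∈ S → x ≢ y → Heavy x y

  allHeavy? : Decidable AllHeavy
  allHeavy? S = all? λ x → all? λ y → x ∈? S →-dec (y ∈? S →-dec (¬? (x ≟ᶠ y) →-dec heavy? x y))

  lightPair? : ∀ x y S → Dec ((x ≢ y × ¬ Heavy x y) × (x ∈ S × (y ∈ S × G S)))
  lightPair? x y S = (¬? (x ≟ᶠ y) ×-dec ¬? (heavy? x y)) ×-dec (x ∈? S ×-dec (y ∈? S ×-dec G? S))

  -- Every other edge contains a light pair; there are at most `n * n` of these, each in at most
  -- `Cap * n ^ (r ∸ 3)` edges.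
  G≤ : # (sets n) G? ≤ # (sets n) (λ S → has? r S ×-dec (G? S ×-dec allHeavy? S)) + Cap * n ^ (3 + r′)
  G≤ = begin
    # (sets n) G?  ≤⟨ #-⊎ (sets n) G? A? (λ S → any? λ x → any? λ y → lightPair? x y S) cover ⟩
    # (sets n) A? + # (sets n) (λ S → any? λ x → any? λ y → lightPair? x y S) ≤⟨ +-monoʳ-≤ (# (sets n) A?) light ⟩
    # (sets n) A? + Cap * n ^ (3 + r′)  ∎
    where
    open ≤-Reasoning
    A? = λ S → has? r S ×-dec (G? S ×-dec allHeavy? S)
    cover : ∀ S → G S → (∣ S ∣ ≡ r × G S × AllHeavy S) ⊎ (∃ λ x → ∃ λ y → (x ≢ y × ¬ Heavy x y) × (x ∈ S × (y ∈ S × G S)))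
    cover S g = split (any? λ x → any? λ y → lightPair? x y S)
      where
      split : Dec (∃ λ x → ∃ λ y → (x ≢ y × ¬ Heavy x y) × (x ∈ S × (y ∈ S × G S))) → _
      split (yes p) = inj₂ p
      split (no ¬p) = inj₁ (G-size g , g , λ x y x∈ y∈ x≢y → decidable-stable (heavy? x y) λ ¬h → ¬p (x , y , (x≢y , ¬h) , x∈ , y∈ , g))
    each : ∀ x y → Dec (x ≢ y × ¬ Heavy x y) → # (sets n) (lightPair? x y) ≤ Cap * n ^ (1 + r′)
    each x y (no ¬p) = ≤-trans (≤-reflexive (trans (∑-cong (sets n) λ S → 𝟙-no (lightPair? x y S) (¬p ∘ proj₁)) (∑-zero (sets n)))) z≤n
    each x y (yes (x≢y , ¬h)) = ≤-trans (#-mono (sets n) (lightPair? x y) (λ S → x ∈? S ×-dec (y ∈? S ×-dec G? S)) (λ S → proj₂)) (≮⇒≥ λ lt → ¬h (x≢y , lt))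
    l₀ : ∀ n C x → n * (n * (C * x)) ≡ C * (n * (n * x))
    l₀ = solve-∀
    light : # (sets n) (λ S → any? λ x → any? λ y → lightPair? x y S) ≤ Cap * n ^ (3 + r′)
    light = begin
      # (sets n) (λ S → any? λ x → any? λ y → lightPair? x y S)
        ≤⟨ #-⋃ (sets n) (fins n) (λ S → any? λ x → any? λ y → lightPair? x y S) (λ x S → any? λ y → lightPair? x y S) (λ S (x , p) → x , ∈-fins x , p) ⟩
      ∑ (fins n) (λ x → # (sets n) (λ S → any? λ y → lightPair? x y S))
        ≤⟨ ∑-mono (fins n) (λ x → #-⋃ (sets n) (fins n) (λ S → any? λ y → lightPair? x y S) (lightPair? x) (λ S (y , p) → y , ∈-fins y , p)) ⟩
      ∑ (fins n) (λ x → ∑ (fins n) (λ y → # (sets n) (lightPair? x y)))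
        ≤⟨ ∑-mono (fins n) (λ x → ∑-mono (fins n) λ y → each x y (¬? (x ≟ᶠ y) ×-dec ¬? (heavy? x y))) ⟩
      ∑ (fins n) (λ x → ∑ (fins n) (λ y → Cap * n ^ (1 + r′)))
        ≡⟨ trans (∑-cong (fins n) λ x → ∑-fins-const n (Cap * n ^ (1 + r′))) (∑-fins-const n _) ⟩
      n * (n * (Cap * n ^ (1 + r′)))
        ≡⟨ l₀ n Cap (n ^ (1 + r′)) ⟩
      Cap * n ^ (3 + r′) ∎

  heavy⇒clique : ∀ {s} (w : Vec (Fin n) s) → Distinct w → AllHeavy (toSet w) → Clique w
  heavy⇒clique []      _       _  = tt
  heavy⇒clique (x ∷ w) (x∉ ∷ d) ah =
    (λ j → ah x _ (v∈add x (toSet w)) (⊆add x (toSet w) (∈-toSet w j)) λ e → x∉ (subst (_∈ toSet w) (sym e) (∈-toSet w j))) ,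
    heavy⇒clique w d λ y z y∈ z∈ → ah y z (⊆add x (toSet w) y∈) (⊆add x (toSet w) z∈)

  r!G≤h : (r !) * # (sets n) G? ≤ h r + (r !) * Cap * n ^ (3 + r′)
  r!G≤h = begin
    (r !) * # (sets n) G?  ≤⟨ *-monoʳ-≤ (r !) G≤ ⟩
    (r !) * (# (sets n) A? + Cap * n ^ (3 + r′))  ≡⟨ l₀ (r !) (# (sets n) A?) Cap (n ^ (3 + r′)) ⟩
    (r !) * # (sets n) A? + (r !) * Cap * n ^ (3 + r′)  ≤⟨ +-monoˡ-≤ _ (≤-trans (orderings r (λ S → G? S ×-dec allHeavy? S))
      (#-mono (vecs n r) (λ w → distinct? w ×-dec (G? (toSet w) ×-dec allHeavy? (toSet w))) clique? λ w (d , _ , ah) → heavy⇒clique w d ah)) ⟩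
    h r + (r !) * Cap * n ^ (3 + r′)  ∎
    where
    open ≤-Reasoning
    A? = λ S → has? r S ×-dec (G? S ×-dec allHeavy? S)
    l₀ : ∀ f x C y → f * (x + C * y) ≡ f * x + f * C * y
    l₀ = solve-∀

  -- The Turán number is at least `σ r` at `q = n / ℓ`, and `r !` times this is `fall ℓ r * q ^ r`.
  -- Replacing `n` by `ℓ * q` and `G` by its heavy cliques costs multiples of `n ^ (r ∸ 1)`, which
  -- for large `n` stay below `n ^ r`.
  many-cliques : ∀ ℓ′ Q → let ℓ = suc ℓ′ in turan r n ℓ ≤ # (sets n) G? →
    ℓ ^ r * Q * (r !) * Cap + fall ℓ r * Q * r * ℓ < n → fall ℓ r * Q * n ^ r < ℓ ^ r * Q * h r + n ^ r
  many-cliques ℓ′ Q enough large = begin-strict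
    fall ℓ r * Q * n ^ r  ≤⟨ *-monoʳ-≤ (fall ℓ r * Q) nʳ ⟩
    fall ℓ r * Q * ((ℓ * q) ^ r + r * ℓ * N)  ≡⟨ cong (λ z → fall ℓ r * Q * (z + r * ℓ * N)) (*-^ r ℓ q) ⟩
    fall ℓ r * Q * (ℓ ^ r * q ^ r + r * ℓ * N)  ≡⟨ l₀ (fall ℓ r) Q (ℓ ^ r) (q ^ r) r ℓ N ⟩
    ℓ ^ r * Q * (fall ℓ r * q ^ r) + fall ℓ r * Q * r * ℓ * N  ≤⟨ +-monoˡ-≤ _ (*-monoʳ-≤ (ℓ ^ r * Q) cliques) ⟩
    ℓ ^ r * Q * (h r + (r !) * Cap * N) + fall ℓ r * Q * r * ℓ * N  ≡⟨ l₁ (ℓ ^ r * Q) (h r) (r !) Cap N (fall ℓ r * Q * r * ℓ) ⟩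
    ℓ ^ r * Q * h r + (ℓ ^ r * Q * (r !) * Cap + fall ℓ r * Q * r * ℓ) * N  <⟨ +-monoʳ-< (ℓ ^ r * Q * h r) (*-monoˡ-< N {{>-nonZero (m^n>0 n {{>-nonZero 0<n}} (3 + r′))}} large) ⟩
    ℓ ^ r * Q * h r + n ^ r  ∎
    where
    open ≤-Reasoning
    ℓ = suc ℓ′
    q = n / ℓ
    N = n ^ (3 + r′)
    0<n : 0 < n
    0<n = ≤-trans (s≤s z≤n) large
    n≡ : ℓ * q + n % ℓ ≡ n
    n≡ = trans (+-comm (ℓ * q) _) (trans (cong (n % ℓ +_) (*-comm ℓ q)) (sym (m≡m%n+[m/n]*n n ℓ)))
    nʳ : n ^ r ≤ (ℓ * q) ^ r + r * ℓ * N
    nʳ = ≤-trans (subst (λ m → m ^ r ≤ (ℓ * q) ^ r + r * (n % ℓ) * m ^ (3 + r′)) n≡ (^-shift (ℓ * q) (n % ℓ) (3 + r′)))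
      (+-monoʳ-≤ ((ℓ * q) ^ r) (*-monoˡ-≤ N (*-monoʳ-≤ r (<⇒≤ (m%n<n n ℓ)))))
    cliques : fall ℓ r * q ^ r ≤ h r + (r !) * Cap * N
    cliques = ≤-trans (≤-reflexive (sym (σ-const ℓ r q))) (≤-trans (*-monoʳ-≤ (r !) (≤-trans (Turán.turan-≥ ℓ′ r n) enough)) r!G≤h)
    l₀ : ∀ f Q x y r l N → f * Q * (x * y + r * l * N) ≡ x * Q * (f * y) + f * Q * r * l * N
    l₀ = solve-∀
    l₁ : ∀ x h f C N y → x * (h + f * C * N) + y * N ≡ x * h + (x * f * C + y) * N
    l₁ = solve-∀

-- Some transversal passes through the two given vertices of different blocks.
clique-blowup : ∀ {n} (Γ : Fin n → Fin n → Set) (Γ? : ∀ x y → Dec (Γ x y)) (Γ-sym : ∀ {x y} → Γ x y → Γ y x) {T k} (B : Fin k → Fin T → Fin n) →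
  (∀ f → Cliques.Clique Γ Γ? Γ-sym (sel B f)) → ∀ i j a b → i ≢ j → Γ (B i a) (B j b)
clique-blowup Γ Γ? Γ-sym {T} {k} B cl i j a b i≢j =
  subst₂ Γ (trans (lookup-sel B f i) (cong (B i) fi)) (trans (lookup-sel B f j) (cong (B j) fj)) (Cliques.Clique-lookup Γ Γ? Γ-sym (sel B f) (cl f) i j i≢j)
  where
  pick : ∀ {x} → Dec (x ≡ i) → Fin T
  pick (yes _) = a
  pick (no _)  = b
  f = Vec.tabulate (λ x → pick (x ≟ᶠ i))
  pick-yes : ∀ {x} (d : Dec (x ≡ i)) → x ≡ i → pick d ≡ a
  pick-yes (yes _) _ = refl
  pick-yes (no ¬p) p = contradiction p ¬p
  pick-no : ∀ {x} (d : Dec (x ≡ i)) → x ≢ i → pick d ≡ b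
  pick-no (yes p) ¬p = contradiction p ¬p
  pick-no (no _)  _  = refl
  fi : Vec.lookup f i ≡ a
  fi = trans (lookup∘tabulate (λ x → pick (x ≟ᶠ i)) i) (pick-yes (i ≟ᶠ i) refl)
  fj : Vec.lookup f j ≡ b
  fj = trans (lookup∘tabulate (λ x → pick (x ≟ᶠ i)) j) (pick-no (j ≟ᶠ i) (i≢j ∘ sym))

witness : ∀ {A : Set} {P : A → Set} → Dec (∃ P) → Maybe A
witness (yes (x , _)) = just x
witness (no _)        = nothing

witness-just : ∀ {A : Set} {P : A → Set} (d : Dec (∃ P)) {x} → witness d ≡ just x → P x
witness-just (yes (x , p)) refl = p

witness-nothing : ∀ {A : Set} {P : A → Set} (d : Dec (∃ P)) → witness d ≡ nothing → ¬ ∃ P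
witness-nothing (no ¬p) _ = ¬p

-- The hierarchy of constants.

<-of-quarter : ∀ {x n} → 0 < n → 4 * x ≤ 3 * n → x < n
<-of-quarter {x} {n} 0<n p = *-cancelˡ-< 4 x n (≤-<-trans p (≤-trans (+-monoˡ-≤ (3 * n) 0<n) (≤-reflexive (lemma n))))
  where
  lemma : ∀ n → n + 3 * n ≡ 4 * n
  lemma = solve-∀

-- `first`, `second` and `third` are the inequalities that the comparison of degrees requires, with
-- all error terms written out; `cθ`, `dθ`, `c₃`, `d₁`, `d₂` are the coefficients of these terms as
-- linear functions of `n / suc J₁` and `n / suc J₂`. `J₂` is chosen first, then `J₁`, then `Q`, and
-- `N` absorbs the constant terms.
module Constants (l P r Cap k J₁ J₂ Q : ℕ) where

  private
    L = suc l
    A₁ = suc J₁ ^ k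
    A₂ = suc J₂ ^ k

  cθ dθ c₃ d₁ d₂ : ℕ
  cθ = suc P + L * (suc P * (l * (L + L * 2)))
  dθ = L * suc P * l * L
  c₃ = l * (L + l * 2) + (4 * (l * (L + l * 2 + 2)) + 2 * r) + (P + L * (P * (l * (L + l * 2 + 2))))
  d₁ = l * l + 4 * (l * l) + L * P * l * L
  d₂ = 4 * l

  module _ (J₂-large : 8 * L * d₂ ≤ suc J₂) (J₁-large : 8 * L * d₁ + 4 * A₂ * dθ ≤ suc J₁) (Q-large : 8 * L * (8 * L + 4 * A₂ + 4 * A₁) ≤ Q) where

    N : ℕ
    N = 1 + 4 * A₁ * (Cap + 1) + 4 * A₂ * (Cap + 1 + cθ) + 8 * L * c₃ + 2 * L

    module _ (n q U : ℕ) (n≥ : N ≤ n) (n-hi : n ≤ L * q + L) (U≤ : Q * U ≤ 8 * L * n) where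

      private
        x₁ = n / suc J₁
        x₂ = n / suc J₂
        s₁ = x₁ + 2
        s₂ = x₂ + 2
        y₁ = l * (L + l * s₁ + s₁)
        y₂ = l * (L + l * s₁ + s₂)
        θ = suc P + L * (suc P * y₁)
        0<n : 0 < n
        0<n = ≤-trans (s≤s z≤n) n≥
        -- `U` is at most `8 * L * n / Q`, so the size of `Q` keeps every multiple of `U` that
        -- occurs below `n`.
        XU : (8 * L + 4 * A₂ + 4 * A₁) * U ≤ n
        XU = *-cancelˡ-≤ (8 * L) (≤-trans (≤-reflexive (sym (*-assoc (8 * L) (8 * L + 4 * A₂ + 4 * A₁) U))) (≤-trans (*-monoˡ-≤ U {8 * L * (8 * L + 4 * A₂ + 4 * A₁)} Q-large) U≤))
        A₁U : 4 * A₁ * U ≤ n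
        A₁U = ≤-trans (*-monoˡ-≤ U (m≤n+m (4 * A₁) (8 * L + 4 * A₂))) XU
        A₂U : 4 * A₂ * U ≤ n
        A₂U = ≤-trans (*-monoˡ-≤ U (≤-trans (m≤n+m (4 * A₂) (8 * L)) (m≤m+n _ (4 * A₁)))) XU
        LU : 8 * L * U ≤ n
        LU = ≤-trans (*-monoˡ-≤ U (≤-trans (m≤m+n (8 * L) (4 * A₂)) (m≤m+n _ (4 * A₁)))) XU
        x₁≤ : ∀ c → c ≤ suc J₁ → c * x₁ ≤ n
        x₁≤ c c≤ = ≤-trans (*-monoˡ-≤ x₁ c≤) (≤-trans (≤-reflexive (*-comm (suc J₁) x₁)) (m/n*n≤m n (suc J₁)))
        x₂≤ : ∀ c → c ≤ suc J₂ → c * x₂ ≤ n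
        x₂≤ c c≤ = ≤-trans (*-monoˡ-≤ x₂ c≤) (≤-trans (≤-reflexive (*-comm (suc J₂) x₂)) (m/n*n≤m n (suc J₂)))
        a₁ = 4 * A₁ * (Cap + 1)
        a₂ = 4 * A₂ * (Cap + 1 + cθ)
        a₃ = 8 * L * c₃
        n₁ : a₁ ≤ n
        n₁ = ≤-trans (≤-trans (n≤1+n a₁) (≤-trans (m≤m+n (suc a₁) a₂) (≤-trans (m≤m+n _ a₃) (m≤m+n _ (2 * L))))) n≥
        n₂ : a₂ ≤ n
        n₂ = ≤-trans (≤-trans (m≤n+m a₂ (1 + a₁)) (≤-trans (m≤m+n _ a₃) (m≤m+n _ (2 * L)))) n≥
        n₃ : a₃ ≤ n
        n₃ = ≤-trans (≤-trans (m≤n+m a₃ (1 + a₁ + a₂)) (m≤m+n _ (2 * L))) n≥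
        n₄ : 2 * L ≤ n
        n₄ = ≤-trans (m≤n+m (2 * L) (1 + a₁ + a₂ + a₃)) n≥

      first : A₁ * (Cap + 1 + U) < n
      first = <-of-quarter 0<n (begin
        4 * (A₁ * (Cap + 1 + U))  ≡⟨ e₁ A₁ (Cap + 1) U ⟩
        4 * A₁ * (Cap + 1) + 4 * A₁ * U  ≤⟨ +-mono-≤ n₁ (≤-trans A₁U (m≤m+n n _)) ⟩
        3 * n  ∎)
        where
        open ≤-Reasoning
        e₁ : ∀ A C U → 4 * (A * (C + U)) ≡ 4 * A * C + 4 * A * U
        e₁ = solve-∀

      second : A₂ * (Cap + 1 + U + θ) < n
      second = <-of-quarter 0<n (begin
        4 * (A₂ * (Cap + 1 + U + θ))  ≡⟨ cong (λ z → 4 * (A₂ * (Cap + 1 + U + z))) (e₀ P l x₁) ⟩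
        4 * (A₂ * (Cap + 1 + U + (cθ + dθ * x₁)))  ≡⟨ e₁ A₂ (Cap + 1) U cθ dθ x₁ ⟩
        4 * A₂ * (Cap + 1 + cθ) + (4 * A₂ * U + (4 * A₂ * dθ * x₁ + 0))  ≤⟨ +-mono-≤ n₂ (+-mono-≤ A₂U (+-monoˡ-≤ 0 (x₁≤ (4 * A₂ * dθ) (≤-trans (m≤n+m _ (8 * L * d₁)) J₁-large)))) ⟩
        3 * n  ∎)
        where
        open ≤-Reasoning
        e₀ : ∀ P l x → suc P + suc l * (suc P * (l * (suc l + l * (x + 2) + (x + 2)))) ≡
          suc P + suc l * (suc P * (l * (suc l + suc l * 2))) + suc l * suc P * l * suc l * x
        e₀ = solve-∀
        e₁ : ∀ A C U c d x → 4 * (A * (C + U + (c + d * x))) ≡ 4 * A * (C + c) + (4 * A * U + (4 * A * d * x + 0))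
        e₁ = solve-∀

      third : U + l * (L + l * s₁) + (4 * y₂ + 2 * r) + (P + L * (P * y₁)) ≤ q
      third = *-cancelˡ-≤ (8 * L) (+-cancelʳ-≤ (4 * n) _ _ (begin
        8 * L * (U + l * (L + l * s₁) + (4 * y₂ + 2 * r) + (P + L * (P * y₁))) + 4 * n  ≡⟨ cong (λ z → 8 * L * z + 4 * n) (e₀ U l x₁ x₂ r P) ⟩
        8 * L * (c₃ + U + d₁ * x₁ + d₂ * x₂) + 4 * n  ≡⟨ cong (_+ 4 * n) (e₁ L c₃ U d₁ x₁ d₂ x₂) ⟩
        8 * L * c₃ + (8 * L * U + (8 * L * d₁ * x₁ + (8 * L * d₂ * x₂ + 0))) + 4 * n
          ≤⟨ +-monoˡ-≤ (4 * n) (+-mono-≤ n₃ (+-mono-≤ LU (+-mono-≤ (x₁≤ (8 * L * d₁) (≤-trans (m≤m+n _ (4 * A₂ * dθ)) J₁-large)) (+-monoˡ-≤ 0 (x₂≤ (8 * L * d₂) J₂-large))))) ⟩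
        4 * n + 4 * n  ≡⟨ e₂ n ⟩
        8 * n  ≤⟨ *-monoʳ-≤ 8 n-hi ⟩
        8 * (L * q + L)  ≡⟨ e₃ L q ⟩
        8 * L * q + 4 * (2 * L)  ≤⟨ +-monoʳ-≤ (8 * L * q) (*-monoʳ-≤ 4 n₄) ⟩
        8 * L * q + 4 * n  ∎))
        where
        open ≤-Reasoning
        e₀ : ∀ U l x₁ x₂ r P → U + l * (suc l + l * (x₁ + 2)) + (4 * (l * (suc l + l * (x₁ + 2) + (x₂ + 2))) + 2 * r) + (P + suc l * (P * (l * (suc l + l * (x₁ + 2) + (x₁ + 2))))) ≡
          l * (suc l + l * 2) + (4 * (l * (suc l + l * 2 + 2)) + 2 * r) + (P + suc l * (P * (l * (suc l + l * 2 + 2)))) + U + (l * l + 4 * (l * l) + suc l * P * l * suc l) * x₁ + 4 * l * x₂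
        e₀ = solve-∀
        e₁ : ∀ L c U d x e y → 8 * L * (c + U + d * x + e * y) ≡ 8 * L * c + (8 * L * U + (8 * L * d * x + (8 * L * e * y + 0)))
        e₁ = solve-∀
        e₂ : ∀ n → 4 * n + 4 * n ≡ 8 * n
        e₂ = solve-∀
        e₃ : ∀ L q → 8 * (L * q + L) ≡ 8 * L * q + 4 * (2 * L)
        e₃ = solve-∀

-- Deleting a vertex from the ground set.

#-∌ : ∀ {n} (u : Fin (suc n)) {A : Subset (suc n) → Set} (A? : Decidable A) →
  # (sets (suc n)) (λ S → ¬? (u ∈? S) ×-dec A? S) ≡ # (sets n) (λ S → A? (insertAt S u outside))
#-∌ {n} zero A? = trans (∑-sets-suc n _) (cong₂ _+_
  (trans (∑-cong (sets n) λ S → 𝟙-no (¬? (zero ∈? (inside ∷ S)) ×-dec A? (inside ∷ S)) λ (p , _) → p here) (∑-zero (sets n)))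
  (#-cong (sets n) (λ S → ¬? (zero ∈? (outside ∷ S)) ×-dec A? (outside ∷ S)) (λ S → A? (outside ∷ S)) (λ _ → proj₂) (λ _ p → (λ ()) , p)))
#-∌ {suc n} (suc u) A? = trans (∑-sets-suc (suc n) _) (trans (cong₂ _+_ (step inside) (step outside)) (sym (∑-sets-suc n _)))
  where
  step : ∀ b → # (sets (suc n)) (λ S → ¬? (suc u ∈? (b ∷ S)) ×-dec A? (b ∷ S)) ≡ # (sets n) (λ S → A? (b ∷ insertAt S u outside))
  step b = trans (#-cong (sets (suc n)) (λ S → ¬? (suc u ∈? (b ∷ S)) ×-dec A? (b ∷ S)) (λ S → ¬? (u ∈? S) ×-dec A? (b ∷ S))
      (λ _ (p , q) → p ∘ there , q) (λ _ (p , q) → p ∘ drop-there , q)) (#-∌ u (A? ∘ (b ∷_)))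

∣insertAt∣ : ∀ {n} (S : Subset n) u → ∣ insertAt S u outside ∣ ≡ ∣ S ∣
∣insertAt∣ S           zero    = refl
∣insertAt∣ (true ∷ S)  (suc u) = cong suc (∣insertAt∣ S u)
∣insertAt∣ (false ∷ S) (suc u) = ∣insertAt∣ S u

insertAt-injective : ∀ {n} (S S′ : Subset n) u → insertAt S u outside ≡ insertAt S′ u outside → S ≡ S′
insertAt-injective S S′ u e = trans (sym (removeAt-insertAt S u outside)) (trans (cong (λ R → removeAt R u) e) (removeAt-insertAt S′ u outside))

∈insertAt⁺ : ∀ {n} (S : Subset n) u {y} → y ∈ S → punchIn u y ∈ insertAt S u outside
∈insertAt⁺ S u {y} y∈ = lookup⇒[]= (punchIn u y) _ (trans (insertAt-punchIn S u outside y) ([]=⇒lookup y∈))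

∈insertAt⁻ : ∀ {n} (S : Subset n) u {y} → punchIn u y ∈ insertAt S u outside → y ∈ S
∈insertAt⁻ S u {y} y∈ = lookup⇒[]= y S (trans (sym (insertAt-punchIn S u outside y)) ([]=⇒lookup y∈))

∈insertAt-old : ∀ {n} (S : Subset n) u x → x ∈ insertAt S u outside → ∃ λ y → punchIn u y ≡ x × y ∈ S
∈insertAt-old S u x x∈ with u ≟ᶠ x
... | yes refl = contradiction (trans (sym ([]=⇒lookup x∈)) (insertAt-lookup S u outside)) λ ()
... | no u≢x   = punchOut u≢x , punchIn-punchOut u≢x , ∈insertAt⁻ S u (subst (_∈ insertAt S u outside) (sym (punchIn-punchOut u≢x)) x∈)

-- The complete multipartite graphs with two added edges.

module Variants (ℓ₀ t₀ : ℕ) where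

  ℓ : ℕ
  ℓ = 4 + ℓ₀

  ℓ′ : ℕ
  ℓ′ = 3 + ℓ₀

  t : ℕ
  t = 4 + t₀

  K : ℕ
  K = ℓ * t

  Place : Set
  Place = Fin ℓ × Fin t

  vertex : Place → Fin K
  vertex (i , a) = combine i a

  -- the two edges added to K_ℓ[t]
  u₁ w₁ : Place
  u₁ = zero , zero
  w₁ = zero , suc zero

  u₂ w₂ : Variant → Place
  u₂ α = zero , suc zero
  u₂ β = zero , suc (suc zero)
  u₂ γ = suc zero , zero
  w₂ α = zero , suc (suc zero)
  w₂ β = zero , suc (suc (suc zero))
  w₂ γ = suc zero , suc zero

  class-of : Fin K → Fin ℓ
  class-of x = proj₁ (remQuot {ℓ} t x)

  position : Fin K → Fin t
  position x = proj₂ (remQuot {ℓ} t x)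

  place-≡ : ∀ x → vertex (class-of x , position x) ≡ x
  place-≡ = combine-remQuot {ℓ} t

  at : ∀ (i : Fin ℓ) (a : Fin t) x → T (part ℓ t x ≡ᵇ toℕ i) → T (pos ℓ t x ≡ᵇ toℕ a) → x ≡ vertex (i , a)
  at i a x p q = trans (sym (place-≡ x)) (cong₂ (λ i a → vertex (i , a)) (toℕ-injective (≡ᵇ⇒≡ (part ℓ t x) (toℕ i) p)) (toℕ-injective (≡ᵇ⇒≡ (pos ℓ t x) (toℕ a) q)))

  inPart⇒Same : ∀ (i : Fin ℓ) (a b : Fin t) x y → T (inPart ℓ t (toℕ i) (toℕ a) (toℕ b) x y) → Same (vertex (i , a)) (vertex (i , b)) x y
  inPart⇒Same i a b x y p =
    let px , p₁ = ∧⁻ {part ℓ t x ≡ᵇ toℕ i} p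
        py , p₂ = ∧⁻ {part ℓ t y ≡ᵇ toℕ i} p₁
    in [ (λ q → let qx , qy = ∧⁻ {pos ℓ t x ≡ᵇ toℕ a} q in inj₁ (at i a x px qx , at i b y py qy))
       , (λ q → let qx , qy = ∧⁻ {pos ℓ t x ≡ᵇ toℕ b} q in inj₂ (at i b x px qx , at i a y py qy)) ]′
       (∨⁻ {(pos ℓ t x ≡ᵇ toℕ a) ∧ (pos ℓ t y ≡ᵇ toℕ b)} p₂)

  VarAdj⇒ : ∀ v x y → T (VarAdj v ℓ t x y) →
    class-of x ≢ class-of y ⊎ (Same (vertex u₁) (vertex w₁) x y ⊎ Same (vertex (u₂ v)) (vertex (w₂ v)) x y)
  VarAdj⇒ v x y p = [ (λ k → inj₁ λ e → not⁻ k (≡⇒≡ᵇ (part ℓ t x) (part ℓ t y) (cong toℕ e))) , inj₂ ]′ (split v p)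
    where
    split : ∀ v → T (VarAdj v ℓ t x y) → T (Kadj ℓ t x y) ⊎
      (Same (vertex u₁) (vertex w₁) x y ⊎ Same (vertex (u₂ v)) (vertex (w₂ v)) x y)
    split α p = [ inj₁ , (λ q → inj₂ ([ (λ s → inj₁ (inPart⇒Same zero zero (suc zero) x y s)) ,
      (λ s → inj₂ (inPart⇒Same zero (suc zero) (suc (suc zero)) x y s)) ]′ (∨⁻ {inPart ℓ t 0 0 1 x y} q))) ]′ (∨⁻ {Kadj ℓ t x y} p)
    split β p = [ inj₁ , (λ q → inj₂ ([ (λ s → inj₁ (inPart⇒Same zero zero (suc zero) x y s)) ,
      (λ s → inj₂ (inPart⇒Same zero (suc (suc zero)) (suc (suc (suc zero))) x y s)) ]′ (∨⁻ {inPart ℓ t 0 0 1 x y} q))) ]′ (∨⁻ {Kadj ℓ t x y} p)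
    split γ p = [ inj₁ , (λ q → inj₂ ([ (λ s → inj₁ (inPart⇒Same zero zero (suc zero) x y s)) ,
      (λ s → inj₂ (inPart⇒Same (suc zero) zero (suc zero) x y s)) ]′ (∨⁻ {inPart ℓ t 0 0 1 x y} q))) ]′ (∨⁻ {Kadj ℓ t x y} p)

  -- Size of the blocks of the cores below: four reserved positions for the ends of the two moved
  -- sets, and three windows of `t` positions, one for moving both sets and one for the partner of
  -- each moved set.
  P : ℕ
  P = 4 + 3 * t

  reserved : Fin 4 → Fin P
  reserved c = c ↑ˡ (3 * t)

  window : Fin 3 → Fin t → Fin P
  window k a = 4 ↑ʳ combine k a

  reserved-injective : ∀ {c d} → reserved c ≡ reserved d → c ≡ d
  reserved-injective = ↑ˡ-injective (3 * t) _ _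

  window-injective : ∀ {k k′ a a′} → window k a ≡ window k′ a′ → k ≡ k′ × a ≡ a′
  window-injective {k} {k′} {a} {a′} e = combine-injective k a k′ a′ (↑ʳ-injective 4 _ _ e)

  window≢reserved : ∀ {k a c} → window k a ≢ reserved c
  window≢reserved {k} {a} {c} e = <⇒≢ (<-≤-trans (toℕ<n c) (m≤m+n 4 (toℕ (combine k a))))
    (trans (sym (toℕ-↑ˡ c (3 * t))) (trans (cong toℕ (sym e)) (toℕ-↑ʳ 4 (combine k a))))

  -- Colours of sets with two vertices of one class.

  module Connection {n : ℕ} (r′ Cap : ℕ) (v : Variant) (χ : Subset n → ℕ) (G : Subset n → Set) (G? : Decidable G)
    (G-size : ∀ {S} → G S → ∣ S ∣ ≡ 4 + r′) (G-inj : ∀ {S S′} → G S → G S′ → χ S ≡ χ S′ → S ≡ S′)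
    (cap₁ : K + 4 * (4 + r′) + K * K * (4 + r′) ≤ Cap) (cap₂ : ℓ * P + (4 + r′) ≤ Cap) (nbig : ℓ * P + 4 * (4 + r′) ≤ n)
    (none : ¬ RainbowSystems.RainbowSystem (4 + r′) K (VarAdj v ℓ t) χ) where

    open Representatives r′ Cap χ G G? G-size G-inj public

    record Core {m} (C : Fin ℓ → Fin m → Fin n) : Set where
      constructor mkCore
      field
        inj   : ∀ i {a b} → C i a ≡ C i b → a ≡ b
        heavy : ∀ i j a b → i ≢ j → Heavy (C i a) (C j b)

      inj₂′ : ∀ {i j a b} → C i a ≡ C j b → i ≡ j × a ≡ b
      inj₂′ {i} {j} {a} {b} e with i ≟ᶠ j
      ... | yes refl = refl , inj i e
      ... | no i≢j   = contradiction e (proj₁ (heavy i j a b i≢j))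
    open Core

    reindex : ∀ {m m′} {C : Fin ℓ → Fin m → Fin n} → Core C → (f : Fin m′ → Fin m) → (∀ {a b} → f a ≡ f b → a ≡ b) → Core (λ i a → C i (f a))
    reindex co f finj = mkCore (λ i e → finj (inj co i e)) (λ i j a b → heavy co i j (f a) (f b))

    -- Such a vertex can stand in for a member of block `i`.
    Joined : ∀ {m} → (Fin ℓ → Fin m → Fin n) → Fin ℓ → Fin n → Set
    Joined C i x = ∀ k a → k ≢ i → Heavy x (C k a)

    Avoids : ∀ {m} → (Fin ℓ → Fin m → Fin n) → Subset n → Set
    Avoids C S = ∀ k a → C k a ∉ S

    record Anchored {m} (C : Fin ℓ → Fin m → Fin n) (i : Fin ℓ) (x y : Fin n) (S : Subset n) : Set where
      constructor anchored
      field
        size-S   : ∣ S ∣ ≡ r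
        x≢y      : x ≢ y
        x∈S      : x ∈ S
        y∈S      : y ∈ S
        x-joined : Joined C i x
        y-joined : Joined C i y
        avoids   : Avoids C S
    open Anchored

    -- Without a rainbow system, `p` and `q` are a place for the other added edge at which every
    -- suitable set is forced to have the colour of `S`. For `α` the added edges share a vertex, so
    -- `p` is `y` itself; hence the alternatives in `p-ok` and `q-ok`.
    record Partner {m} (C : Fin ℓ → Fin m → Fin n) (y : Fin n) (S : Subset n) : Set where
      field
        p q : Fin n
        p-ok : p ≡ y ⊎ ∃ λ k → ∃ λ a → C k a ≡ p
        q-ok : q ≡ y ⊎ ∃ λ k → ∃ λ a → C k a ≡ q
        same : ∀ S′ → ∣ S′ ∣ ≡ r → p ∈ S′ → q ∈ S′ → (∀ k a → C k a ∈ S′ → C k a ≡ p ⊎ C k a ≡ q) →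
          (∀ z → z ∈ S′ → z ∈ S → z ≡ p ⊎ z ≡ q) → χ S ≡ χ S′

    -- Put S on the first added edge of F, with x, y as its ends; the partner is then the place of the second added edge.
    abstract
      partner : ∀ {C : Fin ℓ → Fin t → Fin n} → Core C → ∀ {i x y S} → Anchored C i x y S → Partner C y S
      partner {C} co {i} {x} {y} {S} an = record { p = core (vertex (u₂ v)) ; q = core (vertex (w₂ v)) ; p-ok = ok-u v ; q-ok = ok-w v ; same = same }
        where
        -- Block `i` is moved to the front, where the first added edge lies, and `x`, `y` replace
        -- its first two vertices; both are joined to all other blocks.
        c : Fin ℓ → Fin t → Fin n
        c zero    zero          = x
        c zero    (suc zero)    = y
        c zero    (suc (suc a)) = C i (suc (suc a))
        c (suc k) a             = C (punchIn i k) a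
        core : Fin K → Fin n
        core z = c (class-of z) (position z)
        core-vertex : ∀ k a → core (vertex (k , a)) ≡ c k a
        core-vertex k a = cong (λ p → c (proj₁ p) (proj₂ p)) (remQuot-combine k a)
        fromC : ∀ k a → (c k a ≡ x × (k , a) ≡ u₁) ⊎ (c k a ≡ y × (k , a) ≡ w₁) ⊎ ∃ λ k′ → ∃ λ a′ → C k′ a′ ≡ c k a
        fromC zero    zero          = inj₁ (refl , refl)
        fromC zero    (suc zero)    = inj₂ (inj₁ (refl , refl))
        fromC zero    (suc (suc a)) = inj₂ (inj₂ (_ , _ , refl))
        fromC (suc k) a             = inj₂ (inj₂ (_ , _ , refl))
        x∉C : ∀ k a → C k a ≢ x
        x∉C k a e = avoids an k a (subst (_∈ S) (sym e) (x∈S an))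
        y∉C : ∀ k a → C k a ≢ y
        y∉C k a e = avoids an k a (subst (_∈ S) (sym e) (y∈S an))
        heavy₀ : ∀ a k b → Heavy (c zero a) (C (punchIn i k) b)
        heavy₀ zero          k b = x-joined an _ b (punchInᵢ≢i i k)
        heavy₀ (suc zero)    k b = y-joined an _ b (punchInᵢ≢i i k)
        heavy₀ (suc (suc a)) k b = heavy co _ _ _ b (punchInᵢ≢i i k ∘ sym)
        co′ : Core c
        co′ = mkCore injc heavyc
          where
          injc : ∀ k {a b} → c k a ≡ c k b → a ≡ b
          injc zero {zero}        {zero}        e = refl
          injc zero {zero}        {suc zero}    e = contradiction e (x≢y an)
          injc zero {zero}        {suc (suc b)} e = contradiction (sym e) (x∉C _ _)
          injc zero {suc zero}    {zero}        e = contradiction (sym e) (x≢y an)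
          injc zero {suc zero}    {suc zero}    e = refl
          injc zero {suc zero}    {suc (suc b)} e = contradiction (sym e) (y∉C _ _)
          injc zero {suc (suc a)} {zero}        e = contradiction e (x∉C _ _)
          injc zero {suc (suc a)} {suc zero}    e = contradiction e (y∉C _ _)
          injc zero {suc (suc a)} {suc (suc b)} e = inj co i e
          injc (suc k) e = inj co _ e
          heavyc : ∀ k l a b → k ≢ l → Heavy (c k a) (c l b)
          heavyc zero    zero    a b k≢l = contradiction refl k≢l
          heavyc zero    (suc l) a b k≢l = heavy₀ a l b
          heavyc (suc k) zero    a b k≢l = Heavy-sym (heavy₀ b k a)
          heavyc (suc k) (suc l) a b k≢l = heavy co _ _ a b (k≢l ∘ cong suc ∘ punchIn-injective i k l)
        core-inj : ∀ z z′ → core z ≡ core z′ → z ≡ z′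
        core-inj z z′ e = let e₁ , e₂ = inj₂′ co′ {class-of z} {class-of z′} {position z} {position z′} e in
          trans (sym (place-≡ z)) (trans (cong₂ (λ k a → vertex (k , a)) e₁ e₂) (place-≡ z′))
        ok-u : ∀ v → core (vertex (u₂ v)) ≡ y ⊎ ∃ λ k → ∃ λ a → C k a ≡ core (vertex (u₂ v))
        ok-u α = inj₁ (core-vertex zero (suc zero))
        ok-u β = inj₂ (_ , _ , sym (core-vertex zero (suc (suc zero))))
        ok-u γ = inj₂ (_ , _ , sym (core-vertex (suc zero) zero))
        ok-w : ∀ v → core (vertex (w₂ v)) ≡ y ⊎ ∃ λ k → ∃ λ a → C k a ≡ core (vertex (w₂ v))
        ok-w α = inj₂ (_ , _ , sym (core-vertex zero (suc (suc zero))))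
        ok-w β = inj₂ (_ , _ , sym (core-vertex zero (suc (suc (suc zero)))))
        ok-w γ = inj₂ (_ , _ , sym (core-vertex (suc zero) (suc zero)))
        open RainbowSystems r K (VarAdj v ℓ t) using (Exact; Compatible)
        kinds : ∀ z z′ → Edge K (VarAdj v ℓ t) z z′ → Heavy (core z) (core z′) ⊎ (Same (vertex u₁) (vertex w₁) z z′ ⊎ Same (vertex (u₂ v)) (vertex (w₂ v)) z z′)
        kinds z z′ ed = [ (λ ne → inj₁ (heavy co′ _ _ _ _ ne)) , inj₂ ]′ (VarAdj⇒ v z z′ (proj₂ (∧⁻ {toℕ z <ᵇ toℕ z′} ed)))
        at-place : ∀ z {pl} → (class-of z , position z) ≡ pl → z ≡ vertex pl
        at-place z e = trans (sym (place-≡ z)) (cong vertex e)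
        exact₁ : Exact core (vertex u₁) (vertex w₁) S
        exact₁ = size-S an , subst (_∈ S) (sym (core-vertex zero zero)) (x∈S an) , subst (_∈ S) (sym (core-vertex zero (suc zero))) (y∈S an) , only
          where
          only : ∀ z → core z ∈ S → z ≡ vertex u₁ ⊎ z ≡ vertex w₁
          only z z∈ = [ (λ (_ , e) → inj₁ (at-place z e)) , [ (λ (_ , e) → inj₂ (at-place z e)) ,
            (λ (k , a , e) → contradiction (subst (_∈ S) (sym e) z∈) (avoids an k a)) ]′ ]′ (fromC (class-of z) (position z))
        same : ∀ S′ → ∣ S′ ∣ ≡ r → core (vertex (u₂ v)) ∈ S′ → core (vertex (w₂ v)) ∈ S′ →
          (∀ k a → C k a ∈ S′ → C k a ≡ core (vertex (u₂ v)) ⊎ C k a ≡ core (vertex (w₂ v))) →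
          (∀ z → z ∈ S′ → z ∈ S → z ≡ core (vertex (u₂ v)) ⊎ z ≡ core (vertex (w₂ v))) → χ S ≡ χ S′
        same S′ h p∈ q∈ onlyC onlyS = decidable-stable (χ S ≟ χ S′) λ ne →
          none (embed K (VarAdj v ℓ t) cap₁ core core-inj (vertex u₁) (vertex w₁) (vertex (u₂ v)) (vertex (w₂ v)) S S′ kinds exact₁ exact₂
            ((λ z p q → [ (λ e → vertex (u₂ v) , sym e) , (λ e → vertex (w₂ v) , sym e) ]′ (onlyS z q p)) , ne))
          where
          pq : ∀ z → core z ≡ core (vertex (u₂ v)) ⊎ core z ≡ core (vertex (w₂ v)) → z ≡ vertex (u₂ v) ⊎ z ≡ vertex (w₂ v)
          pq z (inj₁ e) = inj₁ (core-inj z _ e)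
          pq z (inj₂ e) = inj₂ (core-inj z _ e)
          only : ∀ z → core z ∈ S′ → z ≡ vertex (u₂ v) ⊎ z ≡ vertex (w₂ v)
          only z z∈ = [ (λ (e , _) → pq z (onlyS _ z∈ (subst (_∈ S) (sym e) (x∈S an)))) ,
            [ (λ (e , _) → pq z (onlyS _ z∈ (subst (_∈ S) (sym e) (y∈S an)))) ,
              (λ (k , a , e) → pq z (subst (λ x → x ≡ core (vertex (u₂ v)) ⊎ x ≡ core (vertex (w₂ v))) e (onlyC k a (subst (_∈ S′) (sym e) z∈)))) ]′ ]′
            (fromC (class-of z) (position z))
          exact₂ : Exact core (vertex (u₂ v)) (vertex (w₂ v)) S′
          exact₂ = h , p∈ , q∈ , only

    quad : Fin n → Fin n → Fin n → Fin n → Subset n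
    quad a b c d = add a (add b (add c (add d ∅)))

    -- Two pairs have to fit into one `r`-set: the use of `r ≥ 4`.
    ∣quad∣≤ : ∀ a b c d → ∣ quad a b c d ∣ ≤ r
    ∣quad∣≤ a b c d = ≤-trans (∣add∣≤ a (add b (add c (add d ∅)))) (≤-trans (s≤s (≤-trans (∣add∣≤ b (add c (add d ∅))) (s≤s (≤-trans (∣add∣≤ c (add d ∅)) (s≤s (≤-trans (∣add∣≤ d (∅ {n})) (s≤s (∣∅∣≤ {n} 0)))))))) (m≤m+n 4 r′))

    ⊎-elim₄ : ∀ {A B C D X : Set} → (A → X) → (B → X) → (C → X) → (D → X) → A ⊎ B ⊎ C ⊎ D → X
    ⊎-elim₄ f g h i = [ f , [ g , [ h , i ]′ ]′ ]′

    ∈quad⁻ : ∀ {a b c d x} → x ∈ quad a b c d → x ≡ a ⊎ x ≡ b ⊎ x ≡ c ⊎ x ≡ d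
    ∈quad⁻ {a} {b} {c} {d} p with ∈add⁻ a _ p
    ... | inj₁ e = inj₁ e
    ... | inj₂ p with ∈add⁻ b _ p
    ...   | inj₁ e = inj₂ (inj₁ e)
    ...   | inj₂ p with ∈add⁻ c _ p
    ...     | inj₁ e = inj₂ (inj₂ (inj₁ e))
    ...     | inj₂ p with ∈add⁻ d ∅ p
    ...       | inj₁ e = inj₂ (inj₂ (inj₂ e))
    ...       | inj₂ q = contradiction q ∉⊥

    module _ {D : Fin ℓ → Fin P → Fin n} (co : Core D) where

      inD? : ∀ x → Dec (∃ λ k → ∃ λ a → D k a ≡ x)
      inD? x = any? λ k → any? λ a → D k a ≟ᶠ x

      Im : Subset n
      Im = fromDec inD?

      D∈Im : ∀ k a → D k a ∈ Im
      D∈Im k a = ∈-fromDec⁺ inD? (k , a , refl)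

      ∣Im∣≤ : ∣ Im ∣ ≤ ℓ * P
      ∣Im∣≤ = ≤-trans (≤-reflexive (∣fromDec∣ inD?)) (≤-trans (#-⋃ (fins n) (fins ℓ) inD? (λ k x → any? λ a → D k a ≟ᶠ x) (λ x (k , p) → k , ∈-fins k , p))
        (≤-trans (∑-mono (fins ℓ) λ k → ≤-trans (#-⋃ (fins n) (fins P) (λ x → any? λ a → D k a ≟ᶠ x) (λ a x → x ≟ᶠ D k a) (λ x (a , e) → a , ∈-fins a , sym e))
            (≤-reflexive (trans (∑-cong (fins P) λ a → #-≡ (D k a)) (trans (∑-fins-const P 1) (*-identityʳ P)))))
          (≤-reflexive (∑-fins-const ℓ P))))

      part-of : Fin 3 → Fin ℓ → Fin t → Fin n
      part-of k i a = D i (window k a)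

      part-core : ∀ k → Core (part-of k)
      part-core k = reindex co (window k) (λ {a} {b} e → proj₂ (window-injective {k} {k} {a} {b} e))

      part-anchored : ∀ k {i x y S} → Anchored D i x y S → Anchored (part-of k) i x y S
      part-anchored k (anchored a b c d e f g) = anchored a b c d (λ k′ a′ → e k′ _) (λ k′ a′ → f k′ _) (λ k′ a′ → g k′ _)

      -- A set of the colour of `S` in standard position: apart from its two reserved vertices it
      -- meets the core only in the first window, so the other windows stay free for its own
      -- partner.
      record Moved (c d : Fin 4) (S : Subset n) : Set where
        field
          T′     : Subset n
          size-T : ∣ T′ ∣ ≡ r
          colour : χ S ≡ χ T′
          c∈     : D zero (reserved c) ∈ T′
          d∈     : D zero (reserved d) ∈ T′
          meets  : ∀ k a → D k a ∈ T′ → (∃ λ b → a ≡ window zero b) ⊎ (a ≡ reserved c ⊎ a ≡ reserved d)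

      -- The set consists of the partner pair in the first window, the two reserved vertices and
      -- vertices outside `S` and the core. As `S` avoids the core, the two sets share at most the
      -- partner pair.
      move : ∀ c d {i x y S} → Anchored D i x y S → Partner (part-of zero) y S → Moved c d S
      move c d {i} {x} {y} {S} an pt = finish (extend r Y (S ∪ Im) (∣quad∣≤ p q wc wd) (≤-trans (+-monoˡ-≤ r (≤-trans (∣∪∣≤ S Im) (+-mono-≤ (≤-reflexive (size-S an)) ∣Im∣≤))) bound))
        where
        open Partner pt
        wc wd : Fin n
        wc = D zero (reserved c)
        wd = D zero (reserved d)
        Y : Subset n
        Y = quad p q wc wd
        bound : r + ℓ * P + r ≤ n
        bound = ≤-trans (≤-reflexive (lemma r (ℓ * P))) (≤-trans (+-monoʳ-≤ (ℓ * P) (*-monoˡ-≤ r (s≤s (s≤s (z≤n {2}))))) nbig)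
          where
          lemma : ∀ r x → r + x + r ≡ x + 2 * r
          lemma = solve-∀
        -- `y` lies in `S`, which avoids the whole core, so a partner vertex met in `D` comes from
        -- the window.
        pos-ok : ∀ {z} → z ≡ y ⊎ (∃ λ k → ∃ λ a → part-of zero k a ≡ z) → ∀ k a → D k a ≡ z → ∃ λ b → a ≡ window zero b
        pos-ok (inj₁ refl) k a e = contradiction (subst (_∈ S) (sym e) (y∈S an)) (avoids an k a)
        pos-ok (inj₂ (k′ , b , e′)) k a e = b , proj₂ (inj₂′ co (trans e (sym e′)))
        finish : (∃ λ T → (∀ {x} → x ∈ Y → x ∈ T) × ∣ T ∣ ≡ r × (∀ {x} → x ∈ T → x ∈ Y ⊎ x ∉ S ∪ Im)) → Moved c d S
        finish (T , Y⊆T , hT , fresh) = record { T′ = T ; size-T = hT ; colour = same T hT (Y⊆T p∈Y) (Y⊆T q∈Y) onlyC onlyS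
                                               ; c∈ = Y⊆T c∈Y ; d∈ = Y⊆T d∈Y ; meets = meets }
          where
          p∈Y : p ∈ Y
          p∈Y = v∈add p _
          q∈Y : q ∈ Y
          q∈Y = ⊆add p _ (v∈add q _)
          c∈Y : wc ∈ Y
          c∈Y = ⊆add p _ (⊆add q _ (v∈add wc _))
          d∈Y : wd ∈ Y
          d∈Y = ⊆add p _ (⊆add q _ (⊆add wc _ (v∈add wd _)))
          inY : ∀ {z} → z ∈ T → z ∈ S ∪ Im → z ≡ p ⊎ z ≡ q ⊎ z ≡ wc ⊎ z ≡ wd
          inY z∈ z∈′ = [ ∈quad⁻ , contradiction z∈′ ]′ (fresh z∈)
          onlyC : ∀ k a → part-of zero k a ∈ T → part-of zero k a ≡ p ⊎ part-of zero k a ≡ q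
          onlyC k a z∈ = ⊎-elim₄ (λ e → inj₁ e)
            (λ e → inj₂ e)
            (λ e → contradiction (proj₂ (inj₂′ co e)) (window≢reserved {zero} {a} {c}))
            (λ e → contradiction (proj₂ (inj₂′ co e)) (window≢reserved {zero} {a} {d}))
            (inY z∈ (x∈p∪q⁺ (inj₂ (D∈Im k _))))
          onlyS : ∀ z → z ∈ T → z ∈ S → z ≡ p ⊎ z ≡ q
          onlyS z z∈ z∈S = ⊎-elim₄ (λ e → inj₁ e)
            (λ e → inj₂ e)
            (λ { refl → contradiction z∈S (avoids an _ _) })
            (λ { refl → contradiction z∈S (avoids an _ _) })
            (inY z∈ (x∈p∪q⁺ (inj₁ z∈S)))
          meets : ∀ k a → D k a ∈ T → (∃ λ b → a ≡ window zero b) ⊎ (a ≡ reserved c ⊎ a ≡ reserved d)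
          meets k a z∈ = ⊎-elim₄ (λ e → inj₁ (pos-ok p-ok k a e))
            (λ e → inj₁ (pos-ok q-ok k a e))
            (λ e → inj₂ (inj₁ (proj₂ (inj₂′ co e))))
            (λ e → inj₂ (inj₂ (proj₂ (inj₂′ co e))))
            (inY z∈ (x∈p∪q⁺ (inj₂ (D∈Im k a))))

      module _ {c d : Fin 4} (c≢d : c ≢ d) {S : Subset n} (mv : Moved c d S) (k : Fin 3) (k≢0 : k ≢ zero) where
        open Moved mv

        moved-anchored : Anchored (part-of k) zero (D zero (reserved c)) (D zero (reserved d)) T′
        moved-anchored = anchored size-T (λ e → c≢d (reserved-injective (inj co zero e))) c∈ d∈
          (λ j a j≢ → heavy co zero j _ _ (j≢ ∘ sym)) (λ j a j≢ → heavy co zero j _ _ (j≢ ∘ sym)) avoid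
          where
          avoid : Avoids (part-of k) T′
          avoid j a z∈ with meets j (window k a) z∈
          ... | inj₁ (b , e) = k≢0 (proj₁ (window-injective {k} {zero} {a} {b} e))
          ... | inj₂ (inj₁ e) = window≢reserved {k} {a} {c} e
          ... | inj₂ (inj₂ e) = window≢reserved {k} {a} {d} e

        moved-partner : Partner (part-of k) (D zero (reserved d)) T′
        moved-partner = partner (part-core k) moved-anchored

      module _ {S₁ S₂ : Subset n} (mv₁ : Moved zero (suc zero) S₁) (mv₂ : Moved (suc (suc zero)) (suc (suc (suc zero))) S₂)
        (pt₁ : Partner (part-of (suc zero)) (D zero (reserved (suc zero))) (Moved.T′ mv₁))
        (pt₂ : Partner (part-of (suc (suc zero))) (D zero (reserved (suc (suc (suc zero))))) (Moved.T′ mv₂)) where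

        private
          c₁ c₃ : Fin 4
          c₁ = suc zero
          c₃ = suc (suc (suc zero))
          module M₁ = Moved mv₁
          module M₂ = Moved mv₂
          open Partner pt₁ using () renaming (p to p₁; q to q₁; p-ok to p₁-ok; q-ok to q₁-ok; same to same₁)
          open Partner pt₂ using () renaming (p to p₂; q to q₂; p-ok to p₂-ok; q-ok to q₂-ok; same to same₂)
          T₁ = M₁.T′
          T₂ = M₂.T′
          Y = quad p₁ q₁ p₂ q₂
          Z = T₁ ∪ (T₂ ∪ Im)
          bound : ∣ Z ∣ + r ≤ n
          bound = ≤-trans (+-monoˡ-≤ r (≤-trans (∣∪∣≤ T₁ _) (+-mono-≤ (≤-reflexive M₁.size-T) (≤-trans (∣∪∣≤ T₂ Im) (+-mono-≤ (≤-reflexive M₂.size-T) ∣Im∣≤)))))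
            (≤-trans (≤-reflexive (lemma r (ℓ * P))) (≤-trans (+-monoʳ-≤ (ℓ * P) (*-monoˡ-≤ r (s≤s (s≤s (s≤s (z≤n {1})))))) nbig))
            where
            lemma : ∀ r x → r + (r + x) + r ≡ x + 3 * r
            lemma = solve-∀
          -- A partner vertex sits in the window of its core or at the reserved vertex in the role
          -- of `y`. Hence the two partner pairs are disjoint and neither meets the moved set of the
          -- other.
          Origin : Fin 4 → Fin 3 → Fin n → Set
          Origin d k z = ∃ λ j → ∃ λ a → D j a ≡ z × (a ≡ reserved d ⊎ ∃ λ b → a ≡ window k b)
          origin : ∀ {d k z} → z ≡ D zero (reserved d) ⊎ (∃ λ j → ∃ λ a → part-of k j a ≡ z) → Origin d k z
          origin (inj₁ e) = zero , _ , sym e , inj₁ refl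
          origin (inj₂ (j , a , e)) = j , _ , e , inj₂ (a , refl)
          o-p₁ = origin {c₁} {suc zero} {p₁} p₁-ok
          o-q₁ = origin {c₁} {suc zero} {q₁} q₁-ok
          o-p₂ = origin {c₃} {suc (suc zero)} {p₂} p₂-ok
          o-q₂ = origin {c₃} {suc (suc zero)} {q₂} q₂-ok
          apart : ∀ {d k d′ k′ z} → d ≢ d′ → k ≢ k′ → Origin d k z → Origin d′ k′ z → ⊥
          apart {d} {k} {d′} {k′} d≢ k≢ (j , a , e , oa) (j′ , a′ , e′ , oa′) with proj₂ (inj₂′ co (trans e (sym e′)))
          apart {d} {k} {d′} {k′} d≢ k≢ (j , a , e , inj₁ refl) (j′ , a′ , e′ , inj₁ o′) | refl = d≢ (reserved-injective o′)
          apart {d} {k} {d′} {k′} d≢ k≢ (j , a , e , inj₁ refl) (j′ , a′ , e′ , inj₂ (b , o′)) | refl = window≢reserved {k′} {b} {d} (sym o′)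
          apart {d} {k} {d′} {k′} d≢ k≢ (j , a , e , inj₂ (b , refl)) (j′ , a′ , e′ , inj₁ o′) | refl = window≢reserved {k} {b} {d′} o′
          apart {d} {k} {d′} {k′} d≢ k≢ (j , a , e , inj₂ (b , refl)) (j′ , a′ , e′ , inj₂ (b′ , o′)) | refl = k≢ (proj₁ (window-injective {k} {k′} {b} {b′} o′))
          outside-moved : ∀ {c d S} (mv : Moved c d S) {d′ k z} → k ≢ zero → d′ ≢ c → d′ ≢ d → Origin d′ k z → z ∉ Moved.T′ mv
          outside-moved {c} {d} mv {d′} {k} k≢0 d′≢c d′≢d (j , a , refl , oa) z∈ with Moved.meets mv j a z∈ | oa
          ... | inj₁ (b , refl) | inj₁ e = window≢reserved {zero} {b} {d′} e
          ... | inj₁ (b , refl) | inj₂ (b′ , e) = k≢0 (sym (proj₁ (window-injective {zero} {k} {b} {b′} e)))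
          ... | inj₂ (inj₁ refl) | inj₁ e = d′≢c (sym (reserved-injective e))
          ... | inj₂ (inj₁ refl) | inj₂ (b′ , e) = window≢reserved {k} {b′} {c} (sym e)
          ... | inj₂ (inj₂ refl) | inj₁ e = d′≢d (sym (reserved-injective e))
          ... | inj₂ (inj₂ refl) | inj₂ (b′ , e) = window≢reserved {k} {b′} {d} (sym e)

        -- `T` is built on both partner pairs at once, so it has the colour of either moved set.
        meet-colours : (∃ λ T → (∀ {x} → x ∈ Y → x ∈ T) × ∣ T ∣ ≡ r × (∀ {x} → x ∈ T → x ∈ Y ⊎ x ∉ Z)) → χ S₁ ≡ χ S₂
        meet-colours (T , Y⊆T , hT , fresh) = trans M₁.colour (trans (same₁ T hT (Y⊆T (v∈add p₁ _)) (Y⊆T (⊆add p₁ _ (v∈add q₁ _))) onlyC₁ onlyS₁)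
            (sym (trans M₂.colour (same₂ T hT (Y⊆T (⊆add p₁ _ (⊆add q₁ _ (v∈add p₂ _)))) (Y⊆T (⊆add p₁ _ (⊆add q₁ _ (⊆add p₂ _ (v∈add q₂ _))))) onlyC₂ onlyS₂))))
          where
          inY : ∀ {z} → z ∈ T → z ∈ Z → z ≡ p₁ ⊎ z ≡ q₁ ⊎ z ≡ p₂ ⊎ z ≡ q₂
          inY z∈ z∈′ = [ ∈quad⁻ , contradiction z∈′ ]′ (fresh z∈)
          D∈Z : ∀ k a → D k a ∈ Z
          D∈Z k a = x∈p∪q⁺ (inj₂ (x∈p∪q⁺ (inj₂ (D∈Im k a))))
          onlyC₁ : ∀ k a → part-of (suc zero) k a ∈ T → part-of (suc zero) k a ≡ p₁ ⊎ part-of (suc zero) k a ≡ q₁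
          onlyC₁ k a z∈ = ⊎-elim₄ (λ e → inj₁ e)
            (λ e → inj₂ e)
            (λ e → ⊥-elim (apart {c₁} {suc zero} {c₃} {suc (suc zero)} {p₂} (λ ()) (λ ()) (k , _ , e , inj₂ (a , refl)) o-p₂))
            (λ e → ⊥-elim (apart {c₁} {suc zero} {c₃} {suc (suc zero)} {q₂} (λ ()) (λ ()) (k , _ , e , inj₂ (a , refl)) o-q₂))
            (inY z∈ (D∈Z k _))
          onlyC₂ : ∀ k a → part-of (suc (suc zero)) k a ∈ T → part-of (suc (suc zero)) k a ≡ p₂ ⊎ part-of (suc (suc zero)) k a ≡ q₂
          onlyC₂ k a z∈ = ⊎-elim₄ (λ e → ⊥-elim (apart {c₃} {suc (suc zero)} {c₁} {suc zero} {p₁} (λ ()) (λ ()) (k , _ , e , inj₂ (a , refl)) o-p₁))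
            (λ e → ⊥-elim (apart {c₃} {suc (suc zero)} {c₁} {suc zero} {q₁} (λ ()) (λ ()) (k , _ , e , inj₂ (a , refl)) o-q₁))
            (λ e → inj₁ e)
            (λ e → inj₂ e)
            (inY z∈ (D∈Z k _))
          onlyS₁ : ∀ z → z ∈ T → z ∈ T₁ → z ≡ p₁ ⊎ z ≡ q₁
          onlyS₁ z z∈ z∈T₁ = ⊎-elim₄ (λ e → inj₁ e)
            (λ e → inj₂ e)
            (λ { refl → contradiction z∈T₁ (outside-moved mv₁ {c₃} {suc (suc zero)} (λ ()) (λ ()) (λ ()) o-p₂) })
            (λ { refl → contradiction z∈T₁ (outside-moved mv₁ {c₃} {suc (suc zero)} (λ ()) (λ ()) (λ ()) o-q₂) })
            (inY z∈ (x∈p∪q⁺ (inj₁ z∈T₁)))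
          onlyS₂ : ∀ z → z ∈ T → z ∈ T₂ → z ≡ p₂ ⊎ z ≡ q₂
          onlyS₂ z z∈ z∈T₂ = ⊎-elim₄ (λ { refl → contradiction z∈T₂ (outside-moved mv₂ {c₁} {suc zero} (λ ()) (λ ()) (λ ()) o-p₁) })
            (λ { refl → contradiction z∈T₂ (outside-moved mv₂ {c₁} {suc zero} (λ ()) (λ ()) (λ ()) o-q₁) })
            (λ e → inj₁ e)
            (λ e → inj₂ e)
            (inY z∈ (x∈p∪q⁺ (inj₂ (x∈p∪q⁺ (inj₁ z∈T₂)))))

        moved-connect : χ S₁ ≡ χ S₂
        moved-connect = meet-colours (extend r Y Z (∣quad∣≤ p₁ q₁ p₂ q₂) bound)

      -- S₁ and S₂ are moved to sets sharing nothing relevant with each other, which then have a common partner.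
      connect : ∀ {i j x y x′ y′ S₁ S₂} → Anchored D i x y S₁ → Anchored D j x′ y′ S₂ → χ S₁ ≡ χ S₂
      connect an₁ an₂ = moved-connect mv₁ mv₂ (moved-partner (λ ()) mv₁ (suc zero) (λ ())) (moved-partner (λ ()) mv₂ (suc (suc zero)) (λ ()))
        where
        mv₁ = move zero (suc zero) an₁ (partner (part-core zero) (part-anchored zero an₁))
        mv₂ = move (suc (suc zero)) (suc (suc (suc zero))) an₂ (partner (part-core zero) (part-anchored zero an₂))

      -- two sets of G through a heavy pair have different colours
      no-heavy-pair : ∀ {i x y} → Heavy x y → Joined D i x → Joined D i y → (∀ k a → D k a ≢ x) → (∀ k a → D k a ≢ y) → ⊥
      no-heavy-pair {i} {x} {y} hv jx jy x∉ y∉ = first (heavy-pick hv Im (≤-trans ∣Im∣≤ (≤-trans (m≤m+n _ r) cap₂)))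
        where
        anchor : ∀ S Z → (∀ {z} → z ∈ Im → z ∈ Z) → G S → x ∈ S → y ∈ S → (∀ z → z ∈ S → z ∈ Z → z ≡ x ⊎ z ≡ y) → Anchored D i x y S
        anchor S Z sub g x∈ y∈ av = anchored (G-size g) (proj₁ hv) x∈ y∈ jx jy
          λ k a z∈ → [ x∉ k a , y∉ k a ]′ (av _ z∈ (sub (D∈Im k a)))
        first : (∃ λ S → G S × x ∈ S × y ∈ S × (∀ z → z ∈ S → z ∈ Im → z ≡ x ⊎ z ≡ y)) → ⊥
        -- The second set has to avoid the first one as well; equal colours would make the two
        -- equal, against their size.
        first (S , g , x∈ , y∈ , av) = second (heavy-pick hv (Im ∪ S) (≤-trans (∣∪∣≤ Im S) (≤-trans (+-mono-≤ ∣Im∣≤ (≤-reflexive (G-size g))) cap₂)))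
          where
          second : (∃ λ S′ → G S′ × x ∈ S′ × y ∈ S′ × (∀ z → z ∈ S′ → z ∈ Im ∪ S → z ≡ x ⊎ z ≡ y)) → ⊥
          second (S′ , g′ , x∈′ , y∈′ , av′) = pair-small S′ (G-size g′) λ z z∈ → av′ z z∈ (x∈p∪q⁺ (inj₂ (subst (z ∈_) (sym S≡S′) z∈)))
            where
            S≡S′ : S ≡ S′
            S≡S′ = G-inj g g′ (connect (anchor S Im id g x∈ y∈ av) (anchor S′ (Im ∪ S) (λ p → x∈p∪q⁺ (inj₁ p)) g′ x∈′ y∈′ av′))

    record CoreAt (i j : Fin ℓ) (x y x′ y′ : Fin n) (S S′ : Subset n) : Set where
      constructor coreAt
      field
        D       : Fin ℓ → Fin P → Fin n
        isCore  : Core D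
        join-x  : Joined D i x
        join-y  : Joined D i y
        join-x′ : Joined D j x′
        join-y′ : Joined D j y′
        avoid   : Avoids D S
        avoid′  : Avoids D S′

    -- Abstracts what the comparison of colours needs from a notion of class. It is met twice: by
    -- the types read off from one blow-up and by the final classes of all vertices.
    HasCores : (Fin ℓ → Fin n → Set) → Set
    HasCores At = ∀ {i j x y x′ y′} → At i x → At i y → At j x′ → At j y′ → ∀ S S′ → ∣ S ∣ ≤ r → ∣ S′ ∣ ≤ r → CoreAt i j x y x′ y′ S S′

    same-colour : ∀ {At} → HasCores At → ∀ {S S′ i j x y x′ y′} → ∣ S ∣ ≡ r → ∣ S′ ∣ ≡ r →
      At i x → At i y → x ≢ y → x ∈ S → y ∈ S → At j x′ → At j y′ → x′ ≢ y′ → x′ ∈ S′ → y′ ∈ S′ → χ S ≡ χ S′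
    same-colour cores {S} {S′} h h′ ax ay x≢y x∈ y∈ ax′ ay′ x′≢y′ x′∈ y′∈ =
      finish (cores ax ay ax′ ay′ S S′ (≤-reflexive h) (≤-reflexive h′))
      where
      finish : CoreAt _ _ _ _ _ _ S S′ → χ S ≡ χ S′
      finish (coreAt D co jx jy jx′ jy′ av av′) = connect co (anchored h x≢y x∈ y∈ jx jy av) (anchored h′ x′≢y′ x′∈ y′∈ jx′ jy′ av′)

    -- A core joined to `x` and `y` contradicts `no-heavy-pair`; the pair itself is the set to be
    -- avoided, which keeps the core away from its vertices.
    independent : ∀ {At} → HasCores At → ∀ {i x y} → At i x → At i y → ¬ Heavy x y
    independent cores {i} {x} {y} ax ay hv = finish (cores ax ay ax ay (⁅ x ⁆ ∪ ⁅ y ⁆) ∅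
        (≤-trans (∣∪∣≤ ⁅ x ⁆ ⁅ y ⁆) (≤-trans (≤-reflexive (cong₂ _+_ (∣⁅x⁆∣≡1 x) (∣⁅x⁆∣≡1 y))) (s≤s (s≤s z≤n)))) (∣∅∣≤ {n} r))
      where
      finish : CoreAt i i x y x y (⁅ x ⁆ ∪ ⁅ y ⁆) ∅ → ⊥
      finish (coreAt D co jx jy _ _ av _) = no-heavy-pair co hv jx jy
        (λ k a e → av k a (subst (_∈ ⁅ x ⁆ ∪ ⁅ y ⁆) (sym e) (x∈p∪q⁺ (inj₁ (x∈⁅x⁆ x)))))
        (λ k a e → av k a (subst (_∈ ⁅ x ⁆ ∪ ⁅ y ⁆) (sym e) (x∈p∪q⁺ (inj₂ (x∈⁅x⁆ y)))))

    -- Types of vertices with respect to one blow-up.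

    module Types (τ T : ℕ) (T≡ : T ≡ 8 * τ) (B : Fin ℓ → Fin T → Fin n) (B-inj : ∀ i → Injective _≡_ _≡_ (B i))
      (B-heavy : ∀ i j a b → i ≢ j → Heavy (B i a) (B j b)) (τ-large : ℓ * P ≤ τ) (τ-large′ : 2 * r + P ≤ 4 * τ) where

      e : Fin ℓ → Fin n → ℕ
      e j u = # (fins T) (λ m → heavy? u (B j m))

      0<P : 0 < P
      0<P = s≤s z≤n

      P≤τ : P ≤ τ
      P≤τ = ≤-trans (m≤m+n P _) τ-large

      module _ {Pr : Fin ℓ → Fin T → Set} (Pr? : ∀ k → Decidable (Pr k)) where

        Selection : Set
        Selection = ∃ λ (f : Fin ℓ → Fin P → Fin T) → Core (λ k a → B k (f k a)) × (∀ k a → Pr k (f k a))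

        select : (∀ k → P ≤ # (fins T) (Pr? k)) → Selection
        select enough = finish (λ k → #-choose (fins-unique T) (Pr? k) (enough k))
          where
          finish : (∀ k → ∃ λ (f : Fin P → Fin T) → Injective _≡_ _≡_ f × (∀ a → Pr k (f a))) → Selection
          finish ch = (λ k → proj₁ (ch k)) , mkCore (λ i eq → proj₁ (proj₂ (ch i)) (B-inj i eq)) (λ i j a b → B-heavy i j _ _) , λ k → proj₂ (proj₂ (ch k))

      B-preimage : ∀ k S → # (fins T) (λ m → B k m ∈? S) ≤ ∣ S ∣
      B-preimage k = #-preimage≤ (B k) (B-inj k)

      -- otherwise a copy of K_ℓ[t] with an edge inside one part would be heavy
      few-neighbours : ∀ u i → 0 < e i u → ∃ λ j → j ≢ i × e j u < P
      few-neighbours u i 0<e = decidable-stable (any? λ j → ¬? (j ≟ᶠ i) ×-dec (e j u <? P)) λ no-few →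
        dense (λ j j≢i → ≮⇒≥ λ lt → no-few (j , j≢i , lt)) (#-∃ (fins T) (λ m → heavy? u (B i m)) 0<e)
        where
        dense : (∀ j → j ≢ i → P ≤ e j u) → (∃ λ m → Heavy u (B i m)) → ⊥
        dense many (m , hv) = finish (select Pr? enough)
          where
          b = B i m
          Pr : Fin ℓ → Fin T → Set
          Pr k a = (k ≢ i → Heavy u (B k a)) × (k ≡ i → B k a ∉ ⁅ u ⁆ ∪ ⁅ b ⁆)
          Pr? : ∀ k a → Dec (Pr k a)
          Pr? k a = (¬? (k ≟ᶠ i) →-dec heavy? u (B k a)) ×-dec (k ≟ᶠ i →-dec ¬? (B k a ∈? ⁅ u ⁆ ∪ ⁅ b ⁆))
          ∣ub∣≤2 : ∣ ⁅ u ⁆ ∪ ⁅ b ⁆ ∣ ≤ 2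
          ∣ub∣≤2 = ≤-trans (∣∪∣≤ ⁅ u ⁆ ⁅ b ⁆) (≤-reflexive (cong₂ _+_ (∣⁅x⁆∣≡1 u) (∣⁅x⁆∣≡1 b)))
          T-large : P + 2 ≤ T
          T-large = ≤-trans (+-mono-≤ P≤τ (≤-trans (s≤s (s≤s z≤n)) P≤τ)) (≤-trans (≤-reflexive (lemma τ)) (≤-trans (*-monoˡ-≤ τ (s≤s (s≤s (z≤n {6})))) (≤-reflexive (sym T≡))))
            where
            lemma : ∀ τ → τ + τ ≡ 2 * τ
            lemma = solve-∀
          enough : ∀ k → P ≤ # (fins T) (Pr? k)
          enough k with k ≟ᶠ i
          ... | no k≢i   = ≤-trans (many k k≢i) (#-mono (fins T) (λ a → heavy? u (B k a)) (λ a → (yes k≢i →-dec heavy? u (B k a)) ×-dec (no k≢i →-dec ¬? (B k a ∈? ⁅ u ⁆ ∪ ⁅ b ⁆)))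
                             λ a h → (λ _ → h) , λ k≡i → contradiction k≡i k≢i)
          ... | yes refl = +-cancelʳ-≤ 2 _ _ (≤-trans T-large (≤-trans (≤-reflexive (sym (length-fins T)))
                             (Most-¬ (fins T) (λ a → (no (λ k≢k → k≢k refl) →-dec heavy? u (B k a)) ×-dec (yes refl →-dec ¬? (B k a ∈? ⁅ u ⁆ ∪ ⁅ b ⁆))) (λ a → B k a ∈? ⁅ u ⁆ ∪ ⁅ b ⁆)
                               (λ a ¬p → decidable-stable (B k a ∈? ⁅ u ⁆ ∪ ⁅ b ⁆) λ ¬q → ¬p ((λ k≢k → contradiction refl k≢k) , λ _ → ¬q))
                               (≤-trans (B-preimage k _) ∣ub∣≤2))))
          finish : Selection Pr? → ⊥
          finish (f , co , pr) = no-heavy-pair co hv (λ k a k≢i → proj₁ (pr k a) k≢i) (λ k a k≢i → B-heavy i k m _ (k≢i ∘ sym)) u∉ b∉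
            where
            u∉ : ∀ k a → B k (f k a) ≢ u
            u∉ k a eq with k ≟ᶠ i
            ... | yes k≡i = proj₂ (pr k a) k≡i (subst (_∈ ⁅ u ⁆ ∪ ⁅ b ⁆) (sym eq) (x∈p∪q⁺ (inj₁ (x∈⁅x⁆ u))))
            ... | no k≢i  = proj₁ (proj₁ (pr k a) k≢i) (sym eq)
            b∉ : ∀ k a → B k (f k a) ≢ b
            b∉ k a eq with k ≟ᶠ i
            ... | yes k≡i = proj₂ (pr k a) k≡i (subst (_∈ ⁅ u ⁆ ∪ ⁅ b ⁆) (sym eq) (x∈p∪q⁺ (inj₂ (x∈⁅x⁆ b))))
            ... | no k≢i  = proj₁ (B-heavy k i (f k a) m k≢i) eq

      -- Seven eighths of a block of `8 * τ` vertices: four near vertices together miss at most half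
      -- of a block, and the other half has room for the core and the two sets to be avoided.
      Near : Fin ℓ → Fin n → Set
      Near i u = ∀ j → j ≢ i → 7 * τ ≤ e j u

      near? : ∀ i u → Dec (Near i u)
      near? i u = all? λ j → ¬? (j ≟ᶠ i) →-dec (7 * τ ≤? e j u)

      near-most : ∀ {i u} → Near i u → ∀ k → Most (fins T) (λ m → ¬? (k ≟ᶠ i) →-dec heavy? u (B k m)) τ
      near-most {i} {u} nr k with k ≟ᶠ i
      ... | yes k≡i = ≤-trans (≤-reflexive (trans (sym (*-identityʳ _)) (sym (∑-const (fins T) 1))))
                        (≤-trans (∑-mono (fins T) λ m → ≤-reflexive (sym (𝟙-yes (no (λ k≢ → k≢ k≡i) →-dec heavy? u (B k m)) λ k≢i → contradiction k≡i k≢i))) (m≤m+n _ τ))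
      ... | no k≢i  = ≤-trans (≤-reflexive (trans (length-fins T) (trans T≡ (lemma τ)))) (+-monoˡ-≤ τ (≤-trans (nr k k≢i)
                        (#-mono (fins T) (λ m → heavy? u (B k m)) (λ m → yes k≢i →-dec heavy? u (B k m)) λ _ h _ → h)))
        where
        lemma : ∀ τ → 8 * τ ≡ 7 * τ + τ
        lemma = solve-∀

      avoid-most : ∀ k S → ∣ S ∣ ≤ r → Most (fins T) (λ m → ¬? (B k m ∈? S)) r
      avoid-most k S S≤ = Most-¬ (fins T) (λ m → ¬? (B k m ∈? S)) (λ m → B k m ∈? S) (λ m → decidable-stable (B k m ∈? S)) (≤-trans (B-preimage k S) S≤)

      near-cores : HasCores Near
      near-cores {i} {j} {x} {y} {x′} {y′} nx ny nx′ ny′ S S′ S≤ S′≤ = finish (select all-ok? enough)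
        where
        ok : ∀ i x k m → Dec (k ≢ i → Heavy x (B k m))
        ok i x k m = ¬? (k ≟ᶠ i) →-dec heavy? x (B k m)
        all-ok? : ∀ k m → Dec (_ × _ × _ × _ × _ × _)
        all-ok? k m = ok i x k m ×-dec (ok i y k m ×-dec (ok j x′ k m ×-dec (ok j y′ k m ×-dec (¬? (B k m ∈? S) ×-dec ¬? (B k m ∈? S′)))))
        enough : ∀ k → P ≤ # (fins T) (all-ok? k)
        enough k = +-cancelʳ-≤ (τ + (τ + (τ + (τ + (r + r))))) _ _ (≤-trans arith (≤-trans (≤-reflexive (sym (length-fins T)))
          (Most-× (fins T) (ok i x k) _ (near-most nx k) (Most-× (fins T) (ok i y k) _ (near-most ny k) (Most-× (fins T) (ok j x′ k) _ (near-most nx′ k)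
            (Most-× (fins T) (ok j y′ k) _ (near-most ny′ k) (Most-× (fins T) (λ m → ¬? (B k m ∈? S)) (λ m → ¬? (B k m ∈? S′)) (avoid-most k S S≤) (avoid-most k S′ S′≤))))))))
          where
          lemma : ∀ τ r P → P + (τ + (τ + (τ + (τ + (r + r))))) ≡ 4 * τ + (2 * r + P)
          lemma = solve-∀
          lemma₂ : ∀ τ → 4 * τ + 4 * τ ≡ 8 * τ
          lemma₂ = solve-∀
          arith : P + (τ + (τ + (τ + (τ + (r + r))))) ≤ T
          arith = ≤-trans (≤-reflexive (lemma τ r P)) (≤-trans (+-monoʳ-≤ (4 * τ) τ-large′) (≤-reflexive (trans (lemma₂ τ) (sym T≡))))
        finish : Selection all-ok? → CoreAt i j x y x′ y′ S S′
        finish (f , co , pr) = coreAt _ co (λ k a → proj₁ (pr k a)) (λ k a → proj₁ (proj₂ (pr k a))) (λ k a → proj₁ (proj₂ (proj₂ (pr k a))))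
          (λ k a → proj₁ (proj₂ (proj₂ (proj₂ (pr k a))))) (λ k a → proj₁ (proj₂ (proj₂ (proj₂ (proj₂ (pr k a)))))) (λ k a → proj₂ (proj₂ (proj₂ (proj₂ (proj₂ (pr k a))))))

      open Cliques Heavy heavy? Heavy-sym using (adj?; Adj; Adj-removeAt; codegrees) public

      -- Counts the transversals of which `u` sees all entries except possibly the one in block `i`.
      -- Summed over `i` and `u` this is the sum of the codegrees of all transversals.
      c : Fin ℓ → Fin n → ℕ
      c i u = # (vecs T ℓ) (λ f → adj? u (removeAt (sel B f) i))

      c≤e : ∀ {i j} u → i ≢ j → c i u ≤ e j u * T ^ ℓ′
      c≤e {i} {j} u i≢j = begin
        c i u  ≤⟨ #-mono (vecs T ℓ) (λ f → adj? u (removeAt (sel B f) i)) (λ f → heavy? u (B j (Vec.lookup f j)))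
                                                                                            (λ f p → subst (Heavy u) (lookup-sel B f j) (Adj-removeAt u (sel B f) i i≢j p)) ⟩
        # (vecs T ℓ) (λ f → heavy? u (B j (Vec.lookup f j)))  ≡⟨ ∑-vecs-insert T ℓ′ j _ ⟩
        ∑ (vecs T ℓ′) (λ f → ∑ (fins T) (λ m → 𝟙 (heavy? u (B j (Vec.lookup (insertAt f j m) j))))) ≡⟨ ∑-cong (vecs T ℓ′) (λ f → ∑-cong (fins T) λ m →
                                                                                            cong (λ z → 𝟙 (heavy? u (B j z))) (insertAt-lookup f j m)) ⟩
        ∑ (vecs T ℓ′) (λ f → e j u)  ≡⟨ trans (∑-vecs-const T ℓ′ (e j u)) (*-comm (T ^ ℓ′) (e j u)) ⟩
        e j u * T ^ ℓ′  ∎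
        where open ≤-Reasoning

      W : Fin n → ℕ
      W u = ∑ (fins ℓ) (λ i → c i u)

      ∑-codegrees-W : ∑ (vecs T ℓ) (λ f → codegrees (sel B f)) ≡ ∑ (fins n) W
      ∑-codegrees-W = trans (∑-swap (vecs T ℓ) (fins ℓ) _) (trans (∑-cong (fins ℓ) λ i → ∑-swap (vecs T ℓ) (fins n) _) (∑-swap (fins ℓ) (fins n) _))

      e≤T : ∀ j u → e j u ≤ T
      e≤T j u = ≤-trans (#-≤-length (fins T) (λ m → heavy? u (B j m))) (≤-reflexive (length-fins T))

      other : ∀ (i : Fin ℓ) → ∃ λ j → i ≢ j
      other zero    = suc zero , λ ()
      other (suc i) = zero , λ ()

      -- Removing an entry outside block `i` leaves the entry in block `i`, which `u` does not see;
      -- only the term of `i` survives.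
      W-zero : ∀ {i} u → e i u ≡ 0 → W u ≤ c i u
      W-zero {i} u ei = ≤-trans (≤-reflexive (∑-at (λ k → c k u) i)) (≤-trans (+-monoʳ-≤ (c i u) (∑-mono (fins ℓ′) λ k →
          ≤-trans (c≤e u (punchInᵢ≢i i k)) (≤-reflexive (cong (_* T ^ ℓ′) ei)))) (≤-reflexive (trans (cong (c i u +_) (∑-zero (fins ℓ′))) (+-identityʳ _))))

      typed? : ∀ u → Dec (∃ λ i → Near i u)
      typed? u = any? λ i → near? i u

      e-zero : ∀ u i → (∀ j → j ≢ i → P ≤ e j u) → e i u ≡ 0
      e-zero u i many = n≤0⇒n≡0 (≮⇒≥ λ 0<e → let j , j≢i , lt = few-neighbours u i 0<e in <⇒≱ lt (many j j≢i))

      W-typed : ∀ u → (∃ λ i → Near i u) → W u ≤ T ^ ℓ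
      W-typed u (i , nr) = ≤-trans (W-zero u (e-zero u i λ j j≢i → ≤-trans (≤-trans P≤τ (m≤m+n τ _)) (nr j j≢i)))
        (≤-trans (c≤e u (proj₂ (other i))) (*-monoˡ-≤ (T ^ ℓ′) (e≤T _ u)))

      W-two-few : ∀ u {j j′} → j ≢ j′ → e j u < P → e j′ u < P → 8 * W u ≤ 7 * T ^ ℓ
      W-two-few u {j} {j′} j≢j′ lt lt′ = begin
        8 * W u  ≤⟨ *-monoʳ-≤ 8 (∑-mono (fins ℓ) each) ⟩
        8 * ∑ (fins ℓ) (λ _ → P * T ^ ℓ′)  ≡⟨ cong (8 *_) (∑-fins-const ℓ (P * T ^ ℓ′)) ⟩
        8 * (ℓ * (P * T ^ ℓ′))  ≡⟨ lemma ℓ P (T ^ ℓ′) ⟩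
        8 * (ℓ * P) * T ^ ℓ′  ≤⟨ *-monoˡ-≤ (T ^ ℓ′) (≤-trans (*-monoʳ-≤ 8 τ-large) (≤-reflexive (sym T≡))) ⟩
        T * T ^ ℓ′  ≤⟨ m≤m+n _ _ ⟩
        7 * T ^ ℓ  ∎
        where
        open ≤-Reasoning
        lemma : ∀ l P x → 8 * (l * (P * x)) ≡ 8 * (l * P) * x
        lemma = solve-∀
        each : ∀ i → c i u ≤ P * T ^ ℓ′
        each i = split (i ≟ᶠ j)
          where
          split : Dec (i ≡ j) → c i u ≤ P * T ^ ℓ′
          split (no i≢j)  = ≤-trans (c≤e u i≢j) (*-monoˡ-≤ (T ^ ℓ′) (<⇒≤ lt))
          split (yes i≡j) = ≤-trans (c≤e u (λ i≡j′ → j≢j′ (trans (sym i≡j) i≡j′))) (*-monoˡ-≤ (T ^ ℓ′) (<⇒≤ lt′))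

      W-one-zero : ∀ u {i j} → e i u ≡ 0 → i ≢ j → e j u < 7 * τ → 8 * W u ≤ 7 * T ^ ℓ
      W-one-zero u {i} {j} ei i≢j lt = begin
        8 * W u  ≤⟨ *-monoʳ-≤ 8 (≤-trans (W-zero u ei) (≤-trans (c≤e u i≢j) (*-monoˡ-≤ (T ^ ℓ′) (<⇒≤ lt)))) ⟩
        8 * (7 * τ * T ^ ℓ′)  ≡⟨ lemma τ (T ^ ℓ′) ⟩
        7 * (8 * τ * T ^ ℓ′)  ≡⟨ cong (λ z → 7 * (z * T ^ ℓ′)) (sym T≡) ⟩
        7 * T ^ ℓ  ∎
        where
        open ≤-Reasoning
        lemma : ∀ τ x → 8 * (7 * τ * x) ≡ 7 * (8 * τ * x)
        lemma = solve-∀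

      -- Some block has fewer than `P` neighbours, since otherwise `few-neighbours` would leave
      -- block `zero` without any. If two blocks do, every term is small. If only block `i` does, it
      -- contains none, and as `u` is not near `i`, another block has fewer than `7 * τ`.
      W-untyped : ∀ u → ¬ (∃ λ i → Near i u) → 8 * W u ≤ 7 * T ^ ℓ
      W-untyped u untyped = cases (any? λ i → e i u <? P)
        where
        cases : Dec (∃ λ i → e i u < P) → 8 * W u ≤ 7 * T ^ ℓ
        cases (no none-few) = contradiction (<-≤-trans (≤-<-trans z≤n 0<P) (≮⇒≥ λ lt → none-few (zero , lt)))
          (≤⇒≯ (≤-reflexive (e-zero u zero λ j _ → ≮⇒≥ λ lt → none-few (j , lt))))
        cases (yes (i , lt)) = cases₂ (any? λ j → ¬? (i ≟ᶠ j) ×-dec (e j u <? P))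
          where
          cases₂ : Dec (∃ λ j → i ≢ j × e j u < P) → 8 * W u ≤ 7 * T ^ ℓ
          cases₂ (yes (j , i≢j , lt′)) = W-two-few u i≢j lt lt′
          cases₂ (no only) = cases₃ (any? λ j → ¬? (i ≟ᶠ j) ×-dec (e j u <? 7 * τ))
            where
            cases₃ : Dec (∃ λ j → i ≢ j × e j u < 7 * τ) → 8 * W u ≤ 7 * T ^ ℓ
            cases₃ (yes (j , i≢j , lt″)) = W-one-zero u (e-zero u i λ j j≢i → ≮⇒≥ λ lt → only (j , j≢i ∘ sym , lt)) i≢j lt″
            cases₃ (no near) = contradiction (i , λ j j≢i → ≮⇒≥ λ lt → near (j , j≢i ∘ sym , lt)) untyped

      W-bound : ∀ u → 8 * W u + T ^ ℓ * 𝟙 (¬? (typed? u)) ≤ 8 * T ^ ℓ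
      W-bound u = bound (typed? u)
        where
        lemma : ∀ x → 7 * x + x ≡ 8 * x
        lemma = solve-∀
        bound : (d : Dec (∃ λ i → Near i u)) → 8 * W u + T ^ ℓ * 𝟙 (¬? d) ≤ 8 * T ^ ℓ
        bound (yes p) = ≤-trans (≤-reflexive (trans (cong (8 * W u +_) (*-zeroʳ (T ^ ℓ))) (+-identityʳ _))) (*-monoʳ-≤ 8 (W-typed u p))
        bound (no ¬p) = ≤-trans (+-mono-≤ (W-untyped u ¬p) (≤-reflexive (*-identityʳ (T ^ ℓ)))) (≤-reflexive (lemma (T ^ ℓ)))

      -- As every transversal is rich, `W` is on average at least `(1 - ℓ / Q) T ^ ℓ`, while it
      -- never exceeds `T ^ ℓ` and stays below by an eighth at untyped vertices.
      untyped-few : ∀ Q → (∀ f → Q * n ≤ Q * codegrees (sel B f) + ℓ * n) → Q * # (fins n) (λ u → ¬? (typed? u)) ≤ 8 * ℓ * n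
      untyped-few Q rich = *-cancelˡ-≤ (T ^ ℓ) {{>-nonZero 0<X}} (+-cancelˡ-≤ (8 * (X * (Q * n))) _ _ (begin
        8 * (X * (Q * n)) + X * (Q * U)  ≤⟨ +-monoˡ-≤ (X * (Q * U)) (*-monoʳ-≤ 8 rich-sum) ⟩
        8 * (Q * ∑ (fins n) W + X * (ℓ * n)) + X * (Q * U)  ≡⟨ l₁ Q (∑ (fins n) W) X (ℓ * n) U ⟩
        Q * (8 * ∑ (fins n) W + X * U) + X * (8 * (ℓ * n))  ≤⟨ +-monoˡ-≤ _ (*-monoʳ-≤ Q W-sum) ⟩
        Q * (n * (8 * X)) + X * (8 * (ℓ * n))  ≡⟨ l₂ Q n X ℓ ⟩
        8 * (X * (Q * n)) + X * (8 * ℓ * n)  ∎))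
        where
        open ≤-Reasoning
        X = T ^ ℓ
        U = # (fins n) (λ u → ¬? (typed? u))
        0<τ : 0 < τ
        0<τ = ≤-trans 0<P P≤τ
        0<X : 0 < X
        0<X = m^n>0 T {{>-nonZero (≤-trans 0<τ (≤-trans (m≤m+n τ _) (≤-reflexive (sym T≡))))}} ℓ
        l₁ : ∀ Q w X y U → 8 * (Q * w + X * y) + X * (Q * U) ≡ Q * (8 * w + X * U) + X * (8 * y)
        l₁ = solve-∀
        l₂ : ∀ Q n X l → Q * (n * (8 * X)) + X * (8 * (l * n)) ≡ 8 * (X * (Q * n)) + X * (8 * l * n)
        l₂ = solve-∀
        rich-sum : X * (Q * n) ≤ Q * ∑ (fins n) W + X * (ℓ * n)
        rich-sum = begin
          X * (Q * n)  ≡⟨ sym (∑-vecs-const T ℓ (Q * n)) ⟩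
          ∑ (vecs T ℓ) (λ _ → Q * n)  ≤⟨ ∑-mono (vecs T ℓ) rich ⟩
          ∑ (vecs T ℓ) (λ f → Q * codegrees (sel B f) + ℓ * n)  ≡⟨ trans (∑-+ (vecs T ℓ) _ _) (cong₂ _+_ (∑-*ˡ (vecs T ℓ) Q _) (∑-vecs-const T ℓ (ℓ * n))) ⟩
          Q * ∑ (vecs T ℓ) (λ f → codegrees (sel B f)) + X * (ℓ * n)  ≡⟨ cong (λ z → Q * z + X * (ℓ * n)) ∑-codegrees-W ⟩
          Q * ∑ (fins n) W + X * (ℓ * n)  ∎
        W-sum : 8 * ∑ (fins n) W + X * U ≤ n * (8 * X)
        W-sum = begin
          8 * ∑ (fins n) W + X * U  ≡⟨ sym (trans (∑-+ (fins n) _ _) (cong₂ _+_ (∑-*ˡ (fins n) 8 W) (∑-*ˡ (fins n) X _))) ⟩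
          ∑ (fins n) (λ u → 8 * W u + X * 𝟙 (¬? (typed? u)))  ≤⟨ ∑-mono (fins n) W-bound ⟩
          ∑ (fins n) (λ _ → 8 * X)  ≡⟨ ∑-fins-const n (8 * X) ⟩
          n * (8 * X)  ∎

    -- From types to classes by comparing degrees.

    module Structure (ty : Fin n → Maybe (Fin ℓ)) (cores : HasCores (λ i x → ty x ≡ just i)) (r′≤ℓ₀ : r′ ≤ ℓ₀)
      (q : ℕ) (n-lo : ℓ * q < n) (n-hi : n ≤ ℓ * q + ℓ) (J₁ J₂ : ℕ)
      (deg≥ : ∀ u → σ (3 + r′) (λ (_ : Fin ℓ′) → q) ≤ # (sets n) (λ S → u ∈? S ×-dec G? S)) where

      private
        κ = 3 + r′
        N₁ = n ^ (1 + r′)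
        N₂ = n ^ (2 + r′)

      dG : Fin n → ℕ
      dG u = # (sets n) (λ S → u ∈? S ×-dec G? S)

      U : ℕ
      U = # (fins n) (λ x → ty x ≟ᵐ nothing)

      a : Fin n → Fin ℓ → ℕ
      a u j = # (fins n) (λ x → ty x ≟ᵐ just j ×-dec heavy? u x)

      light≤ : ∀ {u z} → u ≢ z → ¬ Heavy u z → codeg u z ≤ Cap * N₁
      light≤ u≢z ¬h = ≮⇒≥ λ lt → ¬h (u≢z , lt)

      through : ∀ (u : Fin n) {Z : Fin n → Set} (Z? : Decidable Z) →
        # (sets n) (λ S → any? (λ z → (¬? (u ≟ᶠ z) ×-dec Z? z) ×-dec (u ∈? S ×-dec (z ∈? S ×-dec G? S)))) ≤ # (fins n) Z? * N₂
      through u {Z} Z? = begin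
        _ ≤⟨ #-⋃ (sets n) (fins n) _ (λ z S → (¬? (u ≟ᶠ z) ×-dec Z? z) ×-dec (u ∈? S ×-dec (z ∈? S ×-dec G? S))) (λ S (z , p) → z , ∈-fins z , p) ⟩
        ∑ (fins n) (λ z → # (sets n) (λ S → (¬? (u ≟ᶠ z) ×-dec Z? z) ×-dec (u ∈? S ×-dec (z ∈? S ×-dec G? S)))) ≤⟨ ∑-mono (fins n) (λ z → each z (¬? (u ≟ᶠ z) ×-dec Z? z)) ⟩
        ∑ (fins n) (λ z → 𝟙 (Z? z) * N₂) ≡⟨ ∑-*ʳ (fins n) N₂ (λ z → 𝟙 (Z? z)) ⟩
        # (fins n) Z? * N₂ ∎
        where
        open ≤-Reasoning
        each : ∀ z (d : Dec (u ≢ z × Z z)) → # (sets n) (λ S → d ×-dec (u ∈? S ×-dec (z ∈? S ×-dec G? S))) ≤ 𝟙 (Z? z) * N₂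
        each z (no ¬p) = ≤-trans (≤-reflexive (trans (∑-cong (sets n) λ S → 𝟙-no (no ¬p ×-dec (u ∈? S ×-dec (z ∈? S ×-dec G? S))) (¬p ∘ proj₁)) (∑-zero (sets n)))) z≤n
        each z (yes (u≢z , p)) = ≤-trans (≤-trans (#-mono (sets n) (λ S → yes (u≢z , p) ×-dec (u ∈? S ×-dec (z ∈? S ×-dec G? S)))
            (λ S → u ∈? S ×-dec (has? r S ×-dec z ∈? S)) (λ S (_ , u∈ , z∈ , g) → u∈ , G-size g , z∈)) (#-∋∋ (2 + r′) u≢z))
          (≤-reflexive (trans (sym (*-identityˡ N₂)) (cong (_* N₂) (sym (𝟙-yes (Z? z) p)))))

      light-through : ∀ (u : Fin n) →
        # (sets n) (λ S → any? (λ z → (¬? (u ≟ᶠ z) ×-dec ¬? (heavy? u z)) ×-dec (u ∈? S ×-dec (z ∈? S ×-dec G? S)))) ≤ n * (Cap * N₁)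
      light-through u = begin
        _ ≤⟨ #-⋃ (sets n) (fins n) _ (λ z S → (¬? (u ≟ᶠ z) ×-dec ¬? (heavy? u z)) ×-dec (u ∈? S ×-dec (z ∈? S ×-dec G? S))) (λ S (z , p) → z , ∈-fins z , p) ⟩
        ∑ (fins n) (λ z → # (sets n) (λ S → (¬? (u ≟ᶠ z) ×-dec ¬? (heavy? u z)) ×-dec (u ∈? S ×-dec (z ∈? S ×-dec G? S)))) ≤⟨ ∑-mono (fins n) (λ z → each z (¬? (u ≟ᶠ z) ×-dec ¬? (heavy? u z))) ⟩
        ∑ (fins n) (λ _ → Cap * N₁) ≡⟨ ∑-fins-const n (Cap * N₁) ⟩
        n * (Cap * N₁) ∎
        where
        open ≤-Reasoning
        each : ∀ z (d : Dec (u ≢ z × ¬ Heavy u z)) → # (sets n) (λ S → d ×-dec (u ∈? S ×-dec (z ∈? S ×-dec G? S))) ≤ Cap * N₁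
        each z (no ¬p) = ≤-trans (≤-reflexive (trans (∑-cong (sets n) λ S → 𝟙-no (no ¬p ×-dec (u ∈? S ×-dec (z ∈? S ×-dec G? S))) (¬p ∘ proj₁)) (∑-zero (sets n)))) z≤n
        each z (yes (u≢z , ¬h)) = ≤-trans (#-mono (sets n) (λ S → yes (u≢z , ¬h) ×-dec (u ∈? S ×-dec (z ∈? S ×-dec G? S))) (λ S → u ∈? S ×-dec (z ∈? S ×-dec G? S)) (λ S → proj₂)) (light≤ u≢z ¬h)

      Clash : Subset n → Set
      Clash S = ∃ λ z → ∃ λ z′ → z ∈ S × z′ ∈ S × z ≢ z′ × ty z ≡ ty z′ × ty z ≢ nothing

      clash? : ∀ S → Dec (Clash S)
      clash? S = any? λ z → any? λ z′ → z ∈? S ×-dec (z′ ∈? S ×-dec (¬? (z ≟ᶠ z′) ×-dec (ty z ≟ᵐ ty z′ ×-dec ¬? (ty z ≟ᵐ nothing))))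

      just! : ∀ z → ty z ≢ nothing → ∃ λ i → ty z ≡ just i
      just! z p with ty z
      ... | just i  = i , refl
      ... | nothing = contradiction refl p

      -- By `same-colour` all clashing sets have one colour, and members of `G` are determined by
      -- their colours.
      clashes≤1 : # (sets n) (λ S → clash? S ×-dec G? S) ≤ 1
      clashes≤1 = #-sets≤1 (λ S → clash? S ×-dec G? S) λ S S′ (c , g) (c′ , g′) → G-inj g g′ (one S S′ g g′ c c′)
        where
        one : ∀ S S′ → G S → G S′ → Clash S → Clash S′ → χ S ≡ χ S′
        one S S′ g g′ (z , w , z∈ , w∈ , z≢w , e , nn) (z′ , w′ , z∈′ , w∈′ , z≢w′ , e′ , nn′) =
          let i , p = just! z nn ; i′ , p′ = just! z′ nn′ in
          same-colour cores (G-size g) (G-size g′) p (trans (sym e) p) z≢w z∈ w∈ p′ (trans (sym e′) p′) z≢w′ z∈′ w∈′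

      module _ (u : Fin n) (i : Fin ℓ) where

        -- The types on the heavy neighbourhood of `u` outside type `i`; the generic edges at `u`
        -- are the crossing sets of these classes with `u` added.
        cls : Fin n → Maybe (Fin ℓ)
        cls x with heavy? u x
        ... | yes _ = del i ty x
        ... | no _  = nothing

        cls-heavy : ∀ x → Heavy u x → cls x ≡ del i ty x
        cls-heavy x h with heavy? u x
        ... | yes _ = refl
        ... | no ¬h = contradiction h ¬h

        cls-just : ∀ x {j} → cls x ≡ just j → Heavy u x × ty x ≡ just j × j ≢ i
        cls-just x e with heavy? u x
        ... | yes h = h , del-just i ty x e

        size-i : size cls i ≡ 0
        size-i = trans (∑-cong (fins n) λ x → 𝟙-no (cls x ≟ᵐ just i) λ e → proj₂ (proj₂ (cls-just x e)) refl) (∑-zero (fins n))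

        size-j : ∀ j → j ≢ i → size cls j ≡ a u j
        size-j j j≢i = #-cong (fins n) (λ x → cls x ≟ᵐ just j) (λ x → ty x ≟ᵐ just j ×-dec heavy? u x)
          (λ x e → let h , t , _ = cls-just x e in t , h)
          (λ x (t , h) → trans (cls-heavy x h) (trans (del-≡ i ty x (λ t′ → j≢i (Maybe.just-injective (trans (sym t) t′)))) t))

        Bad₁? = λ S → any? (λ z → (¬? (u ≟ᶠ z) ×-dec ¬? (heavy? u z)) ×-dec (u ∈? S ×-dec (z ∈? S ×-dec G? S)))
        Bad₂? = λ S → any? (λ z → (¬? (u ≟ᶠ z) ×-dec (ty z ≟ᵐ nothing)) ×-dec (u ∈? S ×-dec (z ∈? S ×-dec G? S)))
        Bad₃? = λ S → any? (λ z → (¬? (u ≟ᶠ z) ×-dec (ty z ≟ᵐ just i ×-dec heavy? u z)) ×-dec (u ∈? S ×-dec (z ∈? S ×-dec G? S)))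
        Bad₄? = λ S → clash? S ×-dec G? S
        Good : Subset n → Set
        Good S = G S × (∀ z → z ∈ S → u ≢ z → Heavy u z × ∃ λ j → ty z ≡ just j × j ≢ i) × ¬ Clash S
        good? : Decidable Good
        good? S = G? S ×-dec (all? (λ z → z ∈? S →-dec (¬? (u ≟ᶠ z) →-dec (heavy? u z ×-dec any? λ j → ty z ≟ᵐ just j ×-dec ¬? (j ≟ᶠ i)))) ×-dec ¬? (clash? S))

        good≤σ : # (sets n) (λ S → u ∈? S ×-dec (has? r S ×-dec good? S)) ≤ σ κ (a u ∘ punchIn i)
        good≤σ = ≤-trans (∋⁻ κ u good? (cross? cls) cross) (≤-reflexive (trans (#-cross κ cls) (σ-del κ i size-i size-j)))
          where
          cross : ∀ S → u ∉ S → Good (add u S) → Cross cls S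
          cross S u∉ (g , ok , ¬c) = defined , injective
            where
            facts : ∀ z → z ∈ S → Heavy u z × ∃ λ j → ty z ≡ just j × j ≢ i
            facts z z∈ = ok z (⊆add u S z∈) λ { refl → u∉ z∈ }
            cls≡ty : ∀ z → z ∈ S → cls z ≡ ty z
            cls≡ty z z∈ = let h , j , t , j≢i = facts z z∈ in trans (cls-heavy z h) (del-≡ i ty z λ t′ → j≢i (Maybe.just-injective (trans (sym t) t′)))
            ty≢ : ∀ z → z ∈ S → ty z ≢ nothing
            ty≢ z z∈ e = let _ , j , t , _ = facts z z∈ in contradiction (trans (sym t) e) λ ()
            defined : ∀ z → z ∈ S → cls z ≢ nothing
            defined z z∈ e = ty≢ z z∈ (trans (sym (cls≡ty z z∈)) e)
            injective : ∀ z z′ → z ∈ S → z′ ∈ S → cls z ≡ cls z′ → z ≡ z′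
            injective z z′ z∈ z′∈ e = decidable-stable (z ≟ᶠ z′) λ z≢z′ →
              ¬c (z , z′ , ⊆add u S z∈ , ⊆add u S z′∈ , z≢z′ , trans (sym (cls≡ty z z∈)) (trans e (cls≡ty z′ z′∈)) , ty≢ z z∈)

        -- Sorts the edges at `u` by whether they contain a light partner of `u`, an untyped vertex,
        -- a heavy neighbour of type `i`, or two vertices of one type. The rest correspond to
        -- crossing sets in the neighbourhood.
        degree-split : dG u ≤ n * (Cap * N₁) + (U * N₂ + (a u i * N₂ + (1 + σ κ (a u ∘ punchIn i))))
        degree-split = ≤-trans (#-⊎ (sets n) (λ S → u ∈? S ×-dec G? S) Bad₁? R₁? (λ S p → split p (Bad₁? S))) (+-mono-≤ (light-through u)
          (≤-trans (#-⊎ (sets n) R₁? Bad₂? R₂? (λ S p → split p (Bad₂? S))) (+-mono-≤ (through u (λ z → ty z ≟ᵐ nothing))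
          (≤-trans (#-⊎ (sets n) R₂? Bad₃? R₃? (λ S p → split p (Bad₃? S))) (+-mono-≤ (through u (λ z → ty z ≟ᵐ just i ×-dec heavy? u z))
          (≤-trans (#-⊎ (sets n) R₃? Bad₄? (λ S → u ∈? S ×-dec (has? r S ×-dec good? S)) (λ S p → split₄ S p (Bad₄? S))) (+-mono-≤ clashes≤1 good≤σ)))))))
          where
          R₁? = λ S → (u ∈? S ×-dec G? S) ×-dec ¬? (Bad₁? S)
          R₂? = λ S → R₁? S ×-dec ¬? (Bad₂? S)
          R₃? = λ S → R₂? S ×-dec ¬? (Bad₃? S)
          split : ∀ {A B : Set} → A → Dec B → B ⊎ (A × ¬ B)
          split p (yes b) = inj₁ b
          split p (no ¬b) = inj₂ (p , ¬b)
          split₄ : ∀ S → _ → Dec (Clash S × G S) → (Clash S × G S) ⊎ (u ∈ S × ∣ S ∣ ≡ r × Good S)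
          split₄ S _ (yes b) = inj₁ b
          split₄ S ((((u∈ , g) , ¬b₁) , ¬b₂) , ¬b₃) (no ¬b₄) = inj₂ (u∈ , G-size g , g , ok , λ c → ¬b₄ (c , g))
            where
            ok : ∀ z → z ∈ S → u ≢ z → Heavy u z × ∃ λ j → ty z ≡ just j × j ≢ i
            ok z z∈ u≢z = h , j , tz , λ j≡i → ¬b₃ (z , (u≢z , trans tz (cong just j≡i) , h) , u∈ , z∈ , g)
              where
              h : Heavy u z
              h = decidable-stable (heavy? u z) λ ¬h → ¬b₁ (z , (u≢z , ¬h) , u∈ , z∈ , g)
              jt = just! z (λ e → ¬b₂ (z , (u≢z , e) , u∈ , z∈ , g))
              j = proj₁ jt
              tz = proj₂ jt

        private
          msum = ∑ (fins ℓ′) (a u ∘ punchIn i)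

        -- If the neighbourhood of u inside class i is small, then the neighbourhood in the other classes
        -- is almost as large as in the Turán graph, since only crossing sets contribute to the degree of u.
        neighbourhood-large : ∀ J′ → suc J′ ^ κ * (Cap + 1 + U + a u i) < n → ℓ′ * q ≤ msum + ℓ′ * (n / suc J′ + 2)
        neighbourhood-large J′ small = begin
          -- `p` exceeds the average neighbourhood in a class and `z` is about `n / J`. If
          -- `p + z ≤ q`, superadditivity of the power leaves `z ^ κ` below the error terms of order
          -- `n ^ (r ∸ 2)`, whence `n ≤ J ^ κ * (Cap + 1 + U + a u i)`.
          ℓ′ * q  ≤⟨ *-monoʳ-≤ ℓ′ (<⇒≤ (≰⇒> λ p+z≤q → <⇒≱ small (too-large p+z≤q))) ⟩
          ℓ′ * (p + z)  ≡⟨ l₀ ℓ′ (msum / ℓ′) (n / J) ⟩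
          msum / ℓ′ * ℓ′ + ℓ′ * (n / J + 2)  ≤⟨ +-monoˡ-≤ _ (m/n*n≤m msum ℓ′) ⟩
          msum + ℓ′ * (n / J + 2)  ∎
          where
          open ≤-Reasoning
          J = suc J′
          p = suc (msum / ℓ′)
          z = suc (n / J)
          E₀ = σ κ (λ (_ : Fin ℓ′) → 1)
          l₀ : ∀ l x y → l * (suc x + suc y) ≡ x * l + l * (y + 2)
          l₀ = solve-∀
          0<n : 0 < n
          0<n = ≤-trans (s≤s z≤n) small
          degree : E₀ * q ^ κ ≤ n * (Cap * N₁) + (U * N₂ + (a u i * N₂ + (1 + E₀ * p ^ κ)))
          degree = begin
            E₀ * q ^ κ  ≡⟨ sym (σ-scale ℓ′ κ q) ⟩
            σ κ (λ (_ : Fin ℓ′) → q)  ≤⟨ deg≥ u ⟩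
            dG u  ≤⟨ degree-split ⟩
            _  ≤⟨ +-monoʳ-≤ (n * (Cap * N₁)) (+-monoʳ-≤ (U * N₂) (+-monoʳ-≤ (a u i * N₂) (s≤s (≤-trans
                                                       (σ-balanced κ {a u ∘ punchIn i} {λ _ → p} (λ _ _ → n≤1+n p) (≤-trans (n≤J*⌈n/J⌉ msum (2 + ℓ₀)) (≤-reflexive (sym (∑-fins-const ℓ′ p))))) (≤-reflexive (σ-scale ℓ′ κ p)))))) ⟩
            n * (Cap * N₁) + (U * N₂ + (a u i * N₂ + (1 + E₀ * p ^ κ))) ∎
          too-large : p + z ≤ q → n ≤ J ^ κ * (Cap + 1 + U + a u i)
          too-large p+z≤q = *-cancelʳ-≤ n _ N₂ {{>-nonZero (m^n>0 n {{>-nonZero 0<n}} (2 + r′))}} (begin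
            n ^ κ  ≤⟨ ^-monoˡ-≤ κ (n≤J*⌈n/J⌉ n J′) ⟩
            (J * z) ^ κ  ≡⟨ *-^ κ J z ⟩
            J ^ κ * z ^ κ  ≤⟨ *-monoʳ-≤ (J ^ κ) zk ⟩
            J ^ κ * ((Cap + 1 + U + a u i) * N₂)  ≡⟨ sym (*-assoc (J ^ κ) _ N₂) ⟩
            J ^ κ * (Cap + 1 + U + a u i) * N₂  ∎)
            where
            zk : z ^ κ ≤ (Cap + 1 + U + a u i) * N₂
            zk = +-cancelˡ-≤ (E₀ * p ^ κ) _ _ (begin
              E₀ * p ^ κ + z ^ κ  ≤⟨ +-monoʳ-≤ (E₀ * p ^ κ) (m≤n*m (z ^ κ) E₀ {{>-nonZero (σ-ones-pos ℓ′ κ (+-monoʳ-≤ 3 r′≤ℓ₀))}}) ⟩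
              E₀ * p ^ κ + E₀ * z ^ κ  ≡⟨ sym (*-distribˡ-+ E₀ (p ^ κ) (z ^ κ)) ⟩
              E₀ * (p ^ κ + z ^ κ)  ≤⟨ *-monoʳ-≤ E₀ (≤-trans (^-superadditive p z (2 + r′)) (^-monoˡ-≤ κ p+z≤q)) ⟩
              E₀ * q ^ κ  ≤⟨ degree ⟩
              n * (Cap * N₁) + (U * N₂ + (a u i * N₂ + (1 + E₀ * p ^ κ)))  ≡⟨ l₁ n Cap N₁ U N₂ (a u i) (E₀ * p ^ κ) ⟩
              E₀ * p ^ κ + (Cap * (n * N₁) + (U * N₂ + (a u i * N₂ + 1)))  ≤⟨ +-monoʳ-≤ (E₀ * p ^ κ) (+-monoʳ-≤ (Cap * N₂) (+-monoʳ-≤ (U * N₂) (+-monoʳ-≤ (a u i * N₂) (m^n>0 n {{>-nonZero 0<n}} (2 + r′))))) ⟩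
              E₀ * p ^ κ + (Cap * N₂ + (U * N₂ + (a u i * N₂ + N₂)))  ≡⟨ cong (E₀ * p ^ κ +_) (l₂ Cap U (a u i) N₂) ⟩
              E₀ * p ^ κ + (Cap + 1 + U + a u i) * N₂ ∎)
              where
              l₁ : ∀ n C x U y A w → n * (C * x) + (U * y + (A * y + (1 + w))) ≡ w + (C * (n * x) + (U * y + (A * y + 1)))
              l₁ = solve-∀
              l₂ : ∀ C U A y → C * y + (U * y + (A * y + y)) ≡ (C + 1 + U + A) * y
              l₂ = solve-∀

      -- `s₁` and `s₂` are the average deficits per class in the neighbourhoods of typed and of
      -- arbitrary vertices, `y₁` and `y₂` bound the vertices they miss in a class other than their
      -- own, and `θ` heavy neighbours in every class would let a core be found inside the
      -- neighbourhood.
      s₁ s₂ y₁ y₂ θ : ℕ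
      s₁ = n / suc J₁ + 2
      s₂ = n / suc J₂ + 2
      y₁ = ℓ′ * (ℓ + ℓ′ * s₁ + s₁)
      y₂ = ℓ′ * (ℓ + ℓ′ * s₁ + s₂)
      θ  = suc P + ℓ * (suc P * y₁)

      vsz : Fin ℓ → ℕ
      vsz j = # (fins n) (λ x → ty x ≟ᵐ just j)

      miss : Fin n → Fin ℓ → ℕ
      miss u j = # (fins n) (λ x → ty x ≟ᵐ just j ×-dec ¬? (heavy? u x))

      vsz-split : ∀ u j → vsz j ≡ a u j + miss u j
      vsz-split u j = #-split (fins n) (λ x → ty x ≟ᵐ just j) (heavy? u)

      vsz-total : ∑ (fins ℓ) vsz + U ≡ n
      vsz-total = trans (cong (_+ U) (∑-swap (fins ℓ) (fins n) _)) (trans (sym (∑-+ (fins n) _ _))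
        (trans (∑-cong (fins n) λ x → one (ty x)) (trans (∑-fins-const n 1) (*-identityʳ n))))
        where
        one : ∀ (c : Maybe (Fin ℓ)) → ∑ (fins ℓ) (λ j → 𝟙 (c ≟ᵐ just j)) + 𝟙 (c ≟ᵐ nothing) ≡ 1
        one nothing  = cong₂ _+_ (trans (∑-cong (fins ℓ) λ j → 𝟙-no (nothing ≟ᵐ just j) λ ()) (∑-zero (fins ℓ))) refl
        one (just i) = trans (cong₂ _+_ (trans (∑-at (λ j → 𝟙 (just i ≟ᵐ just j)) i) (cong₂ _+_ (𝟙-yes (just i ≟ᵐ just i) refl)
          (trans (∑-cong (fins ℓ′) λ j → 𝟙-no (just i ≟ᵐ just (punchIn i j)) λ e → punchInᵢ≢i i j (sym (Maybe.just-injective e))) (∑-zero (fins ℓ′))))) (𝟙-no (just i ≟ᵐ nothing) λ ())) refl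

      vsz-at : ∀ i → vsz i + ∑ (fins ℓ′) (vsz ∘ punchIn i) + U ≡ n
      vsz-at i = trans (cong (_+ U) (sym (∑-at vsz i))) vsz-total

      a-zero : ∀ {u i} → ty u ≡ just i → a u i ≡ 0
      a-zero {u} {i} e = trans (∑-cong (fins n) λ x → 𝟙-no (ty x ≟ᵐ just i ×-dec heavy? u x) λ (e′ , h) → independent cores e e′ h) (∑-zero (fins n))

      a≤vsz : ∀ u j → a u j ≤ vsz j
      a≤vsz u j = ≤-trans (m≤m+n _ _) (≤-reflexive (sym (vsz-split u j)))

      module _ (large₁ : suc J₁ ^ κ * (Cap + 1 + U) < n) where

        typed-large : ∀ {u i} → ty u ≡ just i → ℓ′ * q ≤ ∑ (fins ℓ′) (a u ∘ punchIn i) + ℓ′ * s₁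
        typed-large {u} {i} e = neighbourhood-large u i J₁ (subst (λ z → suc J₁ ^ κ * (Cap + 1 + U + z) < n) (sym (a-zero e))
          (subst (λ z → suc J₁ ^ κ * z < n) (sym (+-identityʳ (Cap + 1 + U))) large₁))

        -- A vertex of type `i` has almost `ℓ′ * q` neighbours in the other classes, which leaves
        -- only about `q` vertices for class `i`.
        vsz≤ : ∀ i → vsz i ≤ q + ℓ + ℓ′ * s₁
        vsz≤ i = split (0 <? vsz i)
          where
          open ≤-Reasoning
          split : Dec (0 < vsz i) → vsz i ≤ q + ℓ + ℓ′ * s₁
          split (no p)  = ≤-trans (≮⇒≥ p) z≤n
          split (yes p) = bound (#-∃ (fins n) (λ x → ty x ≟ᵐ just i) p)
            where
            l₁ : ∀ l q s → l * q + q + suc l + l * s ≡ l * q + (q + suc l + l * s)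
            l₁ = solve-∀
            bound : (∃ λ u → ty u ≡ just i) → vsz i ≤ q + ℓ + ℓ′ * s₁
            bound (u , e) = +-cancelˡ-≤ (ℓ′ * q) _ _ (begin
              ℓ′ * q + vsz i  ≤⟨ +-monoˡ-≤ (vsz i) (typed-large e) ⟩
              ∑ (fins ℓ′) (a u ∘ punchIn i) + ℓ′ * s₁ + vsz i  ≤⟨ +-monoˡ-≤ (vsz i) (+-monoˡ-≤ (ℓ′ * s₁) (∑-mono (fins ℓ′) λ j → a≤vsz u (punchIn i j))) ⟩
              ∑ (fins ℓ′) (vsz ∘ punchIn i) + ℓ′ * s₁ + vsz i  ≡⟨ l₀ (∑ (fins ℓ′) (vsz ∘ punchIn i)) (ℓ′ * s₁) (vsz i) ⟩
              vsz i + ∑ (fins ℓ′) (vsz ∘ punchIn i) + ℓ′ * s₁  ≤⟨ +-monoˡ-≤ (ℓ′ * s₁) (≤-trans (m≤m+n _ U) (≤-reflexive (vsz-at i))) ⟩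
              n + ℓ′ * s₁  ≤⟨ +-monoˡ-≤ (ℓ′ * s₁) n-hi ⟩
              ℓ * q + ℓ + ℓ′ * s₁  ≡⟨ cong (λ z → z + ℓ + ℓ′ * s₁) (+-comm q (ℓ′ * q)) ⟩
              ℓ′ * q + q + ℓ + ℓ′ * s₁  ≡⟨ l₁ ℓ′ q s₁ ⟩
              ℓ′ * q + (q + ℓ + ℓ′ * s₁)  ∎)
              where
              l₀ : ∀ x y z → x + y + z ≡ z + x + y
              l₀ = solve-∀

        others≤ : ∀ i → ∑ (fins ℓ′) (vsz ∘ punchIn i) ≤ ℓ′ * (q + ℓ + ℓ′ * s₁)
        others≤ i = ≤-trans (∑-mono (fins ℓ′) λ j → vsz≤ (punchIn i j)) (≤-reflexive (∑-fins-const ℓ′ (q + ℓ + ℓ′ * s₁)))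

        -- By `vsz≤` the other classes are not much larger than `q`, so a neighbourhood of almost
        -- `ℓ′ * q` vertices misses little of any of them.
        miss≤ : ∀ u i s → ℓ′ * q ≤ ∑ (fins ℓ′) (a u ∘ punchIn i) + ℓ′ * s → ∀ j → j ≢ i → miss u j ≤ ℓ′ * (ℓ + ℓ′ * s₁ + s)
        miss≤ u i s large j j≢i = ≤-trans (≤-trans (≤-reflexive (cong (miss u) (sym (punchIn-punchOut (j≢i ∘ sym)))))
            (≤∑ (miss u ∘ punchIn i) (∈-fins (punchOut (j≢i ∘ sym))))) (+-cancelˡ-≤ Cand _ _ (begin
          Cand + M  ≡⟨ trans (sym (∑-+ (fins ℓ′) (a u ∘ punchIn i) (miss u ∘ punchIn i))) (∑-cong (fins ℓ′) λ j → sym (vsz-split u (punchIn i j))) ⟩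
          ∑ (fins ℓ′) (vsz ∘ punchIn i)  ≤⟨ others≤ i ⟩
          ℓ′ * (q + ℓ + ℓ′ * s₁)  ≡⟨ l₀ ℓ′ q ℓ (ℓ′ * s₁) ⟩
          ℓ′ * q + ℓ′ * (ℓ + ℓ′ * s₁)  ≤⟨ +-monoˡ-≤ _ large ⟩
          Cand + ℓ′ * s + ℓ′ * (ℓ + ℓ′ * s₁)  ≡⟨ l₁ Cand ℓ′ s (ℓ + ℓ′ * s₁) ⟩
          Cand + ℓ′ * (ℓ + ℓ′ * s₁ + s)  ∎))
          where
          open ≤-Reasoning
          Cand = ∑ (fins ℓ′) (a u ∘ punchIn i)
          M = ∑ (fins ℓ′) (miss u ∘ punchIn i)
          l₀ : ∀ l q x y → l * (q + x + y) ≡ l * q + l * (x + y)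
          l₀ = solve-∀
          l₁ : ∀ Cand l s x → Cand + l * s + l * x ≡ Cand + l * (x + s)
          l₁ = solve-∀

        typed-miss : ∀ {u i} → ty u ≡ just i → ∀ j → j ≢ i → miss u j ≤ y₁
        typed-miss {u} {i} e = miss≤ u i s₁ (typed-large e)

        vsz≥ : ∀ i → q ≤ vsz i + (U + ℓ′ * (ℓ + ℓ′ * s₁))
        vsz≥ i = +-cancelˡ-≤ (ℓ′ * q) _ _ (begin
          ℓ′ * q + q  ≡⟨ +-comm (ℓ′ * q) q ⟩
          ℓ * q  ≤⟨ <⇒≤ n-lo ⟩
          n  ≡⟨ sym (vsz-at i) ⟩
          vsz i + ∑ (fins ℓ′) (vsz ∘ punchIn i) + U  ≤⟨ +-monoˡ-≤ U (+-monoʳ-≤ (vsz i) (others≤ i)) ⟩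
          vsz i + ℓ′ * (q + ℓ + ℓ′ * s₁) + U  ≡⟨ l₀ (vsz i) ℓ′ q ℓ (ℓ′ * s₁) U ⟩
          ℓ′ * q + (vsz i + (U + ℓ′ * (ℓ + ℓ′ * s₁)))  ∎)
          where
          open ≤-Reasoning
          l₀ : ∀ v l q x y U → v + l * (q + x + y) + U ≡ l * q + (v + (U + l * (x + y)))
          l₀ = solve-∀

        Chosen : ∀ {c} (m : ℕ) → (Fin c → Fin n → Set) → Set
        Chosen {c} m Cand = ∃ λ (C : Fin c → Fin m → Fin n) → (∀ j a → Cand j (C j a)) × (∀ j {a b} → C j a ≡ C j b → a ≡ b) ×
          (∀ j j′ a b → j ≢ j′ → Heavy (C j a) (C j′ b))

        -- The blocks are chosen class by class; a chosen block of `m` typed vertices rules out at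
        -- most `m * y₁` candidates in each later class.
        choose-core : ∀ m c (cl : Fin c → Fin ℓ) → (∀ {i j} → cl i ≡ cl j → i ≡ j) → {Cand : Fin c → Fin n → Set} (A? : ∀ j → Decidable (Cand j)) →
          (∀ j {x} → Cand j x → ty x ≡ just (cl j)) → (∀ j → m + c * (m * y₁) ≤ # (fins n) (A? j)) → Chosen m Cand
        choose-core m zero cl cl-inj A? A⊆ big = (λ ()) , (λ ()) , (λ ()) , λ ()
        choose-core m (suc c) cl cl-inj {Cand} A? A⊆ big = rest (#-choose (fins-unique n) (A? zero) (≤-trans (m≤m+n m _) (big zero)))
          where
          rest : (∃ λ (f : Fin m → Fin n) → Injective _≡_ _≡_ f × (∀ b → Cand zero (f b))) → Chosen m Cand
          rest (f , f-inj , f∈) = extended (choose-core m c (cl ∘ suc) (sucᶠ-injective ∘ cl-inj) A′? (λ j p → A⊆ (suc j) (proj₁ p)) big′)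
            where
            A′ : Fin c → Fin n → Set
            A′ j x = Cand (suc j) x × (∀ b → Heavy (f b) x)
            A′? : ∀ j → Decidable (A′ j)
            A′? j x = A? (suc j) x ×-dec all? (λ b → heavy? (f b) x)
            missed? : ∀ j b x → Dec (ty x ≡ just (cl (suc j)) × ¬ Heavy (f b) x)
            missed? j b x = ty x ≟ᵐ just (cl (suc j)) ×-dec ¬? (heavy? (f b) x)
            lost : ∀ j → # (fins n) (A? (suc j)) ≤ # (fins n) (A′? j) + m * y₁
            lost j = ≤-trans (#-⊎ (fins n) (A? (suc j)) (A′? j) (λ x → any? λ b → missed? j b x) cover)
              (+-monoʳ-≤ _ (≤-trans (#-⋃ (fins n) (fins m) (λ x → any? λ b → missed? j b x) (missed? j) λ x (b , p) → b , ∈-fins b , p)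
                (≤-trans (∑-mono (fins m) λ b → typed-miss (A⊆ zero (f∈ b)) (cl (suc j)) λ e → contradiction (cl-inj e) λ ()) (≤-reflexive (∑-fins-const m y₁)))))
              where
              cover : ∀ x → Cand (suc j) x → A′ j x ⊎ ∃ λ b → ty x ≡ just (cl (suc j)) × ¬ Heavy (f b) x
              cover x p with any? (λ b → ¬? (heavy? (f b) x))
              ... | yes (b , ¬h) = inj₂ (b , A⊆ (suc j) p , ¬h)
              ... | no all-heavy = inj₁ (p , λ b → decidable-stable (heavy? (f b) x) λ ¬h → all-heavy (b , ¬h))
            big′ : ∀ j → m + c * (m * y₁) ≤ # (fins n) (A′? j)
            big′ j = +-cancelʳ-≤ (m * y₁) _ _ (≤-trans (≤-reflexive (l₀ m (m * y₁) c)) (≤-trans (big (suc j)) (lost j)))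
              where
              l₀ : ∀ m x c → m + c * x + x ≡ m + suc c * x
              l₀ = solve-∀
            extended : Chosen m A′ → Chosen m Cand
            extended (C , C∈ , C-inj , C-heavy) = C⁺ , C⁺∈ , C⁺-inj , C⁺-heavy
              where
              C⁺ : Fin (suc c) → Fin m → Fin n
              C⁺ zero    = f
              C⁺ (suc j) = C j
              C⁺∈ : ∀ j b → Cand j (C⁺ j b)
              C⁺∈ zero    b = f∈ b
              C⁺∈ (suc j) b = proj₁ (C∈ j b)
              C⁺-inj : ∀ j {x y} → C⁺ j x ≡ C⁺ j y → x ≡ y
              C⁺-inj zero    = f-inj
              C⁺-inj (suc j) = C-inj j
              C⁺-heavy : ∀ j j′ x y → j ≢ j′ → Heavy (C⁺ j x) (C⁺ j′ y)
              C⁺-heavy zero    zero     x y ne = contradiction refl ne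
              C⁺-heavy zero    (suc j′) x y ne = proj₂ (C∈ j′ y) x
              C⁺-heavy (suc j) zero     x y ne = Heavy-sym (proj₂ (C∈ j x) y)
              C⁺-heavy (suc j) (suc j′) x y ne = C-heavy j j′ x y (ne ∘ cong suc)

        -- A core with `suc P` vertices per block in the neighbourhood of `u` has one to spare,
        -- which forms with `u` a heavy pair joined to the rest, against `no-heavy-pair`.
        not-everywhere : ∀ u → ¬ (∀ i → θ ≤ a u i)
        not-everywhere u big = finish (choose-core (suc P) ℓ id id (λ j x → ty x ≟ᵐ just j ×-dec heavy? u x) (λ j → proj₁) big)
          where
          finish : Chosen (suc P) (λ j x → ty x ≡ just j × Heavy u x) → ⊥
          finish (C , C∈ , C-inj , C-heavy) = no-heavy-pair {D = λ j b → C j (suc b)}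
            (mkCore (λ j e → sucᶠ-injective (C-inj j e)) (λ j j′ b b′ → C-heavy j j′ _ _)) {i = zero} (proj₂ (C∈ zero zero))
            (λ j b _ → proj₂ (C∈ j (suc b))) (λ j b j≢ → C-heavy zero j zero (suc b) (j≢ ∘ sym))
            (λ j b e → proj₁ (proj₂ (C∈ j (suc b))) (sym e)) b∉
            where
            b∉ : ∀ j b → C j (suc b) ≢ C zero zero
            b∉ zero    b e = contradiction (C-inj zero e) λ ()
            b∉ (suc j) b e = proj₁ (C-heavy (suc j) zero (suc b) zero λ ()) e

        At : Fin ℓ → Fin n → Set
        At i u = ∀ j → j ≢ i → miss u j ≤ y₂

        module _ (large₂ : suc J₂ ^ κ * (Cap + 1 + U + θ) < n) where

          class-at : ∀ u → ∃ λ i → At i u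
          class-at u = find (any? λ i → a u i <? θ)
            where
            find : Dec (∃ λ i → a u i < θ) → ∃ λ i → At i u
            -- Few heavy neighbours of type `i` allow `neighbourhood-large`, now with the coarser
            -- constant `J₂`, since `θ` is itself of order `n / J₁`.
            find (yes (i , lt)) = i , miss≤ u i s₂ (neighbourhood-large u i J₂ (≤-<-trans (*-monoʳ-≤ (suc J₂ ^ κ) (+-monoʳ-≤ (Cap + 1 + U) (<⇒≤ lt))) large₂))
            find (no ¬p) = ⊥-elim (not-everywhere u λ i → ≮⇒≥ λ lt → ¬p (i , lt))

          module _ (large₃ : U + ℓ′ * (ℓ + ℓ′ * s₁) + (4 * y₂ + 2 * r) + (P + ℓ * (P * y₁)) ≤ q) where

            -- Each class keeps about `q` vertices after losing at most `y₂` to each of the four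
            -- vertices and `r` to each of the two sets; by `large₃` this is enough for
            -- `choose-core`.
            at-cores : HasCores At
            at-cores {i} {j} {x} {y} {x′} {y′} ax ay ax′ ay′ S S′ S≤ S′≤ = finish (choose-core P ℓ id id A₆? (λ c p → proj₁ (proj₁ (proj₁ (proj₁ (proj₁ (proj₁ p)))))) big)
              where
              ok : ∀ i x c z → Dec (c ≢ i → Heavy x z)
              ok i x c z = ¬? (c ≟ᶠ i) →-dec heavy? x z
              V? : ∀ c z → Dec (ty z ≡ just c)
              V? c z = ty z ≟ᵐ just c
              A₁? = λ c z → V? c z ×-dec ok i x c z
              A₂? = λ c z → A₁? c z ×-dec ok i y c z
              A₃? = λ c z → A₂? c z ×-dec ok j x′ c z
              A₄? = λ c z → A₃? c z ×-dec ok j y′ c z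
              A₅? = λ c z → A₄? c z ×-dec ¬? (z ∈? S)
              A₆? = λ c z → A₅? c z ×-dec ¬? (z ∈? S′)
              ok-lost : ∀ {i x} → At i x → ∀ c {Z : Fin n → Set} (Z? : Decidable Z) → (∀ {z} → Z z → ty z ≡ just c) → # (fins n) Z? ≤ # (fins n) (λ z → Z? z ×-dec ok i x c z) + y₂
              ok-lost {i} {x} at c Z? Z⊆ = split (c ≟ᶠ i)
                where
                split : Dec (c ≡ i) → # (fins n) Z? ≤ # (fins n) (λ z → Z? z ×-dec ok i x c z) + y₂
                split (yes c≡i) = ≤-trans (#-mono (fins n) Z? (λ z → Z? z ×-dec ok i x c z) λ z p → p , λ c≢i → contradiction c≡i c≢i) (m≤m+n _ y₂)
                split (no c≢i)  = ≤-trans (#-lost (fins n) Z? (ok i x c) (λ z → ty z ≟ᵐ just c ×-dec ¬? (heavy? x z)) λ z p ¬h → Z⊆ p , λ h → ¬h λ _ → h) (+-monoʳ-≤ _ (at c c≢i))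
              set-lost : ∀ S → ∣ S ∣ ≤ r → {Z : Fin n → Set} (Z? : Decidable Z) → # (fins n) Z? ≤ # (fins n) (λ z → Z? z ×-dec ¬? (z ∈? S)) + r
              set-lost S S≤ Z? = ≤-trans (#-lost (fins n) Z? (λ z → ¬? (z ∈? S)) (_∈? S) λ z _ → decidable-stable (z ∈? S)) (+-monoʳ-≤ _ (≤-trans (≤-reflexive (sym (∣∣-# S))) S≤))
              kept : ∀ c → vsz c ≤ # (fins n) (A₆? c) + (4 * y₂ + 2 * r)
              kept c = ≤-trans (ok-lost ax c (V? c) id) (≤-trans (+-monoˡ-≤ y₂ (≤-trans (ok-lost ay c (A₁? c) proj₁) (+-monoˡ-≤ y₂ (≤-trans (ok-lost ax′ c (A₂? c) (proj₁ ∘ proj₁)) (+-monoˡ-≤ y₂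
                (≤-trans (ok-lost ay′ c (A₃? c) (proj₁ ∘ proj₁ ∘ proj₁)) (+-monoˡ-≤ y₂ (≤-trans (set-lost S S≤ (A₄? c)) (+-monoˡ-≤ r (set-lost S′ S′≤ (A₅? c)))))))))))
                (≤-reflexive (l₀ (# (fins n) (A₆? c)) r y₂)))
                where
                l₀ : ∀ x r y → x + r + r + y + y + y + y ≡ x + (4 * y + 2 * r)
                l₀ = solve-∀
              big : ∀ c → P + ℓ * (P * y₁) ≤ # (fins n) (A₆? c)
              big c = +-cancelˡ-≤ (U + ℓ′ * (ℓ + ℓ′ * s₁) + (4 * y₂ + 2 * r)) _ _ (≤-trans large₃ (≤-trans (vsz≥ c)
                (≤-trans (+-monoˡ-≤ _ (kept c)) (≤-reflexive (l₀ (# (fins n) (A₆? c)) (4 * y₂ + 2 * r) (U + ℓ′ * (ℓ + ℓ′ * s₁)))))))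
                where
                l₀ : ∀ x b c → x + b + c ≡ c + b + x
                l₀ = solve-∀
              finish : Chosen P (λ c z → (((((ty z ≡ just c × (c ≢ i → Heavy x z)) × (c ≢ i → Heavy y z)) × (c ≢ j → Heavy x′ z)) × (c ≢ j → Heavy y′ z)) × z ∉ S) × z ∉ S′) → CoreAt i j x y x′ y′ S S′
              finish (C , C∈ , C-inj , C-heavy) = coreAt C (mkCore C-inj C-heavy)
                (λ c b → proj₂ (proj₁ (proj₁ (proj₁ (proj₁ (proj₁ (C∈ c b))))))) (λ c b → proj₂ (proj₁ (proj₁ (proj₁ (proj₁ (C∈ c b)))))) (λ c b → proj₂ (proj₁ (proj₁ (proj₁ (C∈ c b)))))
                (λ c b → proj₂ (proj₁ (proj₁ (C∈ c b)))) (λ c b → proj₂ (proj₁ (C∈ c b))) (λ c b → proj₂ (C∈ c b))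

            X : Fin n → Fin ℓ
            X u = proj₁ (class-at u)

            few-colours : # (sets n) G? ≤ turan r n ℓ + 1
            few-colours = ≤-trans (#-⊎ (sets n) G? (λ S → has? r S ×-dec cross? (just ∘ X) S) mono? cover) (+-mono-≤ (Turán.cross≤turan ℓ′ r X) mono≤1)
              where
              Mono : Subset n → Set
              Mono S = G S × ∃ λ z → ∃ λ z′ → z ∈ S × z′ ∈ S × z ≢ z′ × X z ≡ X z′
              mono? : Decidable Mono
              mono? S = G? S ×-dec any? λ z → any? λ z′ → z ∈? S ×-dec (z′ ∈? S ×-dec (¬? (z ≟ᶠ z′) ×-dec X z ≟ᶠ X z′))
              at-X : ∀ u {i} → X u ≡ i → At i u
              at-X u refl = proj₂ (class-at u)
              mono≤1 : # (sets n) mono? ≤ 1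
              mono≤1 = #-sets≤1 mono? λ S S′ (g , z , w , z∈ , w∈ , z≢w , e) (g′ , z′ , w′ , z∈′ , w∈′ , z≢w′ , e′) →
                G-inj g g′ (same-colour at-cores (G-size g) (G-size g′) (at-X z refl) (at-X w (sym e)) z≢w z∈ w∈ (at-X z′ refl) (at-X w′ (sym e′)) z≢w′ z∈′ w∈′)
              cover : ∀ S → G S → (∣ S ∣ ≡ r × Cross (just ∘ X) S) ⊎ Mono S
              cover S g = split (mono? S)
                where
                split : Dec (Mono S) → (∣ S ∣ ≡ r × Cross (just ∘ X) S) ⊎ Mono S
                split (yes m) = inj₂ m
                split (no ¬m) = inj₁ (G-size g , (λ _ _ ()) , λ z z′ z∈ z′∈ e → decidable-stable (z ≟ᶠ z′) λ z≢z′ → ¬m (g , z , z′ , z∈ , z′∈ , z≢z′ , Maybe.just-injective e))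

    -- The contradiction under large minimum degree.

    module Contradiction (r′≤ℓ₀ : r′ ≤ ℓ₀) (τ T J₁ J₂ Q : ℕ) (T≡ : T ≡ 8 * τ)
      (τ-large : ℓ * P ≤ τ) (τ-large′ : 2 * r + P ≤ 4 * τ) (ℓ≤Q : ℓ ≤ Q)
      (n-large : ℓ ^ r * Q * (r !) * Cap + fall ℓ r * Q * r * ℓ < n)
      (blow : {R : Vec (Fin n) ℓ → Set} (R? : Decidable R) → n ^ ℓ ≤ ℓ ^ r * Q * (ℓ * Q) ^ (ℓ ∸ r) * (suc Q * ℓ) * # (vecs n ℓ) R? →
        ∃ λ (B : Fin ℓ → Fin T → Fin n) → (∀ i → Injective _≡_ _≡_ (B i)) × (∀ f → R (sel B f)))
      (J₂-large : 8 * ℓ * Constants.d₂ ℓ′ P r Cap (3 + r′) J₁ J₂ Q ≤ suc J₂)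
      (J₁-large : 8 * ℓ * Constants.d₁ ℓ′ P r Cap (3 + r′) J₁ J₂ Q + 4 * suc J₂ ^ (3 + r′) * Constants.dθ ℓ′ P r Cap (3 + r′) J₁ J₂ Q ≤ suc J₁)
      (Q-large : 8 * ℓ * (8 * ℓ + 4 * suc J₂ ^ (3 + r′) + 4 * suc J₁ ^ (3 + r′)) ≤ Q)
      (n≥N : Constants.N ℓ′ P r Cap (3 + r′) J₁ J₂ Q J₂-large J₁-large Q-large ≤ n)
      (q : ℕ) (n-lo : ℓ * q < n) (n-hi : n ≤ ℓ * q + ℓ)
      (deg≥ : ∀ u → σ (3 + r′) (λ (_ : Fin ℓ′) → q) ≤ # (sets n) (λ S → u ∈? S ×-dec G? S))
      (many : turan r n ℓ + 2 ≤ # (sets n) G?) where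

      private
        0<n : 0 < n
        0<n = ≤-trans (s≤s z≤n) n-lo

      cliques : fall ℓ r * Q * n ^ r < ℓ ^ r * Q * Cliques.h Heavy heavy? Heavy-sym r + n ^ r
      cliques = ManyCliques.many-cliques r′ Cap χ G G? G-size G-inj ℓ′ Q (≤-trans (m≤m+n _ 2) many) n-large

      Rich : Vec (Fin n) ℓ → Set
      Rich = DenseCliques.Rich Heavy heavy? Heavy-sym ℓ′ (2 + r′) Q (+-monoʳ-≤ 4 r′≤ℓ₀) ℓ≤Q 0<n cliques

      rich? : Decidable Rich
      rich? = DenseCliques.rich? Heavy heavy? Heavy-sym ℓ′ (2 + r′) Q (+-monoʳ-≤ 4 r′≤ℓ₀) ℓ≤Q 0<n cliques

      module _ (B : Fin ℓ → Fin T → Fin n) (B-inj : ∀ i → Injective _≡_ _≡_ (B i)) (rich : ∀ f → Rich (sel B f)) where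

        B-heavy : ∀ i j a b → i ≢ j → Heavy (B i a) (B j b)
        B-heavy = clique-blowup Heavy heavy? Heavy-sym B (λ f → proj₁ (rich f))

        Near : Fin ℓ → Fin n → Set
        Near = Types.Near τ T T≡ B B-inj B-heavy τ-large τ-large′

        typed? : ∀ u → Dec (∃ λ i → Near i u)
        typed? = Types.typed? τ T T≡ B B-inj B-heavy τ-large τ-large′

        ty : Fin n → Maybe (Fin ℓ)
        ty u = witness (typed? u)

        ty-near : ∀ {i u} → ty u ≡ just i → Near i u
        ty-near {u = u} = witness-just (typed? u)

        ty-nothing : ∀ u → ty u ≡ nothing → ¬ (∃ λ i → Near i u)
        ty-nothing u = witness-nothing (typed? u)

        cores : HasCores (λ i x → ty x ≡ just i)
        cores ex ey ex′ ey′ = Types.near-cores τ T T≡ B B-inj B-heavy τ-large τ-large′ (ty-near ex) (ty-near ey) (ty-near ex′) (ty-near ey′)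

        U : ℕ
        U = # (fins n) (λ x → ty x ≟ᵐ nothing)

        U≤ : Q * U ≤ 8 * ℓ * n
        U≤ = ≤-trans (*-monoʳ-≤ Q (#-mono (fins n) (λ x → ty x ≟ᵐ nothing) (λ u → ¬? (typed? u)) ty-nothing))
          (Types.untyped-few τ T T≡ B B-inj B-heavy τ-large τ-large′ Q (λ f → proj₂ (rich f)))

        absurd : ⊥
        absurd = <⇒≱ (≤-trans (≤-reflexive (sym (+-suc (turan r n ℓ) 1))) many)
          (Structure.few-colours ty cores r′≤ℓ₀ q n-lo n-hi J₁ J₂ deg≥
            (Constants.first ℓ′ P r Cap (3 + r′) J₁ J₂ Q J₂-large J₁-large Q-large n q U n≥N n-hi U≤)
            (Constants.second ℓ′ P r Cap (3 + r′) J₁ J₂ Q J₂-large J₁-large Q-large n q U n≥N n-hi U≤)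
            (Constants.third ℓ′ P r Cap (3 + r′) J₁ J₂ Q J₂-large J₁-large Q-large n q U n≥N n-hi U≤))

      contradictory : ⊥
      contradictory = from (blow rich? (DenseCliques.rich-dense Heavy heavy? Heavy-sym ℓ′ (2 + r′) Q (+-monoʳ-≤ 4 r′≤ℓ₀) ℓ≤Q 0<n cliques))
        where
        from : (∃ λ (B : Fin ℓ → Fin T → Fin n) → (∀ i → Injective _≡_ _≡_ (B i)) × (∀ f → Rich (sel B f))) → ⊥
        from (B , B-inj , rich) = absurd B B-inj rich

  -- Upper bound: reduction to the minimum degree of the Turán graph.

  module Upper (r′ : ℕ) (r′≤ℓ₀ : r′ ≤ ℓ₀) where

    private
      r = 4 + r′
      κ = 3 + r′

    System : Variant → ∀ {n} → (Subset n → ℕ) → Set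
    System v = RainbowSystems.RainbowSystem r K (VarAdj v ℓ t)

    -- A rainbow subgraph. It may leave out colours, so that it survives the deletion of a vertex,
    -- where colours get lost.
    record Palette {n} (χ : Subset n → ℕ) : Set₁ where
      field
        G      : Subset n → Set
        G?     : Decidable G
        G-size : ∀ {S} → G S → ∣ S ∣ ≡ r
        G-inj  : ∀ {S S′} → G S → G S′ → χ S ≡ χ S′ → S ≡ S′
    open Palette

    colours : ∀ {n} {χ : Subset n → ℕ} → Palette χ → ℕ
    colours {n} p = # (sets n) (G? p)

    degree : ∀ {n} {χ : Subset n → ℕ} → Palette χ → Fin n → ℕ
    degree {n} p u = # (sets n) (λ S → u ∈? S ×-dec G? p S)

    MinDegree : ℕ → Set₁
    MinDegree N = ∀ n′ → N ≤ suc n′ → ∀ v (χ : Subset (suc n′) → ℕ) (p : Palette χ) → turan r (suc n′) ℓ + 2 ≤ colours p →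
      (∀ u → turan r (suc n′) ℓ ≤ turan r n′ ℓ + degree p u) → System v χ

    module _ (Cap τ T J₁ J₂ Q : ℕ) (T≡ : T ≡ 8 * τ) (cap₁ : K + 4 * r + K * K * r ≤ Cap) (cap₂ : ℓ * P + r ≤ Cap)
      (τ-large : ℓ * P ≤ τ) (τ-large′ : 2 * r + P ≤ 4 * τ) (ℓ≤Q : ℓ ≤ Q)
      (J₂-large : 8 * ℓ * Constants.d₂ ℓ′ P r Cap κ J₁ J₂ Q ≤ suc J₂)
      (J₁-large : 8 * ℓ * Constants.d₁ ℓ′ P r Cap κ J₁ J₂ Q + 4 * suc J₂ ^ κ * Constants.dθ ℓ′ P r Cap κ J₁ J₂ Q ≤ suc J₁)
      (Q-large : 8 * ℓ * (8 * ℓ + 4 * suc J₂ ^ κ + 4 * suc J₁ ^ κ) ≤ Q)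
      (C : ℕ) (C≡ : C ≡ ℓ ^ r * Q * (ℓ * Q) ^ (ℓ ∸ r) * (suc Q * ℓ)) where

      min-degree : Blowup ℓ T C → ∃ MinDegree
      min-degree (N_B , blow) = N_B + (c₁ + (c₂ + N₃)) , main
        where
        c₁ = ℓ * P + 4 * r
        c₂ = suc (ℓ ^ r * Q * (r !) * Cap + fall ℓ r * Q * r * ℓ)
        N₃ = Constants.N ℓ′ P r Cap κ J₁ J₂ Q J₂-large J₁-large Q-large
        main : MinDegree (N_B + (c₁ + (c₂ + N₃)))
        main n′ n≥ v χ p many degrees = decidable-stable (RainbowSystems.rainbowSystem? r K (VarAdj v ℓ t) χ) λ none →
          Connection.Contradiction.contradictory r′ Cap v χ (G p) (G? p) (G-size p) (G-inj p) cap₁ cap₂ (≤-trans (≤-trans (m≤m+n c₁ _) (m≤n+m _ N_B)) n≥) none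
            r′≤ℓ₀ τ T J₁ J₂ Q T≡ τ-large τ-large′ ℓ≤Q (≤-trans (≤-trans (m≤m+n c₂ N₃) (≤-trans (m≤n+m _ c₁) (m≤n+m _ N_B))) n≥)
            (λ R? dense → blow (suc n′) (≤-trans (m≤m+n N_B _) n≥) R? (≤-trans dense (≤-reflexive (cong (_* # (vecs (suc n′) ℓ) R?) (sym C≡)))))
            J₂-large J₁-large Q-large (≤-trans (≤-trans (m≤n+m N₃ c₂) (≤-trans (m≤n+m _ c₁) (m≤n+m _ N_B))) n≥)
            -- `q` is the least class size before the last vertex is added, so that `turan-suc`
            -- turns the minimum degree into `deg≥`.
            (n′ / ℓ) n-lo n-hi (λ u → +-cancelˡ-≤ (turan r n′ ℓ) _ _ (≤-trans (Turán.turan-suc ℓ′ (3 + r′) n′) (degrees u))) many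
          where
          n-lo : ℓ * (n′ / ℓ) < suc n′
          n-lo = s≤s (≤-trans (≤-reflexive (*-comm ℓ (n′ / ℓ))) (m/n*n≤m n′ ℓ))
          n-hi : suc n′ ≤ ℓ * (n′ / ℓ) + ℓ
          n-hi = ≤-trans (s≤s (≤-reflexive (m≡m%n+[m/n]*n n′ ℓ))) (≤-trans (+-monoˡ-≤ (n′ / ℓ * ℓ) (m%n<n n′ ℓ))
            (≤-reflexive (trans (+-comm ℓ _) (cong (_+ ℓ) (*-comm (n′ / ℓ) ℓ)))))

    abstract
      min-degree-N : ∃ MinDegree
      min-degree-N = stage₁ Cap τ (m≤m+n _ _) (m≤n+m (ℓ * P + r) (K + 4 * r + K * K * r)) (m≤m+n _ _) (≤-trans (m≤n+m _ (ℓ * P)) (m≤m+n τ _))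
        where
        Cap τ : ℕ
        Cap = (K + 4 * r + K * K * r) + (ℓ * P + r)
        τ = ℓ * P + (2 * r + P)
        -- The coefficients taken from `Z` depend only on `ℓ` and `P`, so zeros may stand for the
        -- constants still to be chosen.
        module Z = Constants ℓ′ P r 0 κ 0 0 0
        stage₁ : ∀ Cap τ → K + 4 * r + K * K * r ≤ Cap → ℓ * P + r ≤ Cap → ℓ * P ≤ τ → 2 * r + P ≤ 4 * τ → ∃ MinDegree
        stage₁ Cap τ cap₁ cap₂ τ₁ τ₂ = stage₂ (8 * ℓ * Z.d₂) (n≤1+n _)
          where
          stage₂ : ∀ J₂ → 8 * ℓ * Z.d₂ ≤ suc J₂ → ∃ MinDegree
          stage₂ J₂ J₂≥ = stage₃ (8 * ℓ * Z.d₁ + 4 * suc J₂ ^ κ * Z.dθ) (n≤1+n _)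
            where
            stage₃ : ∀ J₁ → 8 * ℓ * Z.d₁ + 4 * suc J₂ ^ κ * Z.dθ ≤ suc J₁ → ∃ MinDegree
            stage₃ J₁ J₁≥ = stage₄ (ℓ + 8 * ℓ * (8 * ℓ + 4 * suc J₂ ^ κ + 4 * suc J₁ ^ κ)) (m≤m+n ℓ _) (m≤n+m _ ℓ)
              where
              stage₄ : ∀ Q → ℓ ≤ Q → 8 * ℓ * (8 * ℓ + 4 * suc J₂ ^ κ + 4 * suc J₁ ^ κ) ≤ Q → ∃ MinDegree
              stage₄ Q ℓ≤Q Q≥ = stage₅ (8 * τ) refl _ refl
                where
                stage₅ : ∀ T → T ≡ 8 * τ → ∀ C → C ≡ ℓ ^ r * Q * (ℓ * Q) ^ (ℓ ∸ r) * (suc Q * ℓ) → ∃ MinDegree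
                stage₅ T T≡ C C≡ = min-degree Cap τ T J₁ J₂ Q T≡ cap₁ cap₂ τ₁ τ₂ ℓ≤Q J₂≥ J₁≥ Q≥ C C≡ (blowup ℓ T C)

    module _ {n : ℕ} (u : Fin (suc n)) {χ : Subset (suc n) → ℕ} where

      restrict : Subset n → ℕ
      restrict S = χ (insertAt S u outside)

      Palette-restrict : Palette χ → Palette restrict
      Palette-restrict p = record
        { G = λ S → G p (insertAt S u outside) ; G? = λ S → G? p (insertAt S u outside)
        ; G-size = λ {S} g → trans (sym (∣insertAt∣ S u)) (G-size p g)
        ; G-inj = λ {S} {S′} g g′ e → insertAt-injective S S′ u (G-inj p g g′ e) }

      colours-restrict : ∀ (p : Palette χ) → colours p ≤ degree p u + colours (Palette-restrict p)
      colours-restrict p = ≤-trans (#-⊎ (sets (suc n)) (G? p) (λ S → u ∈? S ×-dec G? p S) (λ S → ¬? (u ∈? S) ×-dec G? p S) split)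
        (+-monoʳ-≤ (degree p u) (≤-reflexive (#-∌ u (G? p))))
        where
        split : ∀ S → G p S → (u ∈ S × G p S) ⊎ (u ∉ S × G p S)
        split S g with u ∈? S
        ... | yes u∈ = inj₁ (u∈ , g)
        ... | no u∉  = inj₂ (u∉ , g)

      lift-system : ∀ v → System v restrict → System v χ
      lift-system v (c , e , inj , exact , comp) = toSystem {χ = χ} core ext (inj′ , exact′ , comp′)
        where
        open RainbowSystems r K (VarAdj v ℓ t)
        core₀ = Vec.lookup c
        ext₀ = λ i j → Vec.lookup (Vec.lookup e i) j
        core : Fin K → Fin (suc n)
        core = punchIn u ∘ core₀
        ext : Fin K → Fin K → Subset (suc n)
        ext i j = insertAt (ext₀ i j) u outside
        inj′ : ∀ i j → core i ≡ core j → i ≡ j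
        inj′ i j q = inj i j (punchIn-injective u _ _ q)
        exact′ : ∀ i j → Edge K (VarAdj v ℓ t) i j → Exact core i j (ext i j)
        exact′ i j ed = let h , p , q , only = exact i j ed in
          trans (∣insertAt∣ (ext₀ i j) u) h , ∈insertAt⁺ _ u p , ∈insertAt⁺ _ u q , λ κ k∈ → only κ (∈insertAt⁻ _ u k∈)
        comp′ : ∀ i j i′ j′ → Edge K (VarAdj v ℓ t) i j → Edge K (VarAdj v ℓ t) i′ j′ → ¬ (i ≡ i′ × j ≡ j′) → Compatible χ core (ext i j) (ext i′ j′)
        comp′ i j i′ j′ ed ed′ ne = (λ x p q → meets x (∈insertAt-old _ u x p) q) , proj₂ (comp i j i′ j′ ed ed′ ne)
          where
          meets : ∀ x → (∃ λ y → punchIn u y ≡ x × y ∈ ext₀ i j) → x ∈ ext i′ j′ → ∃ λ κ → core κ ≡ x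
          meets x (y , refl , y∈) q = let κ , z = proj₁ (comp i j i′ j′ ed ed′ ne) y y∈ (∈insertAt⁻ _ u q) in κ , cong (punchIn u) z

    module Descent {N : ℕ} (min-degree-case : MinDegree N) where

      -- Deleting a vertex of small degree raises the surplus x over the Turán number, which cannot exceed 2 ^ N.
      descent : ∀ d x v (χ : Subset (d + N) → ℕ) (p : Palette χ) → 2 ^ N ≤ x + d → turan r (d + N) ℓ + 2 + x ≤ colours p → System v χ
      descent zero x v χ p surplus many = contradiction (≤-trans many (≤-trans (#-≤-length (sets N) (G? p)) (≤-reflexive (length-sets N))))
        (<⇒≱ (≤-trans (s≤s (≤-trans surplus (≤-reflexive (+-identityʳ x)))) (≤-trans (≤-trans (n≤1+n (suc x)) (m≤n+m (2 + x) (turan r N ℓ))) (≤-reflexive (sym (+-assoc (turan r N ℓ) 2 x))))))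
      descent (suc d) x v χ p surplus many = split (all? λ u → turan r (suc (d + N)) ℓ ≤? turan r (d + N) ℓ + degree p u)
        where
        split : Dec (∀ u → turan r (suc (d + N)) ℓ ≤ turan r (d + N) ℓ + degree p u) → System v χ
        split (yes degrees) = min-degree-case (d + N) (m≤n+m N (suc d)) v χ p (≤-trans (m≤m+n _ x) many) degrees
        split (no ¬degrees) = delete (¬∀⟶∃¬ (suc (d + N)) _ (λ u → turan r (suc (d + N)) ℓ ≤? turan r (d + N) ℓ + degree p u) ¬degrees)
          where
          delete : (∃ λ u → ¬ (turan r (suc (d + N)) ℓ ≤ turan r (d + N) ℓ + degree p u)) → System v χ
          delete (u , low) = lift-system u {χ} v (descent d (suc x) v (restrict u {χ}) (Palette-restrict u p) (≤-trans surplus (≤-reflexive (+-suc x d)))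
            (+-cancelˡ-≤ (degree p u) _ _ (begin
              degree p u + (turan r (d + N) ℓ + 2 + suc x)  ≡⟨ l₀ (degree p u) (turan r (d + N) ℓ) x ⟩
              suc (turan r (d + N) ℓ + degree p u) + (2 + x)  ≤⟨ +-monoˡ-≤ (2 + x) (≰⇒> low) ⟩
              turan r (suc (d + N)) ℓ + (2 + x)  ≡⟨ sym (+-assoc (turan r (suc (d + N)) ℓ) 2 x) ⟩
              turan r (suc (d + N)) ℓ + 2 + x  ≤⟨ many ⟩
              colours p  ≤⟨ colours-restrict u p ⟩
              degree p u + colours (Palette-restrict u p)  ∎)))
            where
            open ≤-Reasoning
            l₀ : ∀ a b x → a + (b + 2 + suc x) ≡ suc (b + a) + (2 + x)
            l₀ = solve-∀

    upper : ∃ λ N → ∀ n → N ≤ n → ∀ v {m} (χ : Subset n → Fin m) → SurjectiveColouring n r m χ → turan r n ℓ + 2 ≤ m →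
      RainbowCopy (Expansion r K (VarAdj v ℓ t)) χ
    upper = from min-degree-N
      where
      from : ∃ MinDegree → ∃ λ N → ∀ n → N ≤ n → ∀ v {m} (χ : Subset n → Fin m) → SurjectiveColouring n r m χ → turan r n ℓ + 2 ≤ m →
        RainbowCopy (Expansion r K (VarAdj v ℓ t)) χ
      -- Each deletion raises the surplus by one; with at least `2 ^ N` deletions before `N`
      -- vertices are left, the surplus would become impossible.
      from (N , case) = 2 ^ N + N , main
        where
        palette : ∀ {n m} (χ : Subset n → Fin m) (rep : ∀ c → ∃ λ S → ∣ S ∣ ≡ r × χ S ≡ c) → Palette (toℕ ∘ χ)
        palette χ rep = record
          { G = λ S → ∃ λ c → proj₁ (rep c) ≡ S ; G? = λ S → any? λ c → proj₁ (rep c) ≟ˢ S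
          ; G-size = λ { (c , refl) → proj₁ (proj₂ (rep c)) }
          ; G-inj = λ { (c , refl) (c′ , refl) e → cong (λ c → proj₁ (rep c)) (trans (sym (proj₂ (proj₂ (rep c)))) (trans (toℕ-injective e) (proj₂ (proj₂ (rep c′))))) } }
        main : ∀ n → 2 ^ N + N ≤ n → ∀ v {m} (χ : Subset n → Fin m) → SurjectiveColouring n r m χ → turan r n ℓ + 2 ≤ m →
          RainbowCopy (Expansion r K (VarAdj v ℓ t)) χ
        main n n≥ v {m} χ rep m≥ = go (n ∸ N) (m∸n+n≡m (≤-trans (m≤n+m N (2 ^ N)) n≥)) (≤-trans (≤-reflexive (sym (m+n∸n≡m (2 ^ N) N))) (∸-monoˡ-≤ N n≥)) χ rep m≥
          where
          go : ∀ d → d + N ≡ n → 2 ^ N ≤ d → (χ : Subset n → Fin m) → SurjectiveColouring n r m χ → turan r n ℓ + 2 ≤ m → RainbowCopy (Expansion r K (VarAdj v ℓ t)) χ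
          go d refl d≥ χ rep m≥ = RainbowCopies.toCopy r K (VarAdj v ℓ t) (Descent.descent case d 0 v (toℕ ∘ χ) (palette χ rep) d≥
            (≤-trans (≤-reflexive (+-identityʳ _)) (≤-trans m≥ (#-inject _≟ˢ_ (sets n) ∈-sets (G? (palette χ rep)) (λ c → proj₁ (rep c))
              (λ {c} {c′} e → trans (sym (proj₂ (proj₂ (rep c)))) (trans (cong χ e) (proj₂ (proj₂ (rep c′))))) (λ c → c , refl)))))

  -- Lower bound: a colouring without a rainbow copy.

  module Lower (r : ℕ) (4≤r : 4 ≤ r) where

    part-vertex : ∀ i a → part ℓ t (vertex (i , a)) ≡ toℕ i
    part-vertex i a = cong (toℕ ∘ proj₁) (remQuot-combine i a)

    pos-vertex : ∀ i a → pos ℓ t (vertex (i , a)) ≡ toℕ a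
    pos-vertex i a = cong (toℕ ∘ proj₂) (remQuot-combine i a)

    Kadj⁺ : ∀ v {p p′ : Place} → proj₁ p ≢ proj₁ p′ → T (VarAdj v ℓ t (vertex p) (vertex p′))
    Kadj⁺ v {i , a} {j , b} i≢j = any-variant v (not⁺ λ q →
        i≢j (toℕ-injective (trans (sym (part-vertex i a)) (trans (≡ᵇ⇒≡ _ _ q) (part-vertex j b)))))
      where
      any-variant : ∀ v → T (Kadj ℓ t (vertex (i , a)) (vertex (j , b))) → T (VarAdj v ℓ t (vertex (i , a)) (vertex (j , b)))
      any-variant α = ∨⁺ˡ {Kadj ℓ t (vertex (i , a)) (vertex (j , b))}
      any-variant β = ∨⁺ˡ {Kadj ℓ t (vertex (i , a)) (vertex (j , b))}
      any-variant γ = ∨⁺ˡ {Kadj ℓ t (vertex (i , a)) (vertex (j , b))}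

    ≡ᵇ⁺ : ∀ {x y} → x ≡ y → T (x ≡ᵇ y)
    ≡ᵇ⁺ {x} {y} = ≡⇒≡ᵇ x y

    inPart⁺ : ∀ i a b → T (inPart ℓ t (toℕ i) (toℕ a) (toℕ b) (vertex (i , a)) (vertex (i , b)))
    inPart⁺ i a b = ∧⁺ (≡ᵇ⁺ (part-vertex i a)) (∧⁺ (≡ᵇ⁺ (part-vertex i b)) (∨⁺ˡ (∧⁺ (≡ᵇ⁺ (pos-vertex i a)) (≡ᵇ⁺ (pos-vertex i b)))))

    inPart⁺′ : ∀ i a b → T (inPart ℓ t (toℕ i) (toℕ a) (toℕ b) (vertex (i , b)) (vertex (i , a)))
    inPart⁺′ i a b = ∧⁺ (≡ᵇ⁺ (part-vertex i b)) (∧⁺ (≡ᵇ⁺ (part-vertex i a))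
      (∨⁺ʳ {(pos ℓ t (vertex (i , b)) ≡ᵇ toℕ a) ∧ (pos ℓ t (vertex (i , a)) ≡ᵇ toℕ b)} (∧⁺ (≡ᵇ⁺ (pos-vertex i b)) (≡ᵇ⁺ (pos-vertex i a)))))

    -- an edge inside one part completed to K_{ℓ+1} by the vertices at position s of the other parts
    clique : Place → Place → Fin t → Fin (suc ℓ) → Place
    clique u w s zero          = u
    clique u w s (suc zero)    = w
    clique u w s (suc (suc p)) = punchIn (proj₁ u) p , s

    Adjacent : Variant → Place → Place → Set
    Adjacent v p p′ = T (VarAdj v ℓ t (vertex p) (vertex p′)) × T (VarAdj v ℓ t (vertex p′) (vertex p))

    record CliqueIn (v : Variant) (q : Fin (suc ℓ) → Place) : Set where
      field
        distinct : ∀ i j → i ≢ j → q i ≢ q j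
        adjacent : ∀ i j → i ≢ j → Adjacent v (q i) (q j)

    swap-adj : ∀ {v p p′} → Adjacent v p p′ → Adjacent v p′ p
    swap-adj (x , y) = y , x

    clique-ok : ∀ v {c a b} s → a ≢ b → Adjacent v (c , a) (c , b) → CliqueIn v (clique (c , a) (c , b) s)
    clique-ok v {c} {a} {b} s a≢b adj = record { distinct = dis ; adjacent = adj′ }
      where
      q = clique (c , a) (c , b) s
      off : ∀ p → c ≢ punchIn c p
      off p e = punchInᵢ≢i c p (sym e)
      dis : ∀ i j → i ≢ j → q i ≢ q j
      dis zero zero ne _ = ne refl
      dis zero (suc zero) ne e = a≢b (cong proj₂ e)
      dis zero (suc (suc p)) ne e = off p (cong proj₁ e)
      dis (suc zero) zero ne e = a≢b (sym (cong proj₂ e))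
      dis (suc zero) (suc zero) ne _ = ne refl
      dis (suc zero) (suc (suc p)) ne e = off p (cong proj₁ e)
      dis (suc (suc p)) zero ne e = off p (sym (cong proj₁ e))
      dis (suc (suc p)) (suc zero) ne e = off p (sym (cong proj₁ e))
      dis (suc (suc p)) (suc (suc p′)) ne e = ne (cong {B = Fin (suc ℓ)} (λ z → suc (suc z)) (punchIn-injective c p p′ (cong proj₁ e)))
      cross : ∀ {p p′ : Place} → proj₁ p ≢ proj₁ p′ → Adjacent v p p′
      cross ne = Kadj⁺ v ne , Kadj⁺ v (ne ∘ sym)
      adj′ : ∀ i j → i ≢ j → Adjacent v (q i) (q j)
      adj′ zero zero ne = contradiction refl ne
      adj′ zero (suc zero) ne = adj
      adj′ zero (suc (suc p)) ne = cross (off p)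
      adj′ (suc zero) zero ne = swap-adj {v} {c , a} {c , b} adj
      adj′ (suc zero) (suc zero) ne = contradiction refl ne
      adj′ (suc zero) (suc (suc p)) ne = cross (off p)
      adj′ (suc (suc p)) zero ne = cross (off p ∘ sym)
      adj′ (suc (suc p)) (suc zero) ne = cross (off p ∘ sym)
      adj′ (suc (suc p)) (suc (suc p′)) ne = cross λ e → ne (cong {B = Fin (suc ℓ)} (λ z → suc (suc z)) (punchIn-injective c p p′ e))

    q₁ : Fin (suc ℓ) → Place
    q₁ = clique u₁ w₁ (suc (suc zero))

    q₂ : Variant → Fin (suc ℓ) → Place
    q₂ v = clique (u₂ v) (w₂ v) (suc (suc (suc zero)))

    special₁ : ∀ v → Adjacent v u₁ w₁
    special₁ v = one v (vertex u₁) (vertex w₁) (inPart⁺ zero zero (suc zero)) , one v (vertex w₁) (vertex u₁) (inPart⁺′ zero zero (suc zero))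
      where
      one : ∀ v x y → T (inPart ℓ t 0 0 1 x y) → T (VarAdj v ℓ t x y)
      one α x y p = ∨⁺ʳ {Kadj ℓ t x y} (∨⁺ˡ {inPart ℓ t 0 0 1 x y} {inPart ℓ t 0 1 2 x y} p)
      one β x y p = ∨⁺ʳ {Kadj ℓ t x y} (∨⁺ˡ {inPart ℓ t 0 0 1 x y} {inPart ℓ t 0 2 3 x y} p)
      one γ x y p = ∨⁺ʳ {Kadj ℓ t x y} (∨⁺ˡ {inPart ℓ t 0 0 1 x y} {inPart ℓ t 1 0 1 x y} p)

    special₂ : ∀ v → Adjacent v (u₂ v) (w₂ v)
    special₂ α = two (vertex (u₂ α)) (vertex (w₂ α)) (inPart⁺ zero (suc zero) (suc (suc zero))) , two (vertex (w₂ α)) (vertex (u₂ α)) (inPart⁺′ zero (suc zero) (suc (suc zero)))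
      where
      two : ∀ x y → T (inPart ℓ t 0 1 2 x y) → T (VarAdj α ℓ t x y)
      two x y p = ∨⁺ʳ {Kadj ℓ t x y} (∨⁺ʳ {inPart ℓ t 0 0 1 x y} p)
    special₂ β = two (vertex (u₂ β)) (vertex (w₂ β)) (inPart⁺ zero (suc (suc zero)) (suc (suc (suc zero)))) , two (vertex (w₂ β)) (vertex (u₂ β)) (inPart⁺′ zero (suc (suc zero)) (suc (suc (suc zero))))
      where
      two : ∀ x y → T (inPart ℓ t 0 2 3 x y) → T (VarAdj β ℓ t x y)
      two x y p = ∨⁺ʳ {Kadj ℓ t x y} (∨⁺ʳ {inPart ℓ t 0 0 1 x y} p)
    special₂ γ = two (vertex (u₂ γ)) (vertex (w₂ γ)) (inPart⁺ (suc zero) zero (suc zero)) , two (vertex (w₂ γ)) (vertex (u₂ γ)) (inPart⁺′ (suc zero) zero (suc zero))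
      where
      two : ∀ x y → T (inPart ℓ t 1 0 1 x y) → T (VarAdj γ ℓ t x y)
      two x y p = ∨⁺ʳ {Kadj ℓ t x y} (∨⁺ʳ {inPart ℓ t 0 0 1 x y} p)

    clique₁ : ∀ v → CliqueIn v q₁
    clique₁ v = clique-ok v (suc (suc zero)) (λ ()) (special₁ v)

    clique₂ : ∀ v → CliqueIn v (q₂ v)
    clique₂ α = clique-ok α (suc (suc (suc zero))) (λ ()) (special₂ α)
    clique₂ β = clique-ok β (suc (suc (suc zero))) (λ ()) (special₂ β)
    clique₂ γ = clique-ok γ (suc (suc (suc zero))) (λ ()) (special₂ γ)

    -- Positions 2 and 3 keep the completing vertices of the two cliques apart, and the added edges
    -- share at most `w₁`, as they do for `α`. A common edge would need two common places.
    common : ∀ v i j → q₁ i ≡ q₂ v j → i ≡ suc zero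
    common v (suc zero) j e = refl
    common α zero zero ()
    common α zero (suc zero) ()
    common α zero (suc (suc j)) ()
    common α (suc (suc i)) zero ()
    common α (suc (suc i)) (suc zero) ()
    common α (suc (suc i)) (suc (suc j)) ()
    common β zero zero ()
    common β zero (suc zero) ()
    common β zero (suc (suc j)) ()
    common β (suc (suc i)) zero ()
    common β (suc (suc i)) (suc zero) ()
    common β (suc (suc i)) (suc (suc j)) ()
    common γ zero zero ()
    common γ zero (suc zero) ()
    common γ zero (suc (suc j)) ()
    common γ (suc (suc i)) zero ()
    common γ (suc (suc i)) (suc zero) ()
    common γ (suc (suc i)) (suc (suc j)) ()

    module _ (v : Variant) where

      adj = VarAdj v ℓ t
      H = Expansion r K adj

      vertex-injective : ∀ {p p′} → vertex p ≡ vertex p′ → p ≡ p′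
      vertex-injective {i , a} {j , b} e = let e₁ , e₂ = combine-injective i a j b e in cong₂ _,_ e₁ e₂

      Ends : GEdge K adj → Place → Place → Set
      Ends ed p p′ = proj₁ ed ≡ (vertex p , vertex p′) ⊎ proj₁ ed ≡ (vertex p′ , vertex p)

      edge : ∀ {p p′} → p ≢ p′ → Adjacent v p p′ → ∃ λ ed → Ends ed p p′
      edge {p} {p′} ne (x , y) with <-cmp (toℕ (vertex p)) (toℕ (vertex p′))
      ... | tri< lt _ _ = ((vertex p , vertex p′) , ∧⁺ (<⇒<ᵇ lt) x) , inj₁ refl
      ... | tri≈ _ eq _ = contradiction (vertex-injective (toℕ-injective eq)) ne
      ... | tri> _ _ gt = ((vertex p′ , vertex p) , ∧⁺ (<⇒<ᵇ gt) y) , inj₂ refl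

      module _ {n : ℕ} (φ : HGraph.V H → Fin n) where

        inImage? : ∀ ed x → Dec ((φ (inj₁ (proj₁ (proj₁ ed))) ≡ x ⊎ φ (inj₁ (proj₂ (proj₁ ed))) ≡ x) ⊎ ∃ λ k → φ (inj₂ (ed , k)) ≡ x)
        inImage? ed x = (φ (inj₁ (proj₁ (proj₁ ed))) ≟ᶠ x ⊎-dec φ (inj₁ (proj₂ (proj₁ ed))) ≟ᶠ x) ⊎-dec any? λ k → φ (inj₂ (ed , k)) ≟ᶠ x

        image : GEdge K adj → Subset n
        image ed = fromDec (inImage? ed)

        image-ok : ∀ ed → IsImage H φ ed (image ed)
        image-ok ed x = mk⇔ (λ x∈ → to (∈-fromDec⁻ (inImage? ed) x∈)) (λ m → ∈-fromDec⁺ (inImage? ed) (from m))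
          where
          to : (φ (inj₁ (proj₁ (proj₁ ed))) ≡ x ⊎ φ (inj₁ (proj₂ (proj₁ ed))) ≡ x) ⊎ (∃ λ k → φ (inj₂ (ed , k)) ≡ x) → ∃ λ y → HGraph.Mem H ed y × φ y ≡ x
          to (inj₁ (inj₁ e)) = inj₁ _ , inj₁ refl , e
          to (inj₁ (inj₂ e)) = inj₁ _ , inj₂ refl , e
          to (inj₂ (k , e))  = inj₂ (ed , k) , refl , e
          from : (∃ λ y → HGraph.Mem H ed y × φ y ≡ x) → (φ (inj₁ (proj₁ (proj₁ ed))) ≡ x ⊎ φ (inj₁ (proj₂ (proj₁ ed))) ≡ x) ⊎ (∃ λ k → φ (inj₂ (ed , k)) ≡ x)
          from (inj₁ y , inj₁ refl , e) = inj₁ (inj₁ e)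
          from (inj₁ y , inj₂ refl , e) = inj₁ (inj₂ e)
          from (inj₂ (ed′ , k) , refl , e) = inj₂ (k , e)

        ends∈image : ∀ ed {p p′} → Ends ed p p′ → φ (inj₁ (vertex p)) ∈ image ed × φ (inj₁ (vertex p′)) ∈ image ed
        ends∈image ed (inj₁ refl) = ∈-fromDec⁺ (inImage? ed) (inj₁ (inj₁ refl)) , ∈-fromDec⁺ (inImage? ed) (inj₁ (inj₂ refl))
        ends∈image ed (inj₂ refl) = ∈-fromDec⁺ (inImage? ed) (inj₁ (inj₂ refl)) , ∈-fromDec⁺ (inImage? ed) (inj₁ (inj₁ refl))

    open Turán ℓ′ using (class; residue; turan-#; %⇒residue≡)

    module _ {n m : ℕ} (f : Fin m → Subset n) (f-inj : Injective _≡_ _≡_ f) (f-ok : ∀ c → ∣ f c ∣ ≡ r × Cross (class {n}) (f c)) where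

      colour : ∀ {S} → Dec (∃ λ c → f c ≡ S) → Fin (suc m)
      colour (yes (c , _)) = suc c
      colour (no _)        = zero

      χ : Subset n → Fin (suc m)
      χ S = colour (any? λ c → f c ≟ˢ S)

      χ-suc : ∀ {S} (d : Dec (∃ λ c → f c ≡ S)) {c} → f c ≡ S → colour d ≡ suc c
      χ-suc (yes (c′ , e′)) e = cong suc (f-inj (trans e′ (sym e)))
      χ-suc (no ¬p) e = contradiction (_ , e) ¬p

      χ-zero : ∀ {S} (d : Dec (∃ λ c → f c ≡ S)) → ¬ Cross class S → colour d ≡ zero
      χ-zero (yes (c , refl)) ¬cross = contradiction (proj₂ (f-ok c)) ¬cross
      χ-zero (no _) _ = refl

      no-rainbow : ∀ v → ¬ RainbowCopy (H v) χ
      no-rainbow v (φ , φ-inj , rainbow) = clash (same-class (clique₁ v)) (same-class (clique₂ v))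
        where
        cl : Place → Fin ℓ
        cl p = residue (toℕ (φ (inj₁ (vertex p))))
        SameClass : (Fin (suc ℓ) → Place) → Set
        SameClass q = ∃ λ i → ∃ λ j → i ≢ j × ∃ λ ed → Ends v ed (q i) (q j) × χ (image v φ ed) ≡ zero
        same-class : ∀ {q} → CliqueIn v q → SameClass q
        same-class {q} cq with pigeonhole (n<1+n ℓ) (cl ∘ q)
        ... | i , j , i<j , e = i , j , i≢j , finish (edge v (CliqueIn.distinct cq i j i≢j) (CliqueIn.adjacent cq i j i≢j))
          where
          i≢j : i ≢ j
          i≢j refl = <-irrefl refl i<j
          finish : (∃ λ ed → Ends v ed (q i) (q j)) → ∃ λ ed → Ends v ed (q i) (q j) × χ (image v φ ed) ≡ zero
          finish (ed , ends) = ed , ends , χ-zero (any? λ c → f c ≟ˢ image v φ ed) λ (_ , inj) →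
            let a , b = ends∈image v φ ed {q i} {q j} ends in
            CliqueIn.distinct cq i j i≢j (vertex-injective v {q i} {q j} (inj₁-injective (φ-inj (inj _ _ a b (cong just e)))))
        clash : SameClass q₁ → SameClass (q₂ v) → ⊥
        clash (i , j , i≢j , ed , ends , z) (i′ , j′ , _ , ed′ , ends′ , z′) =
          rainbow ed ed′ (image v φ ed) (image v φ ed′) different (image-ok v φ ed) (image-ok v φ ed′) (trans z (sym z′))
          where
          pair : ∀ {p p′ q q′} → (vertex p , vertex p′) ≡ (vertex q , vertex q′) → p ≡ q × p′ ≡ q′
          pair e = vertex-injective v (cong proj₁ e) , vertex-injective v (cong proj₂ e)
          shared : ∀ {k l} → q₁ i ≡ q₂ v k → q₁ j ≡ q₂ v l → ⊥
          shared {k} {l} e e′ = i≢j (trans (common v i k e) (sym (common v j l e′)))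
          different : ed ≢ ed′
          different refl = cases ends ends′
            where
            cases : Ends v ed (q₁ i) (q₁ j) → Ends v ed (q₂ v i′) (q₂ v j′) → ⊥
            cases (inj₁ a) (inj₁ b) = let e , e′ = pair (trans (sym a) b) in shared {i′} {j′} e e′
            cases (inj₁ a) (inj₂ b) = let e , e′ = pair (trans (sym a) b) in shared {j′} {i′} e e′
            cases (inj₂ a) (inj₁ b) = let e , e′ = pair (trans (sym a) b) in shared {j′} {i′} e′ e
            cases (inj₂ a) (inj₂ b) = let e , e′ = pair (trans (sym a) b) in shared {i′} {j′} e′ e

      surjective : (∃ λ S → ∣ S ∣ ≡ r × ¬ Cross (class {n}) S) → SurjectiveColouring n r (suc m) χ
      surjective (S , h , ¬cross) zero = S , h , χ-zero (any? λ c → f c ≟ˢ S) ¬cross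
      surjective _ (suc c) = f c , proj₁ (f-ok c) , χ-suc (any? λ c′ → f c′ ≟ˢ f c) refl

    -- Vertices `0` and `ℓ` lie in one class. The set is needed to make the further colour occur.
    noncrossing : ∀ n → ℓ + r ≤ n → ∃ λ (S : Subset n) → ∣ S ∣ ≡ r × ¬ Cross (class {n}) S
    noncrossing n n≥ = finish (extend r Y ∅ ∣Y∣≤ (≤-trans (+-monoˡ-≤ r (∣∅∣≤ {n} 0)) (≤-trans (m≤n+m r ℓ) n≥)))
      where
      ℓ<n : ℓ < n
      ℓ<n = <-≤-trans (m<m+n ℓ (≤-trans (s≤s z≤n) 4≤r)) n≥
      x y : Fin n
      x = fromℕ< (≤-trans (s≤s z≤n) ℓ<n)
      y = fromℕ< ℓ<n
      Y = add x (add y ∅)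
      ∣Y∣≤ : ∣ Y ∣ ≤ r
      ∣Y∣≤ = ≤-trans (∣add∣≤ x (add y ∅)) (≤-trans (s≤s (≤-trans (∣add∣≤ y (∅ {n})) (s≤s (∣∅∣≤ {n} 0)))) (≤-trans (s≤s (s≤s z≤n)) 4≤r))
      tx : toℕ x ≡ 0
      tx = toℕ-fromℕ< (≤-trans (s≤s z≤n) ℓ<n)
      ty : toℕ y ≡ ℓ
      ty = toℕ-fromℕ< ℓ<n
      same : residue (toℕ x) ≡ residue (toℕ y)
      same = %⇒residue≡ (toℕ x) (toℕ y) (trans (cong (_% ℓ) tx) (sym (trans (cong (_% ℓ) ty) (n%n≡0 ℓ))))
      finish : (∃ λ S → (∀ {z} → z ∈ Y → z ∈ S) × ∣ S ∣ ≡ r × (∀ {z} → z ∈ S → z ∈ Y ⊎ z ∉ ∅)) → ∃ λ (S : Subset n) → ∣ S ∣ ≡ r × ¬ Cross (class {n}) S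
      finish (S , Y⊆S , h , _) = S , h , λ (_ , inj) →
        contradiction (trans (sym tx) (trans (cong toℕ (inj x y (Y⊆S (v∈add x _)) (Y⊆S (⊆add x _ (v∈add y ∅))) (cong just same))) ty)) λ ()

    lower : ∀ n → ℓ + r ≤ n → ∀ v m → 1 ≤ m → m < turan r n ℓ + 2 → ¬ ForcesRainbow n r (Expansion r K (VarAdj v ℓ t)) m
    -- Only `m` crossing sets get colours of their own. For fewer than `turan r n ℓ + 1` colours the
    -- remaining crossing sets share the colour `zero`.
    lower n n≥ v (suc m) _ m< forces = finish (#-choose (sets-unique n) (λ S → has? r S ×-dec cross? (class {n}) S)
        (≤-trans (≤-pred (≤-pred (≤-trans m< (≤-reflexive (+-comm (turan r n ℓ) 2))))) (≤-reflexive (turan-# r n))))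
      where
      finish : (∃ λ (f : Fin m → Subset n) → Injective _≡_ _≡_ f × (∀ c → ∣ f c ∣ ≡ r × Cross (class {n}) (f c))) → ⊥
      finish (f , f-inj , f-ok) = no-rainbow f f-inj f-ok v (forces (χ f f-inj f-ok) (surjective f f-inj f-ok (noncrossing n n≥)))

theorem1p5 : ∀ (ℓ r t : ℕ) → 4 ≤ r → r ≤ ℓ → 4 ≤ t →
    ∃ λ (N : ℕ) → ∀ (n : ℕ) → N ≤ n → ∀ (v : Variant) →
    ArEq n r (Expansion r (ℓ * t) (VarAdj v ℓ t)) (turan r n ℓ + 2)
theorem1p5 _ _ _ 4≤r@(s≤s (s≤s (s≤s (s≤s (z≤n {r′}))))) (s≤s (s≤s (s≤s (s≤s {n = ℓ₀} r′≤ℓ₀)))) (s≤s (s≤s (s≤s (s≤s (z≤n {t₀}))))) =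
  combine-bounds (Variants.Upper.upper ℓ₀ t₀ r′ r′≤ℓ₀)
  where
  ℓ = 4 + ℓ₀
  r = 4 + r′
  t = 4 + t₀
  combine-bounds : (∃ λ N → ∀ n → N ≤ n → ∀ v {m} (χ : Subset n → Fin m) → SurjectiveColouring n r m χ → turan r n ℓ + 2 ≤ m →
      RainbowCopy (Expansion r (ℓ * t) (VarAdj v ℓ t)) χ) →
    ∃ λ (N : ℕ) → ∀ (n : ℕ) → N ≤ n → ∀ (v : Variant) → ArEq n r (Expansion r (ℓ * t) (VarAdj v ℓ t)) (turan r n ℓ + 2)
  -- The lower bound needs `ℓ + r` vertices for a set that is not crossing.
  combine-bounds (N , up) = N + (ℓ + r) , λ n n≥ v →
    (λ χ sur → up n (≤-trans (m≤m+n N _) n≥) v χ sur ≤-refl) , Variants.Lower.lower ℓ₀ t₀ r 4≤r n (≤-trans (m≤n+m (ℓ + r) N) n≥) v
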